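{- Let $A\in\mathbb{Z}^{r\times n}$, $\mathbf{b}\in\mathbb{Z}^r$, $M=\begin{pmatrix}\mathrm{id}_n&\mathbf{0}\\ A&-\mathbf{b}\end{pmatrix}$, and let $M_k\langle I;J\rangle$ be a (well-defined) matrix obtained from $M$ by $k$ successive pivot operations with row index set $I\subseteq[r]$ and column index set $J\subseteq[n]$, $|I|=|J|=k$. If $i\in[r]\setminus I$, $j\in[n]\setminus J$ and the $(n+i,j)$ entry of $M_k\langle I;J\rangle$ is nonzero, then $$\mathop{\mathrm{CT}}_{\lambda_i,j}\mathcal{Z}_{\mathbf{y}}[M_k\langle I;J\rangle]=\mathcal{Z}_{\mathbf{y}}\mathop{\mathrm{CT}}_{\lambda_i,j}[M_k\langle I;J\rangle].$$
   Context: Variables: $\mathbf{y}=(y_1,\dots,y_n)$, $\Lambda=(\lambda_1,\dots,\lambda_r)$. "Fractional" means that rational exponents are allowed. $[n]=\{1,\dots,n\}$. Matrix forms. For an $(n+r)\times(n+1)$ matrix $O$ with nonzero $(n+i,j)$ entry ($i\in[r]$, $j\in[n]$), $O\leftarrow(i,j)$ is obtained from $O$ by adding $-O_{n+i,s}/O_{n+i,j}$ times column $j$ to column $s$ for all $s\ne j$; row $n+i$ and column $j$ are ignored afterwards. For $I=\{i_1,\dots,i_k\}$, $J=\{j_1,\dots,j_k\}$, $M_k\langle I;J\rangle=M\leftarrow(i_1,j_1)\leftarrow\cdots\leftarrow(i_k,j_k)$ (assuming all pivots are nonzero), with rows $n+I$ and columns $J$ ignored. With columns $\gamma_1,\dots,\gamma_{n+1}$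 of $M_k\langle I;J\rangle$ set $[M_k\langle I;J\rangle]=(\mathbf{y},\Lambda)^{\gamma_{n+1}}\big/\prod_{j\in[n]\setminus J}\big(1-(\mathbf{y},\Lambda)^{\gamma_j}\big)$, entries in ignored rows being omitted. The factor indexed by $j$ is called the $j$th denominator factor. $\mathcal{Z}_{y_j}$ acts on fractional series by keeping exactly the terms in which the exponent of $y_j$ is an integer, and $\mathcal{Z}_{\mathbf{y}}=\mathcal{Z}_{y_1}\cdots\mathcal{Z}_{y_n}$. On a fractional rational function $L/\prod_j(1-x_j)$ ($L$ a fractional Laurent polynomial, $x_j$ fractional monomials), choosing positive integers $p_j$ such that $x_j^{p_j}$ has integer exponents in $\mathbf{y}$, one has $\mathcal{Z}_{\mathbf{y}}\frac{L}{\prod_j(1-x_j)}=\frac{\mathcal{Z}_{\mathbf{y}}\left(L\prod_j\sum_{t=0}^{p_j-1}x_j^t\right)}{\prod_j(1-x_j^{p_j})}$, and $1-x_j^{p_j}$ is regarded as the $j$th denominator factor of the result. The operator $\mathrm{CT}_{\lambda,j}$. Let $F$ be a fractional rational function with pairwise coprime denominator factors indexed by $j$, the $j$th being $1-(u_j\lambda^{b_j})^{p_j}$ with $u_j$ free of $\lambda$, $b_j\in\mathbb{Q}$, and $p_j$ a positive integer. If $b_j\ne0$, replace $\lambda$ by $\lambda^m$ with $m$ a positive integer making all $\lambda$-exponents integral; rewrite each factor with $b_\ell<0$ by $1-x=-x(1-x^{ -1})$ so that all factors have the form $1-v_\ell\lambda^{a_\ell}$ with $a_\ell\ge0$; take the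 partial fraction decomposition in $\lambda$, $F=P(\lambda)+p(\lambda)\lambda^{ -t}+\sum_{\ell:\,a_\ell>0}\frac{A_\ell(\lambda)}{1-v_\ell\lambda^{a_\ell}}$ with $P,p,A_\ell$ polynomials in $\lambda$, $\deg p<t$, $\deg A_\ell<a_\ell$; then $\mathrm{CT}_{\lambda,j}F:=A_j(0)$, which does not depend on $m$. When the variable $y_j$ occurs only in $u_j=y_ju_j'$ and $p_j=1$ (as is the case for $F=[M_k\langle I;J\rangle]$, $\lambda=\lambda_i$), this equals $\mathrm{sgn}(b_j)\,\mathcal{Z}_{y_j}\big(F\cdot(1-u_j\lambda^{b_j})\big)\big|_{\lambda=u_j^{ -1/b_j}}$. -}

module Defs where

open import Data.Nat as ℕ using (ℕ)
open import Data.Integer as ℤ using (ℤ; +_; ∣_∣)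
open import Data.Rational as ℚ using (ℚ; 0ℚ; 1ℚ; ↥_; ↧ₙ_; _/_)
open import Data.Rational.Properties as ℚₚ using ()
open import Data.Fin using (Fin; zero; suc; _↑ˡ_; _↑ʳ_; splitAt)
open import Data.Fin.Properties as Finₚ using (splitAt-↑ˡ; ↑ˡ-injective)
open import Data.Fin.Subset using (Subset; ⁅_⁆; _∪_; _∈_; _∉_; ⊥)
open import Data.Fin.Subset.Properties using (_∈?_; x∈⁅x⁆; x∈p∪q⁺)
open import Data.List as List using (List; []; _∷_; _++_; length; upTo; allFin)
open import Data.List.Relation.Unary.All using (All)
open import Data.Vec as Vec using (Vec; lookup)
open import Data.Vec.Properties as Vecₚ using (lookup-map; lookup∘tabulate)
open import Data.Maybe as Maybe using (Maybe; just; nothing; maybe′)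
open import Data.Product using (Σ; Σ-syntax; ∃; ∃-syntax; _×_; _,_; proj₁; proj₂)
open import Data.Sum using (_⊎_; inj₁; inj₂)
open import Function using (_∘_; const)
open import Relation.Nullary using (Dec; yes; no; contradiction)
open import Relation.Binary.PropositionalEquality

IsInteger : ℚ → Set
IsInteger q = ↧ₙ q ≡ 1

isInteger? : ∀ q → Dec (IsInteger q)
isInteger? q = ↧ₙ q ℕ.≟ 1

*-≢0 : ∀ p q → p ≢ 0ℚ → q ≢ 0ℚ → p ℚ.* q ≢ 0ℚ
*-≢0 p q p≢0 q≢0 pq≡0 = q≢0 (begin
  q                         ≡⟨ ℚₚ.*-identityˡ q ⟨
  1ℚ ℚ.* q                  ≡⟨ cong (ℚ._* q) (ℚₚ.*-inverseˡ p) ⟨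
  ((ℚ.1/ p) ℚ.* p) ℚ.* q    ≡⟨ ℚₚ.*-assoc (ℚ.1/ p) p q ⟩
  (ℚ.1/ p) ℚ.* (p ℚ.* q)    ≡⟨ cong ((ℚ.1/ p) ℚ.*_) pq≡0 ⟩
  (ℚ.1/ p) ℚ.* 0ℚ           ≡⟨ ℚₚ.*-zeroʳ (ℚ.1/ p) ⟩
  0ℚ                        ∎)
  where
  open ≡-Reasoning
  instance _ = ℚ.≢-nonZero p≢0

ℕ⇒ℚ-≢0 : ∀ k .{{_ : ℕ.NonZero k}} → (+ k / 1) ≢ 0ℚ
ℕ⇒ℚ-≢0 (ℕ.suc k) eq =
  contradiction (subst ℚ.Positive eq (ℚₚ.normalize-pos (ℕ.suc k) 1)) λ ()

neg-≢0 : ∀ q → q ≢ 0ℚ → ℚ.- q ≢ 0ℚ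
neg-≢0 q q≢0 -q≡0 = q≢0 (ℚₚ.neg-injective -q≡0)

module Fractional (n r : ℕ) where

  -- A fractional monomial (𝐲,Λ)^e is represented by its exponent vector e:
  -- first the exponents of y₁,…,yₙ, then those of λ₁,…,λᵣ.

  Mono : Set
  Mono = Vec ℚ (n ℕ.+ r)

  y : Fin n → Fin (n ℕ.+ r)
  y j = j ↑ˡ r

  lam : Fin r → Fin (n ℕ.+ r)
  lam i = n ↑ʳ i

  _≟ᴹ_ : (e e′ : Mono) → Dec (e ≡ e′)
  _≟ᴹ_ = Vecₚ.≡-dec ℚₚ._≟_

  1ᴹ : Mono
  1ᴹ = Vec.replicate _ 0ℚ

  infixl 7 _·_
  _·_ : Mono → Mono → Mono
  _·_ = Vec.zipWith ℚ._+_

  infixr 8 _^[_]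
  _^[_] : Mono → ℕ → Mono
  x ^[ k ] = Vec.map ((+ k / 1) ℚ.*_) x

  _⁻¹ : Mono → Mono
  _⁻¹ = Vec.map (λ q → ℚ.- q)

  lam^ : Fin r → ℚ → Mono
  lam^ i q = Vec.updateAt 1ᴹ (lam i) (const q)

  -- The coefficient of e is the sum of the coefficients listed with e.

  Laurent : Set
  Laurent = List (ℚ × Mono)

  coeff : Laurent → Mono → ℚ
  coeff []            e = 0ℚ
  coeff ((c , x) ∷ L) e with x ≟ᴹ e
  ... | yes _ = c ℚ.+ coeff L e
  ... | no  _ = coeff L e

  infix 4 _≋_
  _≋_ : Laurent → Laurent → Set
  L ≋ L′ = ∀ e → coeff L e ≡ coeff L′ e

  1ᴸ : Laurent
  1ᴸ = (1ℚ , 1ᴹ) ∷ []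

  infixl 7 _*ᴸ_
  _*ᴸ_ : Laurent → Laurent → Laurent
  _*ᴸ_ = List.cartesianProductWith λ (c , x) (d , z) → c ℚ.* d , x · z

  ∏ᴸ : List Laurent → Laurent
  ∏ᴸ = List.foldr _*ᴸ_ 1ᴸ

  1-_ : Mono → Laurent
  1- x = (1ℚ , 1ᴹ) ∷ (ℚ.- 1ℚ , x) ∷ []

  -- The monomials x allowed in a denominator factor 1 - x: those other than 1.

  Mono≢1 : Set
  Mono≢1 = Σ[ x ∈ Mono ] ∃[ k ] lookup x k ≢ 0ℚ

  infixr 8 _^≢1[_]
  _^≢1[_] : Mono≢1 → (k : ℕ) → .{{ℕ.NonZero k}} → Mono≢1
  (x , t , x≢0) ^≢1[ k ] = x ^[ k ] , t ,
    *-≢0 _ _ (ℕ⇒ℚ-≢0 k) x≢0 ∘ trans (sym (lookup-map t _ x))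

  _⁻¹≢1 : Mono≢1 → Mono≢1
  (x , t , x≢0) ⁻¹≢1 = x ⁻¹ , t , neg-≢0 _ x≢0 ∘ trans (sym (lookup-map t _ x))

  infix 3 _/∏_

  -- num / ∏_{x ∈ den} (1 - x)

  record FracRat : Set where
    constructor _/∏_
    field
      num : Laurent
      den : List Mono≢1

    ∏den : Laurent
    ∏den = ∏ᴸ (List.map (λ x → 1- proj₁ x) den)

  open FracRat public

  infix 4 _≈_
  _≈_ : FracRat → FracRat → Set
  F ≈ G = num F *ᴸ ∏den G ≋ num G *ᴸ ∏den F

  0ᶠ : FracRat
  0ᶠ = [] /∏ []

  infixl 6 _+ᶠ_
  _+ᶠ_ : FracRat → FracRat → FracRat
  F +ᶠ G = (num F *ᴸ ∏den G ++ num G *ᴸ ∏den F) /∏ (den F ++ den G)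

  ∑ᶠ : List FracRat → FracRat
  ∑ᶠ = List.foldr _+ᶠ_ 0ᶠ

  infixl 7 _⊙_
  _⊙_ : Mono → FracRat → FracRat
  x ⊙ F = ((1ℚ , x) ∷ []) *ᴸ num F /∏ den F

  _/1-_ : FracRat → Mono≢1 → FracRat
  F /1- x = num F /∏ (x ∷ den F)

  -- A fractional rational function whose denominator factors carry labels in
  -- [n]; there is no factor with label j when  factor j ≡ nothing.

  record Labelled : Set where
    constructor _/∏_
    field
      num    : Laurent
      factor : Fin n → Maybe Mono≢1

  open Labelled public using (factor)

  ⌞_⌟ : Labelled → FracRat
  ⌞ F ⌟ = Labelled.num F /∏ List.mapMaybe (factor F) (allFin n)

  𝒵y : Fin n → Laurent → Laurent
  𝒵y j = List.filter λ (_ , e) → isInteger? (lookup e (y j))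

  𝒵ᴸ : Laurent → Laurent
  𝒵ᴸ L = List.foldr 𝒵y L (allFin n)

  -- A choice, for every monomial x, of p > 0 such that x^p is integral in 𝐲.

  record Clearing : Set where
    field
      p        : Mono → ℕ
      positive : ∀ x → ℕ.NonZero (p x)
      integral : ∀ x j → IsInteger (lookup (x ^[ p x ]) (y j))

    geometric : Mono → Laurent
    geometric x = List.map (λ t → 1ℚ , x ^[ t ]) (upTo (p x))

    clear : Mono≢1 → Mono≢1
    clear x = x ^≢1[ p (proj₁ x) ]
      where instance _ = positive (proj₁ x)

    𝒵num : FracRat → Laurent
    𝒵num F = 𝒵ᴸ (num F *ᴸ ∏ᴸ (List.map (geometric ∘ proj₁) (den F)))

  𝒵 : Clearing → FracRat → FracRat
  𝒵 c F = Clearing.𝒵num c F /∏ List.map (Clearing.clear c) (den F)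

  𝒵ˡ : Clearing → Labelled → Labelled
  𝒵ˡ c F = Clearing.𝒵num c ⌞ F ⌟ /∏ (Maybe.map (Clearing.clear c) ∘ factor F)

  module _ (i : Fin r) (m : ℕ) where

    scale : ∀ (e : Mono) t → Dec (t ≡ lam i) → ℚ
    scale e t (yes _) = (+ m / 1) ℚ.* lookup e t
    scale e t (no _)  = lookup e t

    scale-≢0 : ∀ .{{_ : ℕ.NonZero m}} e t d → lookup e t ≢ 0ℚ → scale e t d ≢ 0ℚ
    scale-≢0 e t (yes _) = *-≢0 _ _ (ℕ⇒ℚ-≢0 m)
    scale-≢0 e t (no _)  = λ e≢0 → e≢0

    substᴹ : Mono → Mono
    substᴹ e = Vec.tabulate λ t → scale e t (t Finₚ.≟ lam i)

    subst≢1 : .{{ℕ.NonZero m}} → Mono≢1 → Mono≢1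
    subst≢1 (e , t , e≢0) = substᴹ e , t ,
      scale-≢0 e t (t Finₚ.≟ lam i) e≢0 ∘ trans (sym (lookup∘tabulate _ t))

    subst-lam : .{{ℕ.NonZero m}} → Labelled → Labelled
    subst-lam F = List.map (λ (c , e) → c , substᴹ e) (Labelled.num F)
               /∏ (Maybe.map subst≢1 ∘ factor F)

  module _ (i : Fin r) where

    exponent : Mono → ℚ
    exponent e = lookup e (lam i)

    LamIntegral : Labelled → Set
    LamIntegral F = All (λ (_ , e) → IsInteger (exponent e)) (Labelled.num F)
                  × (∀ ℓ x → factor F ℓ ≡ just x → IsInteger (exponent (proj₁ x)))

    LamFree : FracRat → Set
    LamFree F = All (λ (_ , e) → exponent e ≡ 0ℚ) (num F)
              × All (λ x → exponent (proj₁ x) ≡ 0ℚ) (den F)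

    -- x or x⁻¹, whichever has nonnegative exponent of λᵢ: the monomial v λᵢ^a of
    -- the rewritten factor 1 - v λᵢ^a.
    nonneg : Mono≢1 → Mono≢1
    nonneg x with 0ℚ ℚ.≤? exponent (proj₁ x)
    ... | yes _ = x
    ... | no  _ = x ⁻¹≢1

    -- The exponent a above, when exponent x is an integer.
    degree : Mono≢1 → ℕ
    degree x = ∣ ↥ exponent (proj₁ x) ∣

    -- Polynomials in λᵢ, as lists of coefficients, constant coefficient first.
    -- A polynomial has degree < a iff it has such a list of length ≤ a.

    record Poly : Set where
      field
        coeffs : List FracRat
        free   : All LamFree coeffs

    open Poly public

    ⟦_⟧ : Poly → FracRat
    ⟦ A ⟧ = List.foldr (λ c F → c +ᶠ lam^ i 1ℚ ⊙ F) 0ᶠ (coeffs A)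

    _at0 : Poly → FracRat
    A at0 = Maybe.fromMaybe 0ᶠ (List.head (coeffs A))

    infix 4 deg_<_
    deg_<_ : Poly → ℕ → Set
    deg A < a = length (coeffs A) ℕ.≤ a

    -- The factors with a_ℓ = 0 are included in the sum of the decomposition, but
    -- for them A ℓ is forced to be the zero polynomial.

    record PartialFractions (F : Labelled) : Set where
      field
        m          : ℕ
        {{m-pos}}  : ℕ.NonZero m

      F′ : Labelled
      F′ = subst-lam i m F

      field
        integral   : LamIntegral F′
        P p        : Poly
        t          : ℕ
        A          : Fin n → Poly
        deg-p      : deg p < t
        deg-A      : ∀ ℓ x → factor F′ ℓ ≡ just x → deg A ℓ < degree x
        decomposed : ⌞ F′ ⌟ ≈
          ⟦ P ⟧ +ᶠ lam^ i (ℚ.- (+ t / 1)) ⊙ ⟦ p ⟧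
            +ᶠ ∑ᶠ (List.map (λ ℓ → maybe′ (λ x → ⟦ A ℓ ⟧ /1- nonneg x) 0ᶠ (factor F′ ℓ))
                            (allFin n))

    -- H is the value, up to _≈_, of the operator CT_{λᵢ,j} at F. That there is
    -- exactly one value when the denominator factors are pairwise coprime is not
    -- built in.

    CT : Fin n → Labelled → FracRat → Set
    CT j F H =
      (∃[ x ] factor F j ≡ just x × exponent (proj₁ x) ≢ 0ℚ)
      × Σ[ D ∈ PartialFractions F ] H ≈ PartialFractions.A D j at0

  Matrix : Set
  Matrix = Fin (n ℕ.+ r) → Fin (n ℕ.+ 1) → ℚ

  col : Fin n → Fin (n ℕ.+ 1)
  col j = j ↑ˡ 1

  lastCol : Fin (n ℕ.+ 1)
  lastCol = n ↑ʳ zero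

  δ : Fin n → Fin n → ℚ
  δ s t with s Finₚ.≟ t
  ... | yes _ = 1ℚ
  ... | no  _ = 0ℚ

  initial : (Fin r → Fin n → ℤ) → (Fin r → ℤ) → Matrix
  initial A b s t with splitAt n s | splitAt n t
  ... | inj₁ j | inj₁ j′ = δ j j′
  ... | inj₁ j | inj₂ _  = 0ℚ
  ... | inj₂ i | inj₁ j′ = A i j′ / 1
  ... | inj₂ i | inj₂ _  = (ℤ.- b i) / 1

  pivot : (O : Matrix) (i : Fin r) (j : Fin n) → .{{ℚ.NonZero (O (lam i) (col j))}} → Matrix
  pivot O i j t s with s Finₚ.≟ col j
  ... | yes _ = O t s
  ... | no  _ = O t s ℚ.+ (ℚ.- (O (lam i) s ℚ.÷ O (lam i) (col j))) ℚ.* O t (col j)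

  -- Pivots A b k I J O: O is a well-defined M_k⟨I;J⟩.

  data Pivots (A : Fin r → Fin n → ℤ) (b : Fin r → ℤ) :
              ℕ → Subset r → Subset n → Matrix → Set where
    start : Pivots A b 0 ⊥ ⊥ (initial A b)
    step  : ∀ {k I J O} → Pivots A b k I J O →
            ∀ i j → i ∉ I → j ∉ J → (O≢0 : O (lam i) (col j) ≢ 0ℚ) →
            Pivots A b (ℕ.suc k) (⁅ i ⁆ ∪ I) (⁅ j ⁆ ∪ J)
                   (pivot O i j {{ℚ.≢-nonZero O≢0}})

  -- The column as a monomial, the entries in the rows n + I being omitted.
  column : Subset r → Matrix → Fin (n ℕ.+ 1) → Mono
  column I O s = Vec.tabulate entry
    module Column where
    omit : ∀ t → Fin n ⊎ Fin r → ℚ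
    omit t (inj₁ _) = O t s
    omit t (inj₂ i) with i ∈? I
    ... | yes _ = 0ℚ
    ... | no  _ = O t s

    entry : Fin (n ℕ.+ r) → ℚ
    entry t = omit t (splitAt n t)

  -- For s ∉ J, row s is that of the identity matrix; hence the columns outside J
  -- are nonzero.
  module _ {A : Fin r → Fin n → ℤ} {b : Fin r → ℤ} where

    row-fixed : ∀ {k I J O} → Pivots A b k I J O → ∀ {s} → s ∉ J →
                ∀ t → O (y s) (col t) ≡ δ s t
    row-fixed start {s} _ t
      rewrite splitAt-↑ˡ n s r | splitAt-↑ˡ n t 1 = refl
    row-fixed (step {O = O} π i j i∉I j∉J O≢0) {s} s∉ t with col t Finₚ.≟ col j
    ... | yes _ = row-fixed π (s∉ ∘ x∈p∪q⁺ ∘ inj₂) t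
    ... | no  _ rewrite row-fixed π (s∉ ∘ x∈p∪q⁺ ∘ inj₂) t
                      | row-fixed π (s∉ ∘ x∈p∪q⁺ ∘ inj₂) j
                with s Finₚ.≟ j
    ...   | yes refl = contradiction (x∈p∪q⁺ (inj₁ (x∈⁅x⁆ j))) s∉
    ...   | no  _ = trans (cong (δ s t ℚ.+_) (ℚₚ.*-zeroʳ (ℚ.- (O (lam i) (col t) ℚ.÷ O (lam i) (col j)))))
                          (ℚₚ.+-identityʳ (δ s t))
      where instance _ = ℚ.≢-nonZero O≢0

    δ-diagonal : ∀ s → δ s s ≡ 1ℚ
    δ-diagonal s with s Finₚ.≟ s
    ... | yes _  = refl
    ... | no s≢s = contradiction refl s≢s

    column-diagonal : ∀ {k I J O} → Pivots A b k I J O → ∀ {s} → s ∉ J →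
                      lookup (column I O (col s)) (y s) ≡ 1ℚ
    column-diagonal {I = I} {O = O} π {s} s∉J =
      trans (lookup∘tabulate (Column.entry I O (col s)) (y s))
        (trans (cong (Column.omit I O (col s) (y s)) (splitAt-↑ˡ n s r))
          (trans (row-fixed π s∉J s) (δ-diagonal s)))

    bracket : ∀ {k I J O} → Pivots A b k I J O → Labelled
    bracket {I = I} {J} {O} π =
      ((1ℚ , column I O lastCol) ∷ []) /∏ factors
      where
      factors : Fin n → Maybe Mono≢1
      factors j with j ∈? J
      ... | yes _  = nothing
      ... | no j∉J = just (column I O (col j) , y j ,
                           λ eq → ℚₚ.1≢0 (trans (sym (column-diagonal π j∉J)) eq))

{-# OPTIONS --safe #-}
module Submission where

-- Let v be the monomial of the j-th denominator factor or its inverse, such that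
-- its exponent b of λᵢ is positive. Keep the terms whose exponent of λᵢ lies in bℤ
-- and substitute v^(-1/b) for λᵢ: this kills the multiples of 1 - v as well as the
-- terms of degree strictly between 0 and b. Hence it reads off A_j(0) from N when
-- F = N / ((1 - v) D), provided that the monomials of D are kept. The operator 𝒵 has
-- the same shape, being the restriction to a subgroup of the monomials.
--
-- Replace the other factors 1 - x by suitable 1 - z with z a power of x. Then both
-- sides have the same denominator, and the numerators are compared for a single
-- monomial e of N: multiplication by 1 + v + … + v^(p-1), which turns 1 - v into
-- 1 - v^p, yields exactly one term with exponent of λᵢ in pbℤ if that of e lies in
-- bℤ, and none otherwise.
--
-- Partial fraction decompositions exist by the Bézout identity
-- (1 - x^b) - (1 - u^a) = u^a (1 - z) with z = x^b u^(-a), where a and b are the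
-- exponents of λᵢ in x and u, so that z is free of λᵢ. Here z ≠ 1, because every
-- factor has a variable y_ℓ that does not occur in the others.

open import Defs
open import Algebra.Bundles using (CommutativeRing)
open import Algebra.Structures using (IsCommutativeRing)
open import Level using (0ℓ)
open import Data.Empty using (⊥)
open import Data.Nat as ℕ using (ℕ; zero; suc; z≤n; s≤s; NonZero)
import Data.Nat.Properties as ℕₚ
import Data.Nat.Coprimality as Coprimality
open import Data.Integer as ℤ using (ℤ; +_; ∣_∣)
import Data.Integer.Properties as ℤₚ
import Data.Integer.Solver
open import Data.Rational as ℚ using (ℚ; 0ℚ; 1ℚ; ↥_; ↧ₙ_; _/_; mkℚ)
import Data.Rational.Properties as ℚₚ
open import Data.Rational.Solver using (module +-*-Solver)
open import Data.Fin using (Fin; zero; suc; splitAt)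
import Data.Fin.Properties as Finₚ
open import Data.Fin.Subset using (Subset; _∉_)
open import Data.Fin.Subset.Properties using (_∈?_)
open import Data.List as List using (List; []; _∷_; _++_; length; upTo; allFin)
import Data.List.Properties as Listₚ
open import Data.List.Membership.Propositional as List∈ using (_∈_)
open import Data.List.Membership.Propositional.Properties using (∈-allFin)
open import Data.List.Relation.Unary.All as All using (All; []; _∷_)
import Data.List.Relation.Unary.All.Properties as Allₚ
open import Data.List.Relation.Unary.AllPairs using ([]; _∷_)
open import Data.List.Relation.Unary.Any using (here; there)
open import Data.List.Relation.Unary.Unique.Propositional using (Unique)
import Data.List.Relation.Unary.Unique.Propositional.Properties as Uniqueₚ
open import Data.List.Relation.Binary.Pointwise as Pointwise using (Pointwise; []; _∷_)
open import Data.Maybe as Maybe using (Maybe; just; nothing; maybe′)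
open import Data.Product using (∃; _×_; _,_; proj₁; proj₂)
open import Data.Sum using (_⊎_; inj₁; inj₂)
open import Data.Vec as Vec using (Vec; lookup)
open import Data.Vec.Properties as Vecₚ using (lookup-map; lookup∘tabulate; lookup-zipWith; lookup-replicate)
open import Function using (_∘_; const; id)
open import Relation.Nullary using (Dec; yes; no; ¬_; contradiction)
open import Relation.Nullary.Decidable using (¬?)

-- `CT` relates a function to the constant term of any one of its decompositions, and nothing in it
-- says that two decompositions agree. So every decomposition, with every exponent `m` of the
-- substitution for λᵢ, has to be evaluated by data that depend on F alone, and existence has to be
-- shown on both sides.
--
-- `_≈_` is cross multiplication, hence even its transitivity requires denominators that can be
-- cancelled. It is enough that 1 - x is not a zero divisor for x ≠ 1; computations then take place
-- in the localisation at the regular elements.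
--
-- Dropping the exponents of λᵢ outside bℤ stands for averaging over the b solutions λᵢ of v = 1, so
-- that no roots of unity are needed. The price is that the truncated substitution respects a
-- product only if one factor consists of kept terms. This is why denominator factors are raised to
-- powers: their monomials must be kept, and their images must still differ from 1.

module Localisation (R : CommutativeRing 0ℓ 0ℓ) where

  open CommutativeRing R
  open import Algebra.Properties.Ring ring using (-‿distribˡ-*)
  open import Algebra.Solver.Ring.NaturalCoefficients.Default commutativeSemiring
  open import Relation.Binary.Reasoning.Setoid setoid

  -- Regular elements and the ring of fractions

  record Regular (d : Carrier) : Set where
    constructor mkRegular
    field cancel : ∀ x y → d * x ≈ d * y → x ≈ y
  open Regular public

  opaque
    1-regular : Regular 1#
    cancel 1-regular _ _ eq = trans (sym (*-identityˡ _)) (trans eq (*-identityˡ _))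

    *-regular : ∀ {d e} → Regular d → Regular e → Regular (d * e)
    cancel (*-regular rd re) _ _ eq =
      cancel re _ _ (cancel rd _ _ (trans (sym (*-assoc _ _ _)) (trans eq (*-assoc _ _ _))))

    Regular-resp : ∀ {d e} → d ≈ e → Regular d → Regular e
    cancel (Regular-resp eq r) _ _ p = cancel r _ _ (trans (*-congʳ eq) (trans p (*-congʳ (sym eq))))

  infix 8 _÷_
  record Fraction : Set where
    constructor _÷_
    field
      numer : Carrier
      denom : Carrier
      {reg} : Regular denom
  open Fraction

  infix 4 _≃_
  record _≃_ (p q : Fraction) : Set where
    constructor mk≃
    field cross : numer p * denom q ≈ numer q * denom p
  open _≃_ public

  infixl 6 _⊕_
  infixl 7 _⊗_
  opaque
    _⊕_ _⊗_ : Fraction → Fraction → Fraction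
    p ⊕ q = _÷_ (numer p * denom q + numer q * denom p) (denom p * denom q)
                {*-regular (reg p) (reg q)}
    p ⊗ q = _÷_ (numer p * numer q) (denom p * denom q) {*-regular (reg p) (reg q)}

    ⊖_ : Fraction → Fraction
    ⊖ p = _÷_ (- numer p) (denom p) {reg p}

    ι : Carrier → Fraction
    ι a = _÷_ a 1# {1-regular}

  opaque
    unfolding _⊕_ _⊗_ ⊖_ ι

    ÷-⊕ : ∀ a b c d {r : Regular b} {r′ : Regular d} {r″ : Regular (b * d)} →
          _÷_ (a * d + c * b) (b * d) {r″} ≃ _÷_ a b {r} ⊕ _÷_ c d {r′}
    ÷-⊕ a b c d = mk≃ refl

    ÷-⊗ : ∀ a c d {r r′ : Regular d} → _÷_ (a * c) d {r} ≃ ι a ⊗ _÷_ c d {r′}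
    ÷-⊗ a c d = mk≃ (*-congˡ (*-identityˡ d))

    ι-* : ∀ a b → ι (a * b) ≃ ι a ⊗ ι b
    ι-* a b = mk≃ (solve 2 (λ a b → (a :* b) :* (con 1 :* con 1) := (a :* b) :* con 1) refl a b)

    ÷-* : ∀ a d {r : Regular d} → _÷_ a d {r} ⊗ ι d ≃ ι a
    ÷-* a d = mk≃ (solve 2 (λ a d → (a :* d) :* con 1 := a :* (d :* con 1)) refl a d)

    ÷-cong : ∀ {a a′ b b′} {r : Regular b} {r′ : Regular b′} → a ≈ a′ → b ≈ b′ →
             _÷_ a b {r} ≃ _÷_ a′ b′ {r′}
    ÷-cong eq eq′ = mk≃ (*-cong eq (sym eq′))

    ÷-cancel : ∀ a d b {r : Regular (d * b)} {r′ : Regular b} →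
               _÷_ a (d * b) {r} ⊗ ι d ≃ _÷_ a b {r′}
    ÷-cancel a d b = mk≃ (solve 3 (λ a d b → (a :* d) :* b := a :* ((d :* b) :* con 1)) refl a d b)

    ι-cong : ∀ {a b} → a ≈ b → ι a ≃ ι b
    ι-cong eq = mk≃ (*-congʳ eq)

    ι-injective : ∀ {a b} → ι a ≃ ι b → a ≈ b
    ι-injective (mk≃ eq) = trans (sym (*-identityʳ _)) (trans eq (*-identityʳ _))

    ι-+ : ∀ a b → ι (a + b) ≃ ι a ⊕ ι b
    ι-+ a b = mk≃ (solve 2 (λ a b → (a :+ b) :* (con 1 :* con 1)
                              := (a :* con 1 :+ b :* con 1) :* con 1) refl a b)

    ÷-⊗₂ : ∀ a b c d {r : Regular b} {r′ : Regular d} {r″ : Regular (b * d)} →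
           _÷_ (a * c) (b * d) {r″} ≃ _÷_ a b {r} ⊗ _÷_ c d {r′}
    ÷-⊗₂ a b c d = mk≃ refl

    ι-neg : ∀ a → ι (- a) ≃ ⊖ ι a
    ι-neg a = mk≃ refl

    -- Identities of fractions are reduced to identities of ring elements in this way: both sides
    -- are multiplied by a regular denominator that clears them.
    ι-cancelʳ : ∀ {d p q} → Regular d → p ⊗ ι d ≃ q ⊗ ι d → p ≃ q
    ι-cancelʳ {d} {a ÷ b} {a′ ÷ b′} rd (mk≃ eq) = mk≃ (cancel rd _ _ (begin
      d * (a * b′)          ≈⟨ solve 3 (λ a b′ d → d :* (a :* b′) := (a :* d) :* (b′ :* con 1)) refl a b′ d ⟩
      (a * d) * (b′ * 1#)   ≈⟨ eq ⟩
      (a′ * d) * (b * 1#)   ≈⟨ solve 3 (λ a b′ d → d :* (a :* b′) := (a :* d) :* (b′ :* con 1)) refl a′ b d ⟨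
      d * (a′ * b)          ∎))

    private
      -- The two hypotheses only give the conclusion multiplied by the middle denominator `d`, and
      -- its regularity is what removes it.
      ≃-trans : ∀ {p q s} → p ≃ q → q ≃ s → p ≃ s
      ≃-trans {a ÷ b} {_÷_ c d {rd}} {e ÷ f} (mk≃ u) (mk≃ v) = mk≃ (cancel rd _ _ (begin
        d * (a * f)  ≈⟨ solve 3 (λ a d f → d :* (a :* f) := (a :* d) :* f) refl a d f ⟩
        (a * d) * f  ≈⟨ *-congʳ u ⟩
        (c * b) * f  ≈⟨ solve 3 (λ b c f → (c :* b) :* f := (c :* f) :* b) refl b c f ⟩
        (c * f) * b  ≈⟨ *-congʳ v ⟩
        (e * d) * b  ≈⟨ solve 3 (λ b d e → (e :* d) :* b := d :* (e :* b)) refl b d e ⟩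
        d * (e * b)  ∎))

      ⊕-cong : ∀ {p p′ q q′} → p ≃ p′ → q ≃ q′ → p ⊕ q ≃ p′ ⊕ q′
      ⊕-cong {a ÷ b} {a′ ÷ b′} {c ÷ d} {c′ ÷ d′} (mk≃ u) (mk≃ v) = mk≃ (begin
        (a * d + c * b) * (b′ * d′)
          ≈⟨ solve 6 (λ a b c d b′ d′ → (a :* d :+ c :* b) :* (b′ :* d′)
               := (a :* b′) :* (d :* d′) :+ (c :* d′) :* (b :* b′)) refl a b c d b′ d′ ⟩
        (a * b′) * (d * d′) + (c * d′) * (b * b′)
          ≈⟨ +-cong (*-congʳ u) (*-congʳ v) ⟩
        (a′ * b) * (d * d′) + (c′ * d) * (b * b′)
          ≈⟨ solve 6 (λ a′ b c′ d b′ d′ → (a′ :* b) :* (d :* d′) :+ (c′ :* d) :* (b :* b′)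
               := (a′ :* d′ :+ c′ :* b′) :* (b :* d)) refl a′ b c′ d b′ d′ ⟩
        (a′ * d′ + c′ * b′) * (b * d) ∎)

      ⊗-cong : ∀ {p p′ q q′} → p ≃ p′ → q ≃ q′ → p ⊗ q ≃ p′ ⊗ q′
      ⊗-cong {a ÷ b} {a′ ÷ b′} {c ÷ d} {c′ ÷ d′} (mk≃ u) (mk≃ v) = mk≃ (begin
        (a * c) * (b′ * d′)  ≈⟨ swap a c b′ d′ ⟩
        (a * b′) * (c * d′)  ≈⟨ *-cong u v ⟩
        (a′ * b) * (c′ * d)  ≈⟨ swap a′ b c′ d ⟩
        (a′ * c′) * (b * d)  ∎)
        where
        swap : ∀ a b c d → (a * b) * (c * d) ≈ (a * c) * (b * d)
        swap = solve 4 (λ a b c d → (a :* b) :* (c :* d) := (a :* c) :* (b :* d)) refl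

    isCommutativeRing-fractions : IsCommutativeRing _≃_ _⊕_ _⊗_ ⊖_ (ι 0#) (ι 1#)
    isCommutativeRing-fractions = record
      { isRing = record
        { +-isAbelianGroup = record
          { isGroup = record
            { isMonoid = record
              { isSemigroup = record
                { isMagma = record
                  { isEquivalence = record
                    { refl = mk≃ refl ; sym = λ p → mk≃ (sym (cross p)) ; trans = ≃-trans }
                  ; ∙-cong = ⊕-cong }
                ; assoc = λ { (a ÷ b) (c ÷ d) (e ÷ f) → mk≃ (solve 6 (λ a b c d e f →
                    ((a :* d :+ c :* b) :* f :+ e :* (b :* d)) :* (b :* (d :* f))
                    := (a :* (d :* f) :+ (c :* f :+ e :* d) :* b) :* ((b :* d) :* f))
                    refl a b c d e f) } }
              ; identity = (λ { (a ÷ b) → mk≃ (solve 2 (λ a b →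
                    (con 0 :* b :+ a :* con 1) :* b := a :* (con 1 :* b)) refl a b) })
                , (λ { (a ÷ b) → mk≃ (solve 2 (λ a b →
                    (a :* con 1 :+ con 0 :* b) :* b := a :* (b :* con 1)) refl a b) }) }
            ; inverse = (λ { (a ÷ b) → mk≃ (*-cong-0 (trans (sym (distribʳ b (- a) a)) (trans (*-congʳ (-‿inverseˡ a)) (zeroˡ b)))) })
                      , (λ { (a ÷ b) → mk≃ (*-cong-0 (trans (sym (distribʳ b a (- a))) (trans (*-congʳ (-‿inverseʳ a)) (zeroˡ b)))) })
            ; ⁻¹-cong = λ { {a ÷ b} {c ÷ d} (mk≃ u) → mk≃ (begin
                - a * d    ≈⟨ -‿distribˡ-* a d ⟨
                - (a * d)  ≈⟨ -‿cong u ⟩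
                - (c * b)  ≈⟨ -‿distribˡ-* c b ⟩
                - c * b    ∎) } }
          ; comm = λ { (a ÷ b) (c ÷ d) → mk≃ (solve 4 (λ a b c d →
              (a :* d :+ c :* b) :* (d :* b) := (c :* b :+ a :* d) :* (b :* d)) refl a b c d) } }
        ; *-cong = ⊗-cong
        ; *-assoc = λ { (a ÷ b) (c ÷ d) (e ÷ f) → mk≃ (solve 6 (λ a b c d e f →
            ((a :* c) :* e) :* (b :* (d :* f)) := (a :* (c :* e)) :* ((b :* d) :* f)) refl a b c d e f) }
        ; *-identity = (λ { (a ÷ b) → mk≃ (solve 2 (λ a b →
              (con 1 :* a) :* b := a :* (con 1 :* b)) refl a b) })
          , (λ { (a ÷ b) → mk≃ (solve 2 (λ a b →
              (a :* con 1) :* b := a :* (b :* con 1)) refl a b) })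
        ; distrib = (λ { (a ÷ b) (c ÷ d) (e ÷ f) → mk≃ (solve 6 (λ a b c d e f →
              (a :* (c :* f :+ e :* d)) :* ((b :* d) :* (b :* f))
              := ((a :* c) :* (b :* f) :+ (a :* e) :* (b :* d)) :* (b :* (d :* f))) refl a b c d e f) })
          , (λ { (a ÷ b) (c ÷ d) (e ÷ f) → mk≃ (solve 6 (λ a b c d e f →
              ((c :* f :+ e :* d) :* a) :* ((d :* b) :* (f :* b))
              := ((c :* a) :* (f :* b) :+ (e :* a) :* (d :* b)) :* ((d :* f) :* b)) refl a b c d e f) }) }
      ; *-comm = λ { (a ÷ b) (c ÷ d) → mk≃ (solve 4 (λ a b c d →
          (a :* c) :* (d :* b) := (c :* a) :* (b :* d)) refl a b c d) } }
      where
      *-cong-0 : ∀ {a b} → a ≈ 0# → a * 1# ≈ 0# * b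
      *-cong-0 eq = trans (*-congʳ eq) (trans (zeroˡ _) (sym (zeroˡ _)))

  fractions : CommutativeRing 0ℓ 0ℓ
  fractions = record
    { Carrier = Fraction ; _≈_ = _≃_ ; _+_ = _⊕_ ; _*_ = _⊗_ ; -_ = ⊖_ ; 0# = ι 0# ; 1# = ι 1#
    ; isCommutativeRing = isCommutativeRing-fractions }

open import Relation.Binary.PropositionalEquality

-- Integral rationals

private
  /1-mkℚ : ∀ z → z / 1 ≡ mkℚ z 0 (Coprimality.sym (Coprimality.1-coprimeTo ∣ z ∣))
  /1-mkℚ z = ℚₚ.↥p/↧p≡p (mkℚ z 0 _)

/1-+ : ∀ a b → (a ℤ.+ b) / 1 ≡ (a / 1) ℚ.+ (b / 1)
/1-+ a b = sym (trans (cong₂ ℚ._+_ (/1-mkℚ a) (/1-mkℚ b))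
  (cong (_/ 1) (cong₂ ℤ._+_ (ℤₚ.*-identityʳ a) (ℤₚ.*-identityʳ b))))

/1-* : ∀ a b → (a ℤ.* b) / 1 ≡ (a / 1) ℚ.* (b / 1)
/1-* a b = sym (cong₂ ℚ._*_ (/1-mkℚ a) (/1-mkℚ b))

/1-neg : ∀ a → (ℤ.- a) / 1 ≡ ℚ.- (a / 1)
/1-neg (+ zero)     = refl
/1-neg (+ suc n)    = refl
/1-neg ℤ.-[1+ n ]   = sym (neg-involutive (+ suc n / 1))
  where open import Algebra.Properties.Group ℚₚ.+-0-group using () renaming (⁻¹-involutive to neg-involutive)

IsInteger-/1 : ∀ z → IsInteger (z / 1)
IsInteger-/1 z = cong ↧ₙ_ (/1-mkℚ z)

↥-/1 : ∀ z → ↥ (z / 1) ≡ z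
↥-/1 z = cong ↥_ (/1-mkℚ z)

/1-injective : ∀ {a b} → a / 1 ≡ b / 1 → a ≡ b
/1-injective {a} {b} eq = trans (sym (↥-/1 a)) (trans (cong ↥_ eq) (↥-/1 b))

integer-≡ : ∀ q → IsInteger q → q ≡ ↥ q / 1
integer-≡ (mkℚ z 0 c) refl = sym (ℚₚ.↥p/↧p≡p (mkℚ z 0 c))

IsInteger-+ : ∀ p q → IsInteger p → IsInteger q → IsInteger (p ℚ.+ q)
IsInteger-+ p q ip iq = subst IsInteger {(↥ p ℤ.+ ↥ q) / 1} {p ℚ.+ q}
  (trans (/1-+ (↥ p) (↥ q)) (sym (cong₂ ℚ._+_ (integer-≡ p ip) (integer-≡ q iq)))) (IsInteger-/1 (↥ p ℤ.+ ↥ q))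

IsInteger-* : ∀ p q → IsInteger p → IsInteger q → IsInteger (p ℚ.* q)
IsInteger-* p q ip iq = subst IsInteger {(↥ p ℤ.* ↥ q) / 1} {p ℚ.* q}
  (trans (/1-* (↥ p) (↥ q)) (sym (cong₂ ℚ._*_ (integer-≡ p ip) (integer-≡ q iq)))) (IsInteger-/1 (↥ p ℤ.* ↥ q))

IsInteger-neg : ∀ p → IsInteger p → IsInteger (ℚ.- p)
IsInteger-neg p ip = subst IsInteger {(ℤ.- ↥ p) / 1} {ℚ.- p}
  (trans (/1-neg (↥ p)) (cong (λ u → ℚ.- u) (sym (integer-≡ p ip)))) (IsInteger-/1 (ℤ.- ↥ p))

IsInteger-+ʳ : ∀ p q → IsInteger p → IsInteger (p ℚ.+ q) → IsInteger q
IsInteger-+ʳ p q ip ipq = subst IsInteger {ℚ.- p ℚ.+ (p ℚ.+ q)} {q}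
  (trans (sym (ℚₚ.+-assoc (ℚ.- p) p q)) (trans (cong (ℚ._+ q) (ℚₚ.+-inverseˡ p)) (ℚₚ.+-identityˡ q)))
  (IsInteger-+ (ℚ.- p) (p ℚ.+ q) (IsInteger-neg p ip) ipq)

↧-clears : ∀ q → (+ ↧ₙ q / 1) ℚ.* q ≡ ↥ q / 1
↧-clears q@(mkℚ z d c) = trans (cong (ℚ._* q) (/1-mkℚ (+ suc d)))
  (trans (cong ((mkℚ (+ suc d) 0 (Coprimality.sym (Coprimality.1-coprimeTo (suc d)))) ℚ.*_) (sym (ℚₚ.↥p/↧p≡p q))) lemma)
  where
  open import Data.Rational.Unnormalised using (mkℚᵘ; *≡*)
  import Data.Rational.Unnormalised.Properties as ℚᵘₚ
  lemma : mkℚ (+ suc d) 0 (Coprimality.sym (Coprimality.1-coprimeTo (suc d))) ℚ.* (z / suc d) ≡ z / 1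
  -- In unnormalised form both sides are explicit quotients, and the claim is an integer identity
  -- after cross multiplication.
  lemma = ℚₚ.toℚᵘ-injective (ℚᵘₚ.≃-trans (ℚₚ.toℚᵘ-homo-* (mkℚ (+ suc d) 0 (Coprimality.sym (Coprimality.1-coprimeTo (suc d)))) (z / suc d))
    (ℚᵘₚ.≃-trans (ℚᵘₚ.*-congˡ {mkℚᵘ (+ suc d) 0} (ℚₚ.toℚᵘ-fromℚᵘ (mkℚᵘ z d)))
      (ℚᵘₚ.≃-trans (*≡* (trans (ℤₚ.*-identityʳ _) (trans (ℤₚ.*-comm (+ suc d) z)
         (cong (λ k → z ℤ.* + k) (sym (ℕₚ.+-identityʳ (suc d)))))))
        (ℚᵘₚ.≃-sym (ℚₚ.toℚᵘ-fromℚᵘ (mkℚᵘ z 0))))))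

-- This supplies the exponent m with which λᵢ is replaced by λᵢ^m in `partial-fractions`, and the
-- powers of the other denominator factors in `nice-power`.
common-denominator : ∀ qs → ∃ λ m → NonZero m × All (λ q → IsInteger ((+ m / 1) ℚ.* q)) qs
common-denominator []       = 1 , _ , []
common-denominator (q ∷ qs) with common-denominator qs
... | m , m≢0 , ms = ↧ₙ q ℕ.* m , ℕₚ.m*n≢0 (↧ₙ q) m {{_}} {{m≢0}} ,
  subst IsInteger (sym eqˡ) (IsInteger-* (+ m / 1) (↥ q / 1) (IsInteger-/1 (+ m)) (IsInteger-/1 (↥ q))) ∷
  All.map (λ {p} ip → subst IsInteger (sym (eqʳ p)) (IsInteger-* (+ ↧ₙ q / 1) ((+ m / 1) ℚ.* p) (IsInteger-/1 (+ ↧ₙ q)) ip)) ms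
  where
  split : + (↧ₙ q ℕ.* m) / 1 ≡ (+ ↧ₙ q / 1) ℚ.* (+ m / 1)
  split = trans (cong (_/ 1) (ℤₚ.pos-* (↧ₙ q) m)) (/1-* (+ ↧ₙ q) (+ m))
  eqʳ : ∀ p → (+ (↧ₙ q ℕ.* m) / 1) ℚ.* p ≡ (+ ↧ₙ q / 1) ℚ.* ((+ m / 1) ℚ.* p)
  eqʳ p = trans (cong (ℚ._* p) split) (ℚₚ.*-assoc (+ ↧ₙ q / 1) (+ m / 1) p)
  eqˡ : (+ (↧ₙ q ℕ.* m) / 1) ℚ.* q ≡ (+ m / 1) ℚ.* (↥ q / 1)
  eqˡ = trans (cong (ℚ._* q) (trans split (ℚₚ.*-comm (+ ↧ₙ q / 1) (+ m / 1))))
    (trans (ℚₚ.*-assoc (+ m / 1) (+ ↧ₙ q / 1) q) (cong ((+ m / 1) ℚ.*_) (↧-clears q)))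

recip : ∀ q → q ≢ 0ℚ → ℚ
recip q q≢0 = (ℚ.1/ q) {{ℚ.≢-nonZero q≢0}}

recip-* : ∀ q q≢0 → recip q q≢0 ℚ.* q ≡ 1ℚ
recip-* q q≢0 = ℚₚ.*-inverseˡ q {{ℚ.≢-nonZero q≢0}}

module Series (n r : ℕ) where

  open Fractional n r
  open +-*-Solver using (solve; _:+_; _:*_; :-_; _:=_; con)

  -- Monomials and Laurent polynomials

  lookup-ext : ∀ {m} {x z : Vec ℚ m} → (∀ t → lookup x t ≡ lookup z t) → x ≡ z
  lookup-ext {x = x} {z} eq =
    trans (sym (Vecₚ.tabulate∘lookup x)) (trans (Vecₚ.tabulate-cong eq) (Vecₚ.tabulate∘lookup z))

  lookup-· : ∀ x z t → lookup (x · z) t ≡ lookup x t ℚ.+ lookup z t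
  lookup-· x z t = lookup-zipWith ℚ._+_ t x z

  lookup-1ᴹ : ∀ t → lookup 1ᴹ t ≡ 0ℚ
  lookup-1ᴹ t = lookup-replicate t 0ℚ

  infixr 8 _^ℚ_
  _^ℚ_ : Mono → ℚ → Mono
  x ^ℚ q = Vec.map (q ℚ.*_) x

  lookup-^ : ∀ x q t → lookup (x ^ℚ q) t ≡ q ℚ.* lookup x t
  lookup-^ x q t = lookup-map t (q ℚ.*_) x

  lookup-⁻¹ : ∀ x t → lookup (x ⁻¹) t ≡ ℚ.- lookup x t
  lookup-⁻¹ x t = lookup-map t (λ q → ℚ.- q) x

  ·-comm : ∀ x z → x · z ≡ z · x
  ·-comm x z = Vecₚ.zipWith-comm ℚₚ.+-comm x z

  ·-assoc : ∀ x z w → x · z · w ≡ x · (z · w)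
  ·-assoc = Vecₚ.zipWith-assoc ℚₚ.+-assoc

  ·-identityˡ : ∀ x → 1ᴹ · x ≡ x
  ·-identityˡ = Vecₚ.zipWith-identityˡ ℚₚ.+-identityˡ

  ·-identityʳ : ∀ x → x · 1ᴹ ≡ x
  ·-identityʳ = Vecₚ.zipWith-identityʳ ℚₚ.+-identityʳ

  ·-inverseʳ : ∀ x → x · x ⁻¹ ≡ 1ᴹ
  ·-inverseʳ = Vecₚ.zipWith-inverseʳ ℚₚ.+-inverseʳ

  ·-inverseˡ : ∀ x → x ⁻¹ · x ≡ 1ᴹ
  ·-inverseˡ = Vecₚ.zipWith-inverseˡ ℚₚ.+-inverseˡ

  ^-+ : ∀ x p q → x ^ℚ (p ℚ.+ q) ≡ x ^ℚ p · x ^ℚ q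
  ^-+ x p q = lookup-ext λ t → trans (lookup-^ x (p ℚ.+ q) t)
    (trans (ℚₚ.*-distribʳ-+ (lookup x t) p q)
      (sym (trans (lookup-· (x ^ℚ p) (x ^ℚ q) t) (cong₂ ℚ._+_ (lookup-^ x p t) (lookup-^ x q t)))))

  ^-* : ∀ x p q → x ^ℚ (p ℚ.* q) ≡ (x ^ℚ q) ^ℚ p
  ^-* x p q = lookup-ext λ t → trans (lookup-^ x (p ℚ.* q) t)
    (trans (ℚₚ.*-assoc p q (lookup x t))
      (sym (trans (lookup-^ (x ^ℚ q) p t) (cong (p ℚ.*_) (lookup-^ x q t)))))

  ^-0 : ∀ x → x ^ℚ 0ℚ ≡ 1ᴹ
  ^-0 x = lookup-ext λ t → trans (lookup-^ x 0ℚ t)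
    (trans (ℚₚ.*-zeroˡ (lookup x t)) (sym (lookup-1ᴹ t)))

  ^-1 : ∀ x → x ^ℚ 1ℚ ≡ x
  ^-1 x = lookup-ext λ t → trans (lookup-^ x 1ℚ t) (ℚₚ.*-identityˡ (lookup x t))

  -- A Laurent polynomial acts on functions of monomials, and is determined by
  -- this action; identities of Laurent polynomials are checked there.
  ⟪_⟫ : Laurent → (Mono → ℚ) → ℚ
  ⟪ [] ⟫          f = 0ℚ
  ⟪ (c , x) ∷ L ⟫ f = c ℚ.* f x ℚ.+ ⟪ L ⟫ f

  ⟪⟫-cong : ∀ L {f g} → (∀ x → f x ≡ g x) → ⟪ L ⟫ f ≡ ⟪ L ⟫ g
  ⟪⟫-cong []            eq = refl
  ⟪⟫-cong ((c , x) ∷ L) eq = cong₂ ℚ._+_ (cong (c ℚ.*_) (eq x)) (⟪⟫-cong L eq)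

  ⟪⟫-cong-All : ∀ L {f g} → All (λ (_ , x) → f x ≡ g x) L → ⟪ L ⟫ f ≡ ⟪ L ⟫ g
  ⟪⟫-cong-All []            []         = refl
  ⟪⟫-cong-All ((c , x) ∷ L) (eq ∷ eqs) = cong₂ ℚ._+_ (cong (c ℚ.*_) eq) (⟪⟫-cong-All L eqs)

  ⟪⟫-0 : ∀ L → ⟪ L ⟫ (const 0ℚ) ≡ 0ℚ
  ⟪⟫-0 []            = refl
  ⟪⟫-0 ((c , x) ∷ L) = trans (cong₂ ℚ._+_ (ℚₚ.*-zeroʳ c) (⟪⟫-0 L)) (ℚₚ.+-identityʳ 0ℚ)

  ⟪⟫-+ : ∀ L f g → ⟪ L ⟫ (λ x → f x ℚ.+ g x) ≡ ⟪ L ⟫ f ℚ.+ ⟪ L ⟫ g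
  ⟪⟫-+ []            f g = refl
  ⟪⟫-+ ((c , x) ∷ L) f g = trans (cong (c ℚ.* (f x ℚ.+ g x) ℚ.+_) (⟪⟫-+ L f g))
    (solve 5 (λ c a b u v → c :* (a :+ b) :+ (u :+ v) := (c :* a :+ u) :+ (c :* b :+ v))
      refl c (f x) (g x) (⟪ L ⟫ f) (⟪ L ⟫ g))

  ⟪⟫-* : ∀ L q f → ⟪ L ⟫ (λ x → q ℚ.* f x) ≡ q ℚ.* ⟪ L ⟫ f
  ⟪⟫-* []            q f = sym (ℚₚ.*-zeroʳ q)
  ⟪⟫-* ((c , x) ∷ L) q f = trans (cong (c ℚ.* (q ℚ.* f x) ℚ.+_) (⟪⟫-* L q f))
    (solve 4 (λ c q a u → c :* (q :* a) :+ q :* u := q :* (c :* a :+ u)) refl c q (f x) (⟪ L ⟫ f))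

  ⟪++⟫ : ∀ L M f → ⟪ L ++ M ⟫ f ≡ ⟪ L ⟫ f ℚ.+ ⟪ M ⟫ f
  ⟪++⟫ []            M f = sym (ℚₚ.+-identityˡ _)
  ⟪++⟫ ((c , x) ∷ L) M f =
    trans (cong (c ℚ.* f x ℚ.+_) (⟪++⟫ L M f)) (sym (ℚₚ.+-assoc (c ℚ.* f x) (⟪ L ⟫ f) (⟪ M ⟫ f)))

  ⟪map⟫ : ∀ L (φ : Mono → Mono) f → ⟪ List.map (λ (c , x) → c , φ x) L ⟫ f ≡ ⟪ L ⟫ (f ∘ φ)
  ⟪map⟫ []            φ f = refl
  ⟪map⟫ ((c , x) ∷ L) φ f = cong (c ℚ.* f (φ x) ℚ.+_) (⟪map⟫ L φ f)

  ⟪*⟫ : ∀ L M f → ⟪ L *ᴸ M ⟫ f ≡ ⟪ L ⟫ (λ x → ⟪ M ⟫ (λ z → f (x · z)))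
  ⟪*⟫ []            M f = refl
  ⟪*⟫ ((c , x) ∷ L) M f =
    trans (⟪++⟫ (List.map _ M) (L *ᴸ M) f) (cong₂ ℚ._+_ (row M) (⟪*⟫ L M f))
    where
    row : ∀ M → ⟪ List.map (λ (d , z) → c ℚ.* d , x · z) M ⟫ f ≡ c ℚ.* ⟪ M ⟫ (λ z → f (x · z))
    row []            = sym (ℚₚ.*-zeroʳ c)
    row ((d , z) ∷ M) = trans (cong (c ℚ.* d ℚ.* f (x · z) ℚ.+_) (row M))
      (solve 4 (λ c d a u → (c :* d) :* a :+ c :* u := c :* (d :* a :+ u)) refl c d (f (x · z)) _)

  ⟪⟫-swap : ∀ L M (f : Mono → Mono → ℚ) →
            ⟪ L ⟫ (λ x → ⟪ M ⟫ (f x)) ≡ ⟪ M ⟫ (λ z → ⟪ L ⟫ (λ x → f x z))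
  ⟪⟫-swap []            M f = sym (⟪⟫-0 M)
  ⟪⟫-swap ((c , x) ∷ L) M f = sym (trans (⟪⟫-+ M (λ z → c ℚ.* f x z) _)
    (cong₂ ℚ._+_ (⟪⟫-* M c (f x)) (sym (⟪⟫-swap L M f))))

  infix 4 _≐_
  record _≐_ (L M : Laurent) : Set where
    constructor mk≐
    field at : ∀ f → ⟪ L ⟫ f ≡ ⟪ M ⟫ f
  open _≐_ public

  indicator : Mono → Mono → ℚ
  indicator e x with x ≟ᴹ e
  ... | yes _ = 1ℚ
  ... | no  _ = 0ℚ

  coeff-⟪⟫ : ∀ L e → coeff L e ≡ ⟪ L ⟫ (indicator e)
  coeff-⟪⟫ []            e = refl
  coeff-⟪⟫ ((c , x) ∷ L) e with x ≟ᴹ e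
  ... | yes _ = cong₂ ℚ._+_ (sym (ℚₚ.*-identityʳ c)) (coeff-⟪⟫ L e)
  ... | no  _ = trans (coeff-⟪⟫ L e)
    (sym (trans (cong (ℚ._+ ⟪ L ⟫ (indicator e)) (ℚₚ.*-zeroʳ c)) (ℚₚ.+-identityˡ _)))

  ≐⇒≋ : ∀ {L M} → L ≐ M → L ≋ M
  ≐⇒≋ {L} {M} (mk≐ eq) e = trans (coeff-⟪⟫ L e) (trans (eq _) (sym (coeff-⟪⟫ M e)))

  negᴸ : Laurent → Laurent
  negᴸ = List.map λ (c , x) → ℚ.- c , x

  ⟪neg⟫ : ∀ L f → ⟪ negᴸ L ⟫ f ≡ ℚ.- ⟪ L ⟫ f
  ⟪neg⟫ []            f = refl
  ⟪neg⟫ ((c , x) ∷ L) f = trans (cong (ℚ.- c ℚ.* f x ℚ.+_) (⟪neg⟫ L f))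
    (solve 3 (λ c a u → (:- c) :* a :+ (:- u) := :- (c :* a :+ u)) refl c (f x) (⟪ L ⟫ f))

  private
    drop : Mono → Laurent → Laurent
    drop x = List.filter λ (_ , z) → ¬? (z ≟ᴹ x)

    ⟪drop⟫ : ∀ L x f → ⟪ L ⟫ f ≡ coeff L x ℚ.* f x ℚ.+ ⟪ drop x L ⟫ f
    ⟪drop⟫ [] x f = sym (trans (ℚₚ.+-identityʳ _) (ℚₚ.*-zeroˡ (f x)))
    ⟪drop⟫ ((c , z) ∷ L) x f with z ≟ᴹ x
    ... | yes refl = trans (cong (c ℚ.* f x ℚ.+_) (⟪drop⟫ L x f))
      (solve 4 (λ c a k u → c :* a :+ (k :* a :+ u) := (c :+ k) :* a :+ u)
        refl c (f x) (coeff L x) _)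
    ... | no _ = trans (cong (c ℚ.* f z ℚ.+_) (⟪drop⟫ L x f))
      (solve 3 (λ a b u → a :+ (b :+ u) := b :+ (a :+ u)) refl (c ℚ.* f z) (coeff L x ℚ.* f x) _)

    coeff-drop : ∀ L x → (∀ e → coeff L e ≡ 0ℚ) → ∀ e → coeff (drop x L) e ≡ 0ℚ
    coeff-drop L x zeros e = trans (coeff-⟪⟫ (drop x L) e) (trans (sym lemma) (trans (sym (coeff-⟪⟫ L e)) (zeros e)))
      where
      lemma : ⟪ L ⟫ (indicator e) ≡ ⟪ drop x L ⟫ (indicator e)
      lemma = trans (⟪drop⟫ L x (indicator e))
        (trans (cong (λ k → k ℚ.* indicator e x ℚ.+ ⟪ drop x L ⟫ (indicator e)) (zeros x))
          (trans (cong (ℚ._+ ⟪ drop x L ⟫ (indicator e)) (ℚₚ.*-zeroˡ (indicator e x))) (ℚₚ.+-identityˡ _)))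

    -- A list with all coefficients 0 need not be empty, since entries may cancel. Removing all
    -- entries with the monomial of the first one changes the value by the coefficient of that
    -- monomial, which is 0, and shortens the list; `k` bounds the length for the recursion.
    vanish : ∀ k L → length L ℕ.≤ k → (∀ e → coeff L e ≡ 0ℚ) → ∀ f → ⟪ L ⟫ f ≡ 0ℚ
    vanish k       []            _         zeros f = refl
    vanish (suc k) ((c , x) ∷ L) (s≤s L≤k) zeros f = begin
      ⟪ (c , x) ∷ L ⟫ f                    ≡⟨ ⟪drop⟫ ((c , x) ∷ L) x f ⟩
      coeff ((c , x) ∷ L) x ℚ.* f x ℚ.+ ⟪ drop x ((c , x) ∷ L) ⟫ f
        ≡⟨ cong₂ ℚ._+_ (trans (cong (ℚ._* f x) (zeros x)) (ℚₚ.*-zeroˡ (f x)))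
             (vanish k (drop x ((c , x) ∷ L)) shorter (coeff-drop ((c , x) ∷ L) x zeros) f) ⟩
      0ℚ ℚ.+ 0ℚ                            ≡⟨⟩
      0ℚ ∎
      where
      open ≡-Reasoning
      shorter : length (drop x ((c , x) ∷ L)) ℕ.≤ k
      shorter with x ≟ᴹ x
      ... | yes _  = ℕₚ.≤-trans (Listₚ.length-filter _ L) L≤k
      ... | no x≢x = contradiction refl x≢x

  ≋⇒≐ : ∀ {L M} → L ≋ M → L ≐ M
  ≋⇒≐ {L} {M} eq = mk≐ λ f → begin
    ⟪ L ⟫ f                                ≡⟨ solve 2 (λ a b → a := b :+ (a :+ (:- b))) refl (⟪ L ⟫ f) (⟪ M ⟫ f) ⟩
    ⟪ M ⟫ f ℚ.+ (⟪ L ⟫ f ℚ.+ ℚ.- ⟪ M ⟫ f)  ≡⟨ cong (⟪ M ⟫ f ℚ.+_) (trans (sym (split f)) (vanish _ (L ++ negᴸ M) ℕₚ.≤-refl zeros f)) ⟩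
    ⟪ M ⟫ f ℚ.+ 0ℚ                         ≡⟨ ℚₚ.+-identityʳ _ ⟩
    ⟪ M ⟫ f                                ∎
    where
    open ≡-Reasoning
    split : ∀ f → ⟪ L ++ negᴸ M ⟫ f ≡ ⟪ L ⟫ f ℚ.+ ℚ.- ⟪ M ⟫ f
    split f = trans (⟪++⟫ L (negᴸ M) f) (cong (⟪ L ⟫ f ℚ.+_) (⟪neg⟫ M f))
    zeros : ∀ e → coeff (L ++ negᴸ M) e ≡ 0ℚ
    zeros e = trans (coeff-⟪⟫ (L ++ negᴸ M) e) (trans (split (indicator e))
      (trans (cong (λ k → k ℚ.+ ℚ.- ⟪ M ⟫ (indicator e)) (trans (sym (coeff-⟪⟫ L e)) (trans (eq e) (coeff-⟪⟫ M e))))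
        (ℚₚ.+-inverseʳ (⟪ M ⟫ (indicator e)))))

  ≐-refl : ∀ {L} → L ≐ L
  ≐-refl = mk≐ λ _ → refl

  ≐-sym : ∀ {L M} → L ≐ M → M ≐ L
  ≐-sym (mk≐ p) = mk≐ λ f → sym (p f)

  ≐-trans : ∀ {L M N} → L ≐ M → M ≐ N → L ≐ N
  ≐-trans (mk≐ p) (mk≐ q) = mk≐ λ f → trans (p f) (q f)

  laurents : CommutativeRing 0ℓ 0ℓ
  laurents = record
    { Carrier = Laurent ; _≈_ = _≐_ ; _+_ = _++_ ; _*_ = _*ᴸ_ ; -_ = negᴸ ; 0# = [] ; 1# = 1ᴸ
    ; isCommutativeRing = record
      { isRing = record
        { +-isAbelianGroup = record
          { isGroup = record
            { isMonoid = record
              { isSemigroup = record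
                { isMagma = record
                  { isEquivalence = record { refl = ≐-refl ; sym = ≐-sym ; trans = ≐-trans }
                  ; ∙-cong = λ {L} {L′} {M} {M′} (mk≐ p) (mk≐ q) → mk≐ λ f →
                      trans (⟪++⟫ L M f) (trans (cong₂ ℚ._+_ (p f) (q f)) (sym (⟪++⟫ L′ M′ f))) }
                ; assoc = λ L M N → mk≐ λ f → cong (λ X → ⟪ X ⟫ f) (Listₚ.++-assoc L M N) }
              ; identity = (λ L → ≐-refl) , (λ L → mk≐ λ f → cong (λ X → ⟪ X ⟫ f) (Listₚ.++-identityʳ L)) }
            ; inverse = (λ L → mk≐ λ f → trans (⟪++⟫ (negᴸ L) L f)
                          (trans (cong (ℚ._+ ⟪ L ⟫ f) (⟪neg⟫ L f)) (ℚₚ.+-inverseˡ (⟪ L ⟫ f))))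
                      , (λ L → mk≐ λ f → trans (⟪++⟫ L (negᴸ L) f)
                          (trans (cong (⟪ L ⟫ f ℚ.+_) (⟪neg⟫ L f)) (ℚₚ.+-inverseʳ (⟪ L ⟫ f))))
            ; ⁻¹-cong = λ {L} {M} (mk≐ p) → mk≐ λ f →
                trans (⟪neg⟫ L f) (trans (cong (λ q → ℚ.- q) (p f)) (sym (⟪neg⟫ M f))) }
          ; comm = λ L M → mk≐ λ f → trans (⟪++⟫ L M f)
              (trans (ℚₚ.+-comm (⟪ L ⟫ f) (⟪ M ⟫ f)) (sym (⟪++⟫ M L f))) }
        ; *-cong = λ {L} {L′} {M} {M′} (mk≐ p) (mk≐ q) → mk≐ λ f → trans (⟪*⟫ L M f)
            (trans (⟪⟫-cong L (λ x → q _)) (trans (p _) (sym (⟪*⟫ L′ M′ f))))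
        ; *-assoc = λ L M N → mk≐ λ f → trans (⟪*⟫ (L *ᴸ M) N f) (trans (⟪*⟫ L M _)
            (trans (⟪⟫-cong L λ x → trans (⟪⟫-cong M λ z → ⟪⟫-cong N λ w → cong f (·-assoc x z w))
                                         (sym (⟪*⟫ M N _)))
              (sym (⟪*⟫ L (M *ᴸ N) f))))
        ; *-identity = *-idˡ , λ L → ≐-trans (*-comm L 1ᴸ) (*-idˡ L)
        ; distrib = (λ L M N → ≐-trans (*-comm L (M ++ N)) (≐-trans (distribʳ L M N)
                        (mk≐ λ f → trans (⟪++⟫ (M *ᴸ L) (N *ᴸ L) f)
                          (trans (cong₂ ℚ._+_ (at (*-comm M L) f) (at (*-comm N L) f))
                            (sym (⟪++⟫ (L *ᴸ M) (L *ᴸ N) f))))))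
                    , distribʳ }
      ; *-comm = *-comm } }
    where
    *-comm : ∀ L M → L *ᴸ M ≐ M *ᴸ L
    *-comm L M = mk≐ λ f → trans (⟪*⟫ L M f) (trans (⟪⟫-swap L M (λ x z → f (x · z)))
      (trans (⟪⟫-cong M λ z → ⟪⟫-cong L λ x → cong f (·-comm x z)) (sym (⟪*⟫ M L f))))
    *-idˡ : ∀ L → 1ᴸ *ᴸ L ≐ L
    *-idˡ L = mk≐ λ f → trans (⟪*⟫ 1ᴸ L f) (trans (ℚₚ.+-identityʳ _)
      (trans (ℚₚ.*-identityˡ _) (⟪⟫-cong L λ z → cong f (·-identityˡ z))))
    distribʳ : ∀ L M N → (M ++ N) *ᴸ L ≐ M *ᴸ L ++ N *ᴸ L
    distribʳ L M N = mk≐ λ f → trans (⟪*⟫ (M ++ N) L f) (trans (⟪++⟫ M N _)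
      (trans (cong₂ ℚ._+_ (sym (⟪*⟫ M L f)) (sym (⟪*⟫ N L f))) (sym (⟪++⟫ (M *ᴸ L) (N *ᴸ L) f))))

  module R = CommutativeRing laurents
  open Localisation laurents public

  -- Single monomials, and cancellation of 1 - x

  mono : Mono → Laurent
  mono x = (1ℚ , x) ∷ []

  ⟪mono⟫ : ∀ x f → ⟪ mono x ⟫ f ≡ f x
  ⟪mono⟫ x f = trans (ℚₚ.+-identityʳ _) (ℚₚ.*-identityˡ (f x))

  mono-· : ∀ x z → mono (x · z) ≐ mono x *ᴸ mono z
  mono-· x z = mk≐ λ f → trans (⟪mono⟫ (x · z) f)
    (sym (trans (⟪*⟫ (mono x) (mono z) f)
      (trans (⟪mono⟫ x (λ u → ⟪ mono z ⟫ (λ v → f (u · v)))) (⟪mono⟫ z (λ v → f (x · v))))))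

  ⟪1-⟫ : ∀ x f → ⟪ 1- x ⟫ f ≡ f 1ᴹ ℚ.+ ℚ.- f x
  ⟪1-⟫ x f = solve 2 (λ a b → con 1ℚ :* a :+ (con (ℚ.- 1ℚ) :* b :+ con 0ℚ) := a :+ (:- b)) refl (f 1ᴹ) (f x)

  1-+ : ∀ x → 1- x ++ mono x ≐ 1ᴸ
  1-+ x = mk≐ λ f → trans (⟪++⟫ (1- x) (mono x) f) (trans (cong₂ ℚ._+_ (⟪1-⟫ x f) (⟪mono⟫ x f))
    (trans (solve 2 (λ a b → (a :+ (:- b)) :+ b := a) refl (f 1ᴹ) (f x)) (sym (⟪mono⟫ 1ᴹ f))))

  ⟪1-*⟫ : ∀ x L f → ⟪ (1- x) *ᴸ L ⟫ f ≡ ⟪ L ⟫ f ℚ.+ ℚ.- ⟪ L ⟫ (λ z → f (x · z))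
  ⟪1-*⟫ x L f = trans (⟪*⟫ (1- x) L f) (trans (⟪1-⟫ x (λ u → ⟪ L ⟫ (λ z → f (u · z))))
    (cong (ℚ._+ ℚ.- ⟪ L ⟫ (λ z → f (x · z))) (⟪⟫-cong L λ z → cong f (·-identityˡ z))))

  -- If (1 - x) N = 0 then N is invariant under multiplication by x, and hence by
  -- x^k; for large k this moves every monomial of N off any given one.
  private
    shift : ∀ x N → (∀ f → ⟪ (1- x) *ᴸ N ⟫ f ≡ 0ℚ) → ∀ k f → ⟪ N ⟫ f ≡ ⟪ N ⟫ (λ z → f (x ^[ k ] · z))
    shift x N zeros zero    f = ⟪⟫-cong N λ z → cong f (sym (trans (cong (_· z) (^-0 x)) (·-identityˡ z)))
    shift x N zeros (suc k) f = begin
      ⟪ N ⟫ f                                ≡⟨ shift x N zeros k f ⟩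
      ⟪ N ⟫ (λ z → f (x ^[ k ] · z))         ≡⟨ once (λ z → f (x ^[ k ] · z)) ⟩
      ⟪ N ⟫ (λ z → f (x ^[ k ] · (x · z)))   ≡⟨ ⟪⟫-cong N (λ z → cong f (assoc z)) ⟩
      ⟪ N ⟫ (λ z → f (x ^[ suc k ] · z))     ∎
      where
      open ≡-Reasoning
      once : ∀ f → ⟪ N ⟫ f ≡ ⟪ N ⟫ (λ z → f (x · z))
      once f = trans (solve 2 (λ a b → a := (a :+ (:- b)) :+ b) refl (⟪ N ⟫ f) (⟪ N ⟫ (λ z → f (x · z))))
        (trans (cong (ℚ._+ ⟪ N ⟫ (λ z → f (x · z))) (trans (sym (⟪1-*⟫ x N f)) (zeros f))) (ℚₚ.+-identityˡ _))
      power : x ^[ suc k ] ≡ x ^[ k ] · x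
      power = trans (cong (x ^ℚ_) (trans (cong (_/ 1) (cong +_ (ℕₚ.+-comm 1 k))) (/1-+ (+ k) (+ 1))))
        (trans (^-+ x (+ k / 1) 1ℚ) (cong (x ^[ k ] ·_) (^-1 x)))
      assoc : ∀ z → x ^[ k ] · (x · z) ≡ x ^[ suc k ] · z
      assoc z = sym (trans (cong (_· z) power) (·-assoc (x ^[ k ]) x z))

    escape : ∀ x t (x≢0 : lookup x t ≢ 0ℚ) e (N : Laurent) →
             ∃ λ K → ∀ k → K ℕ.≤ k → All (λ (_ , z) → x ^[ k ] · z ≢ e) N
    escape x t x≢0 e []            = 0 , λ _ _ → []
    escape x t x≢0 e ((c , z) ∷ N) with escape x t x≢0 e N
    ... | K , far = suc bound ℕ.⊔ K , λ k le →
      hit k (ℕₚ.m⊔n≤o⇒m≤o (suc bound) K le) ∷ far k (ℕₚ.m⊔n≤o⇒n≤o (suc bound) K le)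
      where
      -- Coordinate t alone determines k from x^k z = e: it is this quotient. Any k beyond the
      -- absolute value of its numerator is therefore excluded.
      quotient : ℚ
      quotient = recip (lookup x t) x≢0 ℚ.* (lookup e t ℚ.+ ℚ.- lookup z t)
      bound : ℕ
      bound = ∣ ↥ quotient ∣
      hit : ∀ k → suc bound ℕ.≤ k → x ^[ k ] · z ≢ e
      hit k le eq = ℕₚ.<-irrefl (cong ∣_∣ (trans (cong ↥_ quotient-k) (↥-/1 (+ k)))) le
        where
        coordinate : (+ k / 1) ℚ.* lookup x t ℚ.+ lookup z t ≡ lookup e t
        coordinate = trans (cong (ℚ._+ lookup z t) (sym (lookup-^ x (+ k / 1) t)))
          (trans (sym (lookup-· (x ^[ k ]) z t)) (cong (λ v → lookup v t) eq))
        quotient-k : quotient ≡ + k / 1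
        quotient-k = trans (cong (λ v → recip (lookup x t) x≢0 ℚ.* (v ℚ.+ ℚ.- lookup z t)) (sym coordinate))
          (trans (solve 4 (λ i a b k → i :* ((k :* a :+ b) :+ (:- b)) := k :* (i :* a)) refl
                   (recip (lookup x t) x≢0) (lookup x t) (lookup z t) (+ k / 1))
            (trans (cong ((+ k / 1) ℚ.*_) (recip-* (lookup x t) x≢0)) (ℚₚ.*-identityʳ (+ k / 1))))

  1-‿regular : (x : Mono≢1) → Regular (1- proj₁ x)
  cancel (1-‿regular (x , t , x≢0)) L M (mk≐ eq) = ≋⇒≐ λ e → begin
    coeff L e                                          ≡⟨ coeff-⟪⟫ L e ⟩
    ⟪ L ⟫ (indicator e)                                ≡⟨ solve 2 (λ a b → a := (a :+ (:- b)) :+ b) refl (⟪ L ⟫ (indicator e)) (⟪ M ⟫ (indicator e)) ⟩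
    (⟪ L ⟫ (indicator e) ℚ.+ ℚ.- ⟪ M ⟫ (indicator e)) ℚ.+ ⟪ M ⟫ (indicator e)
      ≡⟨ cong (ℚ._+ ⟪ M ⟫ (indicator e)) (trans (sym (split (indicator e))) (zero-at e)) ⟩
    0ℚ ℚ.+ ⟪ M ⟫ (indicator e)                         ≡⟨ ℚₚ.+-identityˡ _ ⟩
    ⟪ M ⟫ (indicator e)                                ≡⟨ coeff-⟪⟫ M e ⟨
    coeff M e                                          ∎
    where
    open ≡-Reasoning
    N : Laurent
    N = L ++ negᴸ M
    split : ∀ f → ⟪ N ⟫ f ≡ ⟪ L ⟫ f ℚ.+ ℚ.- ⟪ M ⟫ f
    split f = trans (⟪++⟫ L (negᴸ M) f) (cong (⟪ L ⟫ f ℚ.+_) (⟪neg⟫ M f))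
    zeros : ∀ f → ⟪ (1- x) *ᴸ N ⟫ f ≡ 0ℚ
    zeros f = trans (⟪1-*⟫ x N f)
      (trans (cong₂ (λ a b → a ℚ.+ ℚ.- b) (split f) (split (λ z → f (x · z))))
        (trans (solve 4 (λ a b c d → (a :+ (:- b)) :+ (:- (c :+ (:- d)))
                  := (a :+ (:- c)) :+ (:- (b :+ (:- d)))) refl
                  (⟪ L ⟫ f) (⟪ M ⟫ f) (⟪ L ⟫ (λ z → f (x · z))) (⟪ M ⟫ (λ z → f (x · z))))
          (trans (cong₂ (λ a b → a ℚ.+ ℚ.- b) (sym (⟪1-*⟫ x L f)) (sym (⟪1-*⟫ x M f)))
            (trans (cong (λ a → a ℚ.+ ℚ.- ⟪ (1- x) *ᴸ M ⟫ f) (eq f)) (ℚₚ.+-inverseʳ (⟪ (1- x) *ᴸ M ⟫ f))))))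
    zero-at : ∀ e → ⟪ N ⟫ (indicator e) ≡ 0ℚ
    zero-at e with escape x t x≢0 e N
    ... | K , far = trans (shift x N zeros K (indicator e))
      (trans (⟪⟫-cong-All N (All.map (λ {z} → off z) (far K ℕₚ.≤-refl))) (⟪⟫-0 N))
      where
      off : ∀ ((_ , z) : ℚ × Mono) → x ^[ K ] · z ≢ e → indicator e (x ^[ K ] · z) ≡ 0ℚ
      off (_ , z) ne with (x ^[ K ] · z) ≟ᴹ e
      ... | yes eq = contradiction eq ne
      ... | no _   = refl

  -- A homomorphism defined on a subgroup of the monomials. T maps the terms in the
  -- domain and drops the others.
  record PartialHom : Set where
    field
      to   : Mono → Maybe Mono
      to-1 : to 1ᴹ ≡ just 1ᴹ
      to-· : ∀ {x u} z → to x ≡ just u → to (x · z) ≡ Maybe.map (u ·_) (to z)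

    extend : (Mono → ℚ) → Mono → ℚ
    extend f x = maybe′ f 0ℚ (to x)

    T : Laurent → Laurent
    T = List.mapMaybe λ (c , x) → Maybe.map (c ,_) (to x)

    ⟪T⟫ : ∀ L f → ⟪ T L ⟫ f ≡ ⟪ L ⟫ (extend f)
    ⟪T⟫ []            f = refl
    ⟪T⟫ ((c , x) ∷ L) f with to x
    ... | just u  = cong (c ℚ.* f u ℚ.+_) (⟪T⟫ L f)
    ... | nothing = trans (⟪T⟫ L f)
      (sym (trans (cong (ℚ._+ ⟪ L ⟫ (extend f)) (ℚₚ.*-zeroʳ c)) (ℚₚ.+-identityˡ _)))

    T-cong : ∀ {L M} → L ≐ M → T L ≐ T M
    T-cong {L} {M} (mk≐ eq) = mk≐ λ f → trans (⟪T⟫ L f) (trans (eq _) (sym (⟪T⟫ M f)))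

    T-++ : ∀ L M → T (L ++ M) ≡ T L ++ T M
    T-++ = Listₚ.mapMaybe-++ _

    Dom : Laurent → Set
    Dom = All λ (_ , x) → ∃ λ u → to x ≡ just u

    -- If x is in the domain, then x z is in it exactly if z is, because the domain is a subgroup.
    -- For general M the claim fails: the product of two dropped terms may be a kept one.
    T-* : ∀ {M} L → Dom M → T (M *ᴸ L) ≐ T M *ᴸ T L
    T-* {M} L dom = mk≐ λ f → begin
      ⟪ T (M *ᴸ L) ⟫ f                                          ≡⟨ ⟪T⟫ (M *ᴸ L) f ⟩
      ⟪ M *ᴸ L ⟫ (extend f)                                     ≡⟨ ⟪*⟫ M L (extend f) ⟩
      ⟪ M ⟫ (λ x → ⟪ L ⟫ (λ z → extend f (x · z)))              ≡⟨ ⟪⟫-cong-All M (All.map (λ {(_ , x)} (u , eq) → inner f x u eq) dom) ⟩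
      ⟪ M ⟫ (extend (λ u → ⟪ T L ⟫ (λ v → f (u · v))))          ≡⟨ ⟪T⟫ M _ ⟨
      ⟪ T M ⟫ (λ u → ⟪ T L ⟫ (λ v → f (u · v)))                 ≡⟨ ⟪*⟫ (T M) (T L) f ⟨
      ⟪ T M *ᴸ T L ⟫ f                                          ∎
      where
      open ≡-Reasoning
      pointwise : ∀ f x u → to x ≡ just u → ∀ z → extend f (x · z) ≡ extend (λ v → f (u · v)) z
      pointwise f x u eq z rewrite to-· z eq with to z
      ... | just v  = refl
      ... | nothing = refl
      inner : ∀ f x u → to x ≡ just u →
              ⟪ L ⟫ (λ z → extend f (x · z)) ≡ extend (λ u → ⟪ T L ⟫ (λ v → f (u · v))) x
      inner f x u eq = trans (⟪⟫-cong L (pointwise f x u eq))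
        (trans (sym (⟪T⟫ L (λ v → f (u · v))))
          (cong (maybe′ (λ u → ⟪ T L ⟫ (λ v → f (u · v))) 0ℚ) (sym eq)))

    Dom-* : ∀ {M L} → Dom M → Dom L → Dom (M *ᴸ L)
    Dom-* {[]}          []             doms = []
    Dom-* {(c , x) ∷ M} {L} ((u , eq) ∷ dom) doms =
      Allₚ.++⁺ (Allₚ.map⁺ (All.map (λ {(_ , z)} (v , eq′) → u · v ,
        trans (to-· z eq) (cong (Maybe.map (u ·_)) eq′)) doms)) (Dom-* dom doms)

    Dom-1 : Dom 1ᴸ
    Dom-1 = (1ᴹ , to-1) ∷ []

    Dom-1- : ∀ {x u} → to x ≡ just u → Dom (1- x)
    Dom-1- eq = (1ᴹ , to-1) ∷ (_ , eq) ∷ []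

    T-1- : ∀ {x u} → to x ≡ just u → T (1- x) ≡ 1- u
    T-1- eq rewrite to-1 | eq = refl

    T-mono : ∀ {x u} → to x ≡ just u → T (mono x) ≡ mono u
    T-mono eq rewrite eq = refl

  module _ (τ : PartialHom) where
    open PartialHom τ

    -- The denominators D for which T N / T D is a sensible image of N / D: T respects
    -- multiplication by D, and neither D nor its image is a zero divisor.
    record Good (D : Laurent) : Set where
      constructor good
      field
        dom       : Dom D
        regular   : Regular D
        regular-T : Regular (T D)

    Good-1 : Good 1ᴸ
    Good-1 = good Dom-1 1-regular (subst Regular (sym (T-mono to-1)) 1-regular)

    Good-* : ∀ {D E} → Good D → Good E → Good (D *ᴸ E)
    Good-* {D} {E} (good d r t) (good d′ r′ t′) = good (Dom-* d d′) (*-regular r r′)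
      (Regular-resp (≐-sym (T-* E d)) (*-regular t t′))

    Good-1- : ∀ (x u : Mono≢1) → to (proj₁ x) ≡ just (proj₁ u) → Good (1- proj₁ x)
    Good-1- x u eq = good (Dom-1- eq) (1-‿regular x)
      (subst Regular (sym (T-1- eq)) (1-‿regular u))

  -- Fractions, residues and the operator 𝒵

  module K = CommutativeRing fractions
  open import Relation.Binary.Reasoning.Setoid K.setoid
  open import Algebra.Solver.Ring.NaturalCoefficients.Default K.commutativeSemiring
    using () renaming (solve to solveᴷ; _:+_ to _⊹_; _:*_ to _⊛_; _:=_ to _⊜_; con to conᴷ)

  ∏1- : List Mono≢1 → Laurent
  ∏1- xs = ∏ᴸ (List.map (λ x → 1- proj₁ x) xs)

  ∏1-‿++ : ∀ xs ys → ∏1- (xs ++ ys) ≐ ∏1- xs *ᴸ ∏1- ys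
  ∏1-‿++ []       ys = ≐-sym (R.*-identityˡ (∏1- ys))
  ∏1-‿++ (x ∷ xs) ys = ≐-trans (R.*-congˡ {1- proj₁ x} (∏1-‿++ xs ys)) (≐-sym (R.*-assoc (1- proj₁ x) (∏1- xs) (∏1- ys)))

  ∏1-‿regular : ∀ xs → Regular (∏1- xs)
  ∏1-‿regular []       = 1-regular
  ∏1-‿regular (x ∷ xs) = *-regular (1-‿regular x) (∏1-‿regular xs)

  infixl 7 _*ᶠ_
  _*ᶠ_ : FracRat → FracRat → FracRat
  F *ᶠ G = num F *ᴸ num G /∏ (den F ++ den G)

  opaque
    frac : FracRat → Fraction
    frac F = _÷_ (num F) (∏den F) {∏1-‿regular (den F)}

    ≈⇒≃ : ∀ {F G} → F ≈ G → frac F ≃ frac G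
    ≈⇒≃ eq = mk≃ (≋⇒≐ eq)

    ≃⇒≈ : ∀ {F G} → frac F ≃ frac G → F ≈ G
    ≃⇒≈ (mk≃ eq) = ≐⇒≋ eq

    frac-0 : frac 0ᶠ ≃ K.0#
    frac-0 = K.trans (K.sym (K.*-identityʳ (frac 0ᶠ))) (÷-* [] 1ᴸ)

    frac-+ : ∀ F G → frac (F +ᶠ G) ≃ frac F K.+ frac G
    frac-+ F G = K.trans (÷-cong {r′ = *-regular (∏1-‿regular (den F)) (∏1-‿regular (den G))} ≐-refl (∏1-‿++ (den F) (den G)))
      (÷-⊕ (num F) (∏den F) (num G) (∏den G))

    frac-⊙ : ∀ x F → frac (x ⊙ F) ≃ ι (mono x) K.* frac F
    frac-⊙ x F = ÷-⊗ (mono x) (num F) (∏den F)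

    frac-/ : ∀ F x → frac (F /1- x) K.* ι (1- proj₁ x) ≃ frac F
    frac-/ F x = ÷-cancel (num F) (1- proj₁ x) (∏den F)

    frac-rep : ∀ F → frac F K.* ι (∏den F) ≃ ι (num F)
    frac-rep F = ÷-* (num F) (∏den F)

    frac-* : ∀ F G → frac (F *ᶠ G) ≃ frac F K.* frac G
    frac-* F G = K.trans (÷-cong {r′ = *-regular (∏1-‿regular (den F)) (∏1-‿regular (den G))} ≐-refl (∏1-‿++ (den F) (den G)))
      (÷-⊗₂ (num F) (∏den F) (num G) (∏den G))

    frac-/∏[] : ∀ L → frac (L /∏ []) ≃ ι L
    frac-/∏[] L = K.trans (K.sym (K.*-identityʳ _)) (÷-* L 1ᴸ)

  geom : Mono → ℕ → Laurent
  geom x k = List.map (λ t → 1ℚ , x ^[ t ]) (upTo k)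

  ^[1+] : ∀ x k → x ^[ suc k ] ≡ x · x ^[ k ]
  ^[1+] x k = trans (cong (x ^ℚ_) (/1-+ (+ 1) (+ k))) (trans (^-+ x 1ℚ (+ k / 1)) (cong (_· x ^[ k ]) (^-1 x)))

  ⟪geom⟫ : ∀ x k f → ⟪ geom x (suc k) ⟫ f ≡ ⟪ geom x k ⟫ f ℚ.+ f (x ^[ k ])
  ⟪geom⟫ x k f = trans (cong (λ ts → ⟪ List.map (λ t → 1ℚ , x ^[ t ]) ts ⟫ f) (sym (Listₚ.upTo-∷ʳ k)))
    (trans (cong (λ L → ⟪ L ⟫ f) (Listₚ.map-++ (λ t → 1ℚ , x ^[ t ]) (upTo k) (k ∷ [])))
      (trans (⟪++⟫ (geom x k) (mono (x ^[ k ])) f) (cong (⟪ geom x k ⟫ f ℚ.+_) (⟪mono⟫ (x ^[ k ]) f))))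

  1-*geom : ∀ x k → (1- x) *ᴸ geom x k ≐ 1- (x ^[ k ])
  1-*geom x k = mk≐ λ f → trans (⟪1-*⟫ x (geom x k) f) (trans (telescope k f) (sym (⟪1-⟫ (x ^[ k ]) f)))
    where
    telescope : ∀ k f → ⟪ geom x k ⟫ f ℚ.+ ℚ.- ⟪ geom x k ⟫ (λ z → f (x · z)) ≡ f 1ᴹ ℚ.+ ℚ.- f (x ^[ k ])
    telescope zero    f = trans (sym (ℚₚ.+-inverseʳ (f 1ᴹ))) (cong (λ z → f 1ᴹ ℚ.+ ℚ.- f z) (sym (^-0 x)))
    telescope (suc k) f =
      trans (cong₂ (λ a b → a ℚ.+ ℚ.- b) (⟪geom⟫ x k f)
              (trans (⟪geom⟫ x k (λ z → f (x · z))) (cong (λ z → ⟪ geom x k ⟫ (λ z → f (x · z)) ℚ.+ f z) (sym (^[1+] x k)))))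
        (trans (solve 4 (λ a b c d → (a :+ b) :+ (:- (c :+ d)) := (a :+ (:- c)) :+ (b :+ (:- d))) refl
                 (⟪ geom x k ⟫ f) (f (x ^[ k ])) (⟪ geom x k ⟫ (λ z → f (x · z))) (f (x ^[ suc k ])))
          (trans (cong (ℚ._+ (f (x ^[ k ]) ℚ.+ ℚ.- f (x ^[ suc k ]))) (telescope k f))
            (solve 3 (λ a b c → (a :+ (:- b)) :+ (b :+ (:- c)) := a :+ (:- c)) refl
              (f 1ᴹ) (f (x ^[ k ])) (f (x ^[ suc k ])))))

  module _ (τ : PartialHom) (v : Mono) where

    open PartialHom τ

    -- k = N / ((1 - v) D) and g = T N / T D.
    record Residue (k g : Fraction) : Set where
      constructor residue
      field
        {N D} : Laurent
        D-good : Good τ D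
        rep    : k K.* (ι (1- v) K.* ι D) ≃ ι N
        value  : g K.* ι (T D) ≃ ι (T N)

    Residue-resp : ∀ {k k′ g g′} → k ≃ k′ → g ≃ g′ → Residue k g → Residue k′ g′
    Residue-resp k≃ g≃ (residue gd rp vl) =
      residue gd (K.trans (K.*-congʳ (K.sym k≃)) rp) (K.trans (K.*-congʳ (K.sym g≃)) vl)

    -- From k (1 - v) D = N and k (1 - v) D′ = N′ follows D′ N = D N′ without any cancellation. As D
    -- and D′ consist of kept terms, T turns this into T D′ T N = T D T N′, where `T D` is regular.
    -- So the residue depends neither on the representation nor on the decomposition that it came
    -- from.
    Residue-value : ∀ {k g N D} → Residue k g → Good τ D → k K.* (ι (1- v) K.* ι D) ≃ ι N →
                    g K.* ι (T D) ≃ ι (T N)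
    Residue-value {k} {g} {N′} {D′} (residue {N = N} {D = D} (good dm _ rt) rp vl) (good dm′ _ _) rp′ =
      ι-cancelʳ rt (begin
        g K.* ι (T D′) K.* ι (T D)      ≈⟨ solveᴷ 3 (λ g a b → (g ⊛ a) ⊛ b ⊜ (g ⊛ b) ⊛ a) K.refl g (ι (T D′)) (ι (T D)) ⟩
        g K.* ι (T D) K.* ι (T D′)      ≈⟨ K.*-congʳ vl ⟩
        ι (T N) K.* ι (T D′)            ≈⟨ K.*-comm (ι (T N)) (ι (T D′)) ⟩
        ι (T D′) K.* ι (T N)            ≈⟨ ι-* (T D′) (T N) ⟨
        ι (T D′ *ᴸ T N)                 ≈⟨ ι-cong (T-* N dm′) ⟨
        ι (T (D′ *ᴸ N))                 ≈⟨ ι-cong (T-cong crossed) ⟩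
        ι (T (D *ᴸ N′))                 ≈⟨ ι-cong (T-* N′ dm) ⟩
        ι (T D *ᴸ T N′)                 ≈⟨ ι-* (T D) (T N′) ⟩
        ι (T D) K.* ι (T N′)            ≈⟨ K.*-comm (ι (T D)) (ι (T N′)) ⟩
        ι (T N′) K.* ι (T D)            ∎)
      where
      crossed : D′ *ᴸ N ≐ D *ᴸ N′
      crossed = ι-injective (begin
        ι (D′ *ᴸ N)                                   ≈⟨ ι-* D′ N ⟩
        ι D′ K.* ι N                                  ≈⟨ K.*-congˡ {ι D′} rp ⟨
        ι D′ K.* (k K.* (ι (1- v) K.* ι D))           ≈⟨ solveᴷ 4 (λ a b k c → a ⊛ (k ⊛ (c ⊛ b)) ⊜ b ⊛ (k ⊛ (c ⊛ a))) K.refl (ι D′) (ι D) k (ι (1- v)) ⟩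
        ι D K.* (k K.* (ι (1- v) K.* ι D′))           ≈⟨ K.*-congˡ {ι D} rp′ ⟩
        ι D K.* ι N′                                  ≈⟨ ι-* D N′ ⟨
        ι (D *ᴸ N′)                                   ∎)

    Residue-+ : ∀ {k k′ g g′} → Residue k g → Residue k′ g′ → Residue (k K.+ k′) (g K.+ g′)
    Residue-+ {k} {k′} {g} {g′} (residue {N = N} {D = D} gd rp vl) (residue {N = N′} {D = D′} gd′ rp′ vl′) =
      residue {N = D′ *ᴸ N ++ D *ᴸ N′} {D = D *ᴸ D′} (Good-* τ gd gd′)
        (begin
          (k K.+ k′) K.* (ι (1- v) K.* ι (D *ᴸ D′))
            ≈⟨ K.*-congˡ {k K.+ k′} (K.*-congˡ {ι (1- v)} (ι-* D D′)) ⟩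
          (k K.+ k′) K.* (ι (1- v) K.* (ι D K.* ι D′))
            ≈⟨ solveᴷ 5 (λ k k′ c d d′ → (k ⊹ k′) ⊛ (c ⊛ (d ⊛ d′))
                 ⊜ d′ ⊛ (k ⊛ (c ⊛ d)) ⊹ d ⊛ (k′ ⊛ (c ⊛ d′))) K.refl
                 k k′ (ι (1- v)) (ι D) (ι D′) ⟩
          ι D′ K.* (k K.* (ι (1- v) K.* ι D)) K.+ ι D K.* (k′ K.* (ι (1- v) K.* ι D′))
            ≈⟨ combine D N D′ N′ rp rp′ ⟩
          ι (D′ *ᴸ N ++ D *ᴸ N′) ∎)
        (begin
          (g K.+ g′) K.* ι (T (D *ᴸ D′))
            ≈⟨ K.*-congˡ {g K.+ g′} (K.trans (ι-cong (T-* D′ (Good.dom gd))) (ι-* (T D) (T D′))) ⟩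
          (g K.+ g′) K.* (ι (T D) K.* ι (T D′))
            ≈⟨ solveᴷ 4 (λ k k′ d d′ → (k ⊹ k′) ⊛ (d ⊛ d′)
                 ⊜ d′ ⊛ (k ⊛ d) ⊹ d ⊛ (k′ ⊛ d′)) K.refl
                 g g′ (ι (T D)) (ι (T D′)) ⟩
          ι (T D′) K.* (g K.* ι (T D)) K.+ ι (T D) K.* (g′ K.* ι (T D′))
            ≈⟨ combine (T D) (T N) (T D′) (T N′) vl vl′ ⟩
          ι (T D′ *ᴸ T N ++ T D *ᴸ T N′)
            ≈⟨ ι-cong (R.+-cong (T-* N (Good.dom gd′)) (T-* N′ (Good.dom gd))) ⟨
          ι (T (D′ *ᴸ N) ++ T (D *ᴸ N′))
            ≡⟨ cong ι (T-++ (D′ *ᴸ N) (D *ᴸ N′)) ⟨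
          ι (T (D′ *ᴸ N ++ D *ᴸ N′)) ∎)
      where
      combine : ∀ D N D′ N′ {a b} → a ≃ ι N → b ≃ ι N′ → ι D′ K.* a K.+ ι D K.* b ≃ ι (D′ *ᴸ N ++ D *ᴸ N′)
      combine D N D′ N′ {a} {b} eq eq′ = begin
        ι D′ K.* a K.+ ι D K.* b       ≈⟨ K.+-cong (K.*-congˡ {ι D′} eq) (K.*-congˡ {ι D} eq′) ⟩
        ι D′ K.* ι N K.+ ι D K.* ι N′  ≈⟨ K.+-cong (ι-* D′ N) (ι-* D N′) ⟨
        ι (D′ *ᴸ N) K.+ ι (D *ᴸ N′)    ≈⟨ ι-+ (D′ *ᴸ N) (D *ᴸ N′) ⟨
        ι (D′ *ᴸ N ++ D *ᴸ N′)         ∎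

    -- A fraction without a pole along v gets the numerator (1 - v) N when it is written over (1 -
    -- v) D, and T maps 1 - v to 1 - 1 = 0.
    Residue-0 : to v ≡ just 1ᴹ → ∀ {k N D} → Good τ D → k K.* ι D ≃ ι N → Residue k K.0#
    Residue-0 tov {k} {N} {D} gd rp = residue {N = (1- v) *ᴸ N} {D = D} gd
      (begin
        k K.* (ι (1- v) K.* ι D)   ≈⟨ solveᴷ 3 (λ k c d → k ⊛ (c ⊛ d) ⊜ c ⊛ (k ⊛ d)) K.refl k (ι (1- v)) (ι D) ⟩
        ι (1- v) K.* (k K.* ι D)   ≈⟨ K.*-congˡ {ι (1- v)} rp ⟩
        ι (1- v) K.* ι N           ≈⟨ ι-* (1- v) N ⟨
        ι ((1- v) *ᴸ N)            ∎)
      (begin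
        K.0# K.* ι (T D)           ≈⟨ K.zeroˡ (ι (T D)) ⟩
        ι []                       ≈⟨ ι-cong vanishing ⟨
        ι (T ((1- v) *ᴸ N))        ∎)
      where
      vanishing : T ((1- v) *ᴸ N) ≐ []
      vanishing = ≐-trans (T-* N (Dom-1- tov)) (≐-trans (R.*-congʳ {T N} one-minus-one) (R.zeroˡ (T N)))
        where
        one-minus-one : T (1- v) ≐ []
        one-minus-one = mk≐ λ f → trans (cong (λ L → ⟪ L ⟫ f) (T-1- tov))
          (trans (⟪1-⟫ 1ᴹ f) (ℚₚ.+-inverseʳ (f 1ᴹ)))

  module _ {P : Mono → Set} (P? : ∀ x → Dec (P x)) (P-1 : P 1ᴹ)
           (P-· : ∀ x z → P x → P z → P (x · z)) (P-/ : ∀ x z → P x → P (x · z) → P z)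
           (φ : Mono → Mono) (φ-1 : φ 1ᴹ ≡ 1ᴹ) (φ-· : ∀ x z → φ (x · z) ≡ φ x · φ z) where

    private
      on : ∀ {x} → Dec (P x) → Mono → Maybe Mono
      on (yes _) u = just u
      on (no _)  u = nothing

      on-yes : ∀ {x} (d : Dec (P x)) {u} → P x → on d u ≡ just u
      on-yes (yes _) p = refl
      on-yes (no ¬p) p = contradiction p ¬p

      on-no : ∀ {x} (d : Dec (P x)) {u} → ¬ P x → on d u ≡ nothing
      on-no (yes p) ¬p = contradiction p ¬p
      on-no (no _)  ¬p = refl

      on-just : ∀ {x} (d : Dec (P x)) {u w} → on d u ≡ just w → P x × u ≡ w
      on-just (yes p) refl = p , refl

    restricted : PartialHom
    restricted = record
      { to   = λ x → on (P? x) (φ x)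
      ; to-1 = trans (on-yes (P? 1ᴹ) P-1) (cong just φ-1)
      ; to-· = mult }
      where
      mult : ∀ {x u} z → on (P? x) (φ x) ≡ just u →
             on (P? (x · z)) (φ (x · z)) ≡ Maybe.map (u ·_) (on (P? z) (φ z))
      mult {x} z eq with on-just (P? x) eq | P? z
      ... | p , refl | yes q = trans (on-yes (P? (x · z)) (P-· x z p q)) (cong just (φ-· x z))
      ... | p , refl | no ¬q = on-no (P? (x · z)) λ pq → ¬q (P-/ x z p pq)

    restricted-yes : ∀ x → P x → PartialHom.to restricted x ≡ just (φ x)
    restricted-yes x = on-yes (P? x)

    restricted-no : ∀ x → ¬ P x → PartialHom.to restricted x ≡ nothing
    restricted-no x = on-no (P? x)

  -- Integrality in 𝐲 and the operator 𝒵

  YIntegral : Mono → Set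
  YIntegral x = All (λ j → IsInteger (lookup x (y j))) (allFin n)

  yIntegral? : ∀ x → Dec (YIntegral x)
  yIntegral? x = All.all? (λ j → isInteger? (lookup x (y j))) (allFin n)

  YIntegral-1 : YIntegral 1ᴹ
  YIntegral-1 = All.tabulate λ {j} _ → subst IsInteger (sym (lookup-1ᴹ (y j))) refl

  YIntegral-· : ∀ x z → YIntegral x → YIntegral z → YIntegral (x · z)
  YIntegral-· x z p q = All.zipWith (λ {j} (a , b) → subst IsInteger (sym (lookup-· x z (y j)))
    (IsInteger-+ (lookup x (y j)) (lookup z (y j)) a b)) (p , q)

  YIntegral-/ : ∀ x z → YIntegral x → YIntegral (x · z) → YIntegral z
  YIntegral-/ x z p q = All.zipWith (λ {j} (a , b) → IsInteger-+ʳ (lookup x (y j)) (lookup z (y j)) a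
    (subst IsInteger (lookup-· x z (y j)) b)) (p , q)

  YIntegral-^ : ∀ x q → IsInteger q → YIntegral x → YIntegral (x ^ℚ q)
  YIntegral-^ x q i = All.map λ {j} a → subst IsInteger (sym (lookup-^ x q (y j)))
    (IsInteger-* q (lookup x (y j)) i a)

  opaque
    ζ : PartialHom
    ζ = restricted yIntegral? YIntegral-1 YIntegral-· YIntegral-/ id refl (λ _ _ → refl)

    ζ-yes : ∀ x → YIntegral x → PartialHom.to ζ x ≡ just x
    ζ-yes = restricted-yes yIntegral? YIntegral-1 YIntegral-· YIntegral-/ id refl (λ _ _ → refl)

    ζ-no : ∀ x → ¬ YIntegral x → PartialHom.to ζ x ≡ nothing
    ζ-no = restricted-no yIntegral? YIntegral-1 YIntegral-· YIntegral-/ id refl (λ _ _ → refl)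

  private
    keep : ∀ {A : Set} → Dec A → ℚ → ℚ
    keep (yes _) q = q
    keep (no _)  q = 0ℚ

    keep-yes : ∀ {A : Set} (d : Dec A) {q} → A → keep d q ≡ q
    keep-yes (yes _) a = refl
    keep-yes (no ¬a) a = contradiction a ¬a

    keep-no : ∀ {A : Set} (d : Dec A) {q} → ¬ A → keep d q ≡ 0ℚ
    keep-no (yes a) ¬a = contradiction a ¬a
    keep-no (no _)  ¬a = refl

    int? : ∀ x j → Dec (IsInteger (lookup x (y j)))
    int? x j = isInteger? (lookup x (y j))

    ⟪filter⟫ : ∀ {P : Mono → Set} (P? : ∀ x → Dec (P x)) L f →
               ⟪ List.filter (λ (_ , x) → P? x) L ⟫ f ≡ ⟪ L ⟫ (λ x → keep (P? x) (f x))
    ⟪filter⟫ P? []            f = refl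
    ⟪filter⟫ P? ((c , x) ∷ L) f with P? x
    ... | yes _ = cong (c ℚ.* f x ℚ.+_) (⟪filter⟫ P? L f)
    ... | no  _ = trans (⟪filter⟫ P? L f)
      (sym (trans (cong (ℚ._+ ⟪ L ⟫ _) (ℚₚ.*-zeroʳ c)) (ℚₚ.+-identityˡ _)))

    ⟪𝒵⟫ : ∀ js L f → ⟪ List.foldr 𝒵y L js ⟫ f ≡ ⟪ L ⟫ (λ x → keep (All.all? (int? x) js) (f x))
    ⟪𝒵⟫ []       L f = refl
    ⟪𝒵⟫ (j ∷ js) L f = trans (⟪filter⟫ (λ x → int? x j) (List.foldr 𝒵y L js) f) (trans (⟪𝒵⟫ js L _) (⟪⟫-cong L merge))
      where
      merge : ∀ x → keep (All.all? (int? x) js) (keep (int? x j) (f x)) ≡ keep (All.all? (int? x) (j ∷ js)) (f x)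
      merge x with int? x j | All.all? (int? x) js
      ... | yes _ | yes _ = refl
      ... | yes _ | no _  = refl
      ... | no _  | yes _ = refl
      ... | no _  | no _  = refl

  𝒵ᴸ≐T : ∀ L → 𝒵ᴸ L ≐ PartialHom.T ζ L
  𝒵ᴸ≐T L = mk≐ λ f → trans (⟪𝒵⟫ (allFin n) L f) (trans (⟪⟫-cong L (pointwise f)) (sym (PartialHom.⟪T⟫ ζ L f)))
    where
    pointwise : ∀ f x → keep (yIntegral? x) (f x) ≡ PartialHom.extend ζ f x
    pointwise f x = case (yIntegral? x)
      where
      case : Dec (YIntegral x) → keep (yIntegral? x) (f x) ≡ PartialHom.extend ζ f x
      case (yes p) = trans (keep-yes (yIntegral? x) p) (cong (maybe′ f 0ℚ) (sym (ζ-yes x p)))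
      case (no ¬p) = trans (keep-no (yIntegral? x) ¬p) (cong (maybe′ f 0ℚ) (sym (ζ-no x ¬p)))

  module _ (c : Clearing) where

    open Clearing c
    open PartialHom ζ

    clears : ∀ x → YIntegral (x ^[ p x ])
    clears x = All.tabulate λ {j} _ → integral x j

    private
      geometrics : ∀ xs → ∏1- xs *ᴸ ∏ᴸ (List.map (geometric ∘ proj₁) xs) ≐ ∏1- (List.map clear xs)
      geometrics []       = R.*-identityˡ 1ᴸ
      geometrics (x ∷ xs) = ≐-trans (interchange (1- proj₁ x) (∏1- xs) (geometric (proj₁ x)) _)
        (R.*-cong (1-*geom (proj₁ x) (p (proj₁ x))) (geometrics xs))
        where
        open import Algebra.Properties.CommutativeSemigroup (CommutativeRing.*-commutativeSemigroup laurents) using (interchange)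

      clear-fixed : ∀ x → to (proj₁ (clear x)) ≡ just (proj₁ (clear x))
      clear-fixed x = ζ-yes (proj₁ (clear x)) (clears (proj₁ x))

      clear-Dom : ∀ xs → Dom (∏1- (List.map clear xs))
      clear-Dom []       = Dom-1
      clear-Dom (x ∷ xs) = Dom-* (Dom-1- (clear-fixed x)) (clear-Dom xs)

      T-clear : ∀ xs → T (∏1- (List.map clear xs)) ≐ ∏1- (List.map clear xs)
      T-clear []       = R.reflexive (T-mono to-1)
      T-clear (x ∷ xs) = ≐-trans
        (T-* {1- proj₁ (clear x)} (∏1- (List.map clear xs)) (Dom-1- (clear-fixed x)))
        (R.*-cong {T (1- proj₁ (clear x))} {1- proj₁ (clear x)} (R.reflexive (T-1- (clear-fixed x))) (T-clear xs))

    -- The geometric sums turn each factor 1 - x into 1 - x^p, whose terms all survive. Thus 𝒵 acts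
    -- as the restriction T on numerators over every denominator that is integral in 𝐲, and the
    -- choice of the exponents p has no influence.
    𝒵-value : ∀ F {N D} → Dom D → frac F K.* ι D ≃ ι N → frac (𝒵 c F) K.* ι (T D) ≃ ι (T N)
    𝒵-value F {N} {D} dom rep = ι-cancelʳ (∏1-‿regular (List.map clear (den F))) (begin
      frac (𝒵 c F) K.* ι (T D) K.* ι E      ≈⟨ solveᴷ 3 (λ a b c → (a ⊛ b) ⊛ c ⊜ b ⊛ (a ⊛ c)) K.refl (frac (𝒵 c F)) (ι (T D)) (ι E) ⟩
      ι (T D) K.* (frac (𝒵 c F) K.* ι E)    ≈⟨ K.*-congˡ {ι (T D)} (K.trans (frac-rep (𝒵 c F)) (ι-cong (𝒵ᴸ≐T (num F *ᴸ Γ)))) ⟩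
      ι (T D) K.* ι (T (num F *ᴸ Γ))        ≈⟨ ι-* (T D) (T (num F *ᴸ Γ)) ⟨
      ι (T D *ᴸ T (num F *ᴸ Γ))             ≈⟨ ι-cong (T-* (num F *ᴸ Γ) dom) ⟨
      ι (T (D *ᴸ (num F *ᴸ Γ)))             ≈⟨ ι-cong (T-cong crossed) ⟩
      ι (T (E *ᴸ N))                        ≈⟨ ι-cong (T-* N (clear-Dom (den F))) ⟩
      ι (T E *ᴸ T N)                        ≈⟨ ι-cong (R.*-congʳ {T N} (T-clear (den F))) ⟩
      ι (E *ᴸ T N)                          ≈⟨ ι-cong (R.*-comm E (T N)) ⟩
      ι (T N *ᴸ E)                          ≈⟨ ι-* (T N) E ⟩
      ι (T N) K.* ι E                       ∎)
      where
      Γ E : Laurent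
      Γ = ∏ᴸ (List.map (geometric ∘ proj₁) (den F))
      E = ∏1- (List.map clear (den F))
      crossed : D *ᴸ (num F *ᴸ Γ) ≐ E *ᴸ N
      crossed = ι-injective (begin
        ι (D *ᴸ (num F *ᴸ Γ))                        ≈⟨ K.trans (ι-* D (num F *ᴸ Γ)) (K.*-congˡ {ι D} (ι-* (num F) Γ)) ⟩
        ι D K.* (ι (num F) K.* ι Γ)                  ≈⟨ K.*-congˡ {ι D} (K.*-congʳ {ι Γ} (frac-rep F)) ⟨
        ι D K.* (frac F K.* ι (∏den F) K.* ι Γ)      ≈⟨ solveᴷ 4 (λ d f p g → d ⊛ ((f ⊛ p) ⊛ g) ⊜ (p ⊛ g) ⊛ (f ⊛ d)) K.refl (ι D) (frac F) (ι (∏den F)) (ι Γ) ⟩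
        ι (∏den F) K.* ι Γ K.* (frac F K.* ι D)      ≈⟨ K.*-cong (K.trans (K.sym (ι-* (∏den F) Γ)) (ι-cong (geometrics (den F)))) rep ⟩
        ι E K.* ι N                                  ≈⟨ ι-* E N ⟨
        ι (E *ᴸ N)                                   ∎)

  -- Elimination of λᵢ along a monomial v

  module _ (i : Fin r) (v : Mono) (v≢0 : lookup v (lam i) ≢ 0ℚ) where

    private
      s : ℚ
      s = recip (lookup v (lam i)) v≢0

    -- If x = x₀ v^q with x₀ free of λᵢ, then q is this quotient. It is an integer exactly if the
    -- exponent of λᵢ in x is an integer multiple of that in v.
    ratio : Mono → ℚ
    ratio x = lookup x (lam i) ℚ.* s

    ratio-· : ∀ x z → ratio (x · z) ≡ ratio x ℚ.+ ratio z
    ratio-· x z = trans (cong (ℚ._* s) (lookup-· x z (lam i))) (ℚₚ.*-distribʳ-+ s (lookup x (lam i)) (lookup z (lam i)))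

    ratio-1 : ratio 1ᴹ ≡ 0ℚ
    ratio-1 = trans (cong (ℚ._* s) (lookup-1ᴹ (lam i))) (ℚₚ.*-zeroˡ s)

    ratio-v : ratio v ≡ 1ℚ
    ratio-v = trans (ℚₚ.*-comm (lookup v (lam i)) s) (recip-* (lookup v (lam i)) v≢0)

    ratio-* : ∀ x → ratio x ℚ.* lookup v (lam i) ≡ lookup x (lam i)
    ratio-* x = trans (ℚₚ.*-assoc (lookup x (lam i)) s (lookup v (lam i)))
      (trans (cong (lookup x (lam i) ℚ.*_) (recip-* (lookup v (lam i)) v≢0)) (ℚₚ.*-identityʳ _))

    -- v^(-1/b), where b is the exponent of λᵢ in v, is substituted for λᵢ.
    eliminate : Mono → Mono
    eliminate x = x · v ^ℚ (ℚ.- ratio x)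

    eliminate-· : ∀ x z → eliminate (x · z) ≡ eliminate x · eliminate z
    eliminate-· x z = lookup-ext λ t →
      trans (at-t (x · z) t) (trans (cong₂ (λ a b → a ℚ.+ (ℚ.- b) ℚ.* lookup v t) (lookup-· x z t) (ratio-· x z))
        (trans (solve 5 (λ a b p q w → (a :+ b) :+ (:- (p :+ q)) :* w
                   := (a :+ (:- p) :* w) :+ (b :+ (:- q) :* w)) refl
                   (lookup x t) (lookup z t) (ratio x) (ratio z) (lookup v t))
          (sym (trans (lookup-· (eliminate x) (eliminate z) t) (cong₂ ℚ._+_ (at-t x t) (at-t z t))))))
      where
      at-t : ∀ x t → lookup (eliminate x) t ≡ lookup x t ℚ.+ (ℚ.- ratio x) ℚ.* lookup v t
      at-t x t = trans (lookup-· x (v ^ℚ (ℚ.- ratio x)) t) (cong (lookup x t ℚ.+_) (lookup-^ v (ℚ.- ratio x) t))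

    eliminate-free : ∀ x → lookup x (lam i) ≡ 0ℚ → eliminate x ≡ x
    eliminate-free x eq = trans (cong (λ q → x · v ^ℚ (ℚ.- q)) (trans (cong (ℚ._* s) eq) (ℚₚ.*-zeroˡ s)))
      (trans (cong (x ·_) (^-0 v)) (·-identityʳ x))

    eliminate-v : eliminate v ≡ 1ᴹ
    eliminate-v = trans (cong (λ q → v · v ^ℚ (ℚ.- q)) ratio-v)
      (trans (cong (_· v ^ℚ (ℚ.- 1ℚ)) (sym (^-1 v))) (trans (sym (^-+ v 1ℚ (ℚ.- 1ℚ))) (^-0 v)))

    private
      P-· : ∀ x z → IsInteger (ratio x) → IsInteger (ratio z) → IsInteger (ratio (x · z))
      P-· x z p q = subst IsInteger (sym (ratio-· x z)) (IsInteger-+ (ratio x) (ratio z) p q)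

      P-/ : ∀ x z → IsInteger (ratio x) → IsInteger (ratio (x · z)) → IsInteger (ratio z)
      P-/ x z p q = IsInteger-+ʳ (ratio x) (ratio z) p (subst IsInteger (ratio-· x z) q)

      eliminate-1 : eliminate 1ᴹ ≡ 1ᴹ
      eliminate-1 = eliminate-free 1ᴹ (lookup-1ᴹ (lam i))

      P-1 : IsInteger (ratio 1ᴹ)
      P-1 = subst IsInteger (sym ratio-1) refl

    opaque
      ρ : PartialHom
      ρ = restricted {λ x → IsInteger (ratio x)} (λ x → isInteger? (ratio x)) P-1 P-· P-/ eliminate eliminate-1 eliminate-·

      ρ-yes : ∀ x → IsInteger (ratio x) → PartialHom.to ρ x ≡ just (eliminate x)
      ρ-yes = restricted-yes {λ x → IsInteger (ratio x)} (λ x → isInteger? (ratio x)) P-1 P-· P-/ eliminate eliminate-1 eliminate-·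

      ρ-no : ∀ x → ¬ IsInteger (ratio x) → PartialHom.to ρ x ≡ nothing
      ρ-no = restricted-no {λ x → IsInteger (ratio x)} (λ x → isInteger? (ratio x)) P-1 P-· P-/ eliminate eliminate-1 eliminate-·

    ρ-v : PartialHom.to ρ v ≡ just 1ᴹ
    ρ-v = trans (ρ-yes v (subst IsInteger (sym ratio-v) refl)) (cong just eliminate-v)

    ρ-free : ∀ x → lookup x (lam i) ≡ 0ℚ → PartialHom.to ρ x ≡ just x
    ρ-free x eq = trans (ρ-yes x (subst IsInteger (sym (trans (cong (ℚ._* s) eq) (ℚₚ.*-zeroˡ s))) refl))
      (cong just (eliminate-free x eq))

  module _ (τ : PartialHom) where
    open PartialHom τ

    -- The images are again elements of `Mono≢1`, so that the image of the product of the factors is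
    -- a product of factors that can be cancelled.
    Images : List Mono≢1 → List Mono≢1 → Set
    Images = Pointwise λ z u → to (proj₁ z) ≡ just (proj₁ u)

    Images-Good : ∀ {zs us} → Images zs us → Good τ (∏1- zs)
    Images-Good []                       = Good-1 τ
    Images-Good (_∷_ {x = z} {y = u} eq eqs) = Good-* τ (Good-1- τ z u eq) (Images-Good eqs)

    Images-T : ∀ {zs us} → Images zs us → T (∏1- zs) ≐ ∏1- us
    Images-T []                       = R.reflexive (T-mono to-1)
    Images-T (_∷_ {x = z} {y = u} {xs = zs} {ys = us} eq eqs) = ≐-trans (T-* {1- proj₁ z} (∏1- zs) (Dom-1- eq))
      (R.*-cong {T (1- proj₁ z)} {1- proj₁ u} (R.reflexive (T-1- eq)) (Images-T eqs))

    -- The cross multiplication of `𝒵-value` for a function whose numerator and denominator are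
    -- themselves images. It is applied to the substitution of λᵢ^m for λᵢ.
    image-value : ∀ F F′ {N D} → num F′ ≐ T (num F) → ∏den F′ ≐ T (∏den F) → Dom (∏den F) → Dom D →
                  frac F K.* ι D ≃ ι N → frac F′ K.* ι (T D) ≃ ι (T N)
    image-value F F′ {N} {D} num-eq den-eq den-dom dom rep = ι-cancelʳ (∏1-‿regular (den F′)) (begin
      frac F′ K.* ι (T D) K.* ι (∏den F′)      ≈⟨ solveᴷ 3 (λ a b c → (a ⊛ b) ⊛ c ⊜ b ⊛ (a ⊛ c)) K.refl (frac F′) (ι (T D)) (ι (∏den F′)) ⟩
      ι (T D) K.* (frac F′ K.* ι (∏den F′))    ≈⟨ K.*-congˡ {ι (T D)} (K.trans (frac-rep F′) (ι-cong num-eq)) ⟩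
      ι (T D) K.* ι (T (num F))                ≈⟨ ι-* (T D) (T (num F)) ⟨
      ι (T D *ᴸ T (num F))                     ≈⟨ ι-cong (T-* (num F) dom) ⟨
      ι (T (D *ᴸ num F))                       ≈⟨ ι-cong (T-cong crossed) ⟩
      ι (T (∏den F *ᴸ N))                      ≈⟨ ι-cong (T-* N den-dom) ⟩
      ι (T (∏den F) *ᴸ T N)                    ≈⟨ ι-* (T (∏den F)) (T N) ⟩
      ι (T (∏den F)) K.* ι (T N)               ≈⟨ K.*-congʳ (ι-cong den-eq) ⟨
      ι (∏den F′) K.* ι (T N)                  ≈⟨ K.*-comm _ _ ⟩
      ι (T N) K.* ι (∏den F′)                  ∎)
      where
      crossed : D *ᴸ num F ≐ ∏den F *ᴸ N
      crossed = ι-injective (begin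
        ι (D *ᴸ num F)                      ≈⟨ ι-* D (num F) ⟩
        ι D K.* ι (num F)                   ≈⟨ K.*-congˡ {ι D} (frac-rep F) ⟨
        ι D K.* (frac F K.* ι (∏den F))     ≈⟨ solveᴷ 3 (λ d f p → d ⊛ (f ⊛ p) ⊜ p ⊛ (f ⊛ d)) K.refl (ι D) (frac F) (ι (∏den F)) ⟩
        ι (∏den F) K.* (frac F K.* ι D)     ≈⟨ K.*-congˡ {ι (∏den F)} rep ⟩
        ι (∏den F) K.* ι N                  ≈⟨ ι-* (∏den F) N ⟨
        ι (∏den F *ᴸ N)                     ∎)

module PartialFraction (n r : ℕ) (i : Fin r) where

  open Fractional n r
  open Series n r
  open +-*-Solver using (solve; _:+_; _:*_; :-_; _:=_; con)
  open import Relation.Binary.Reasoning.Setoid K.setoid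
  open import Algebra.Properties.Ring K.ring using (-‿distribˡ-*; -‿distribʳ-*; -‿involutive; -1*x≈-x)
  open import Algebra.Solver.Ring.NaturalCoefficients.Default K.commutativeSemiring
    using () renaming (solve to solveᴷ; _:+_ to _⊹_; _:*_ to _⊛_; _:=_ to _⊜_; con to conᴷ)

  -- The residue of a decomposition

  Exponents : (ℚ → Set) → Laurent → Set
  Exponents P = All λ (_ , e) → P (exponent i e)

  Free : Laurent → Set
  Free = Exponents (_≡ 0ℚ)

  exponent-· : ∀ x z → exponent i (x · z) ≡ exponent i x ℚ.+ exponent i z
  exponent-· x z = lookup-· x z (lam i)

  Exponents-* : ∀ P Q S → (∀ p q → P p → Q q → S (p ℚ.+ q)) →
                ∀ {L M} → Exponents P L → Exponents Q M → Exponents S (L *ᴸ M)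
  Exponents-* P Q S f {[]}          []       qs = []
  Exponents-* P Q S f {(c , x) ∷ L} {M} (p ∷ ps) qs = Allₚ.++⁺
    (Allₚ.map⁺ (All.map (λ {(_ , z)} q → subst S (sym (exponent-· x z)) (f (exponent i x) (exponent i z) p q)) qs))
    (Exponents-* P Q S f ps qs)

  Free-* : ∀ {L M} → Free L → Free M → Free (L *ᴸ M)
  Free-* = Exponents-* (_≡ 0ℚ) (_≡ 0ℚ) (_≡ 0ℚ) λ _ _ → cong₂ ℚ._+_

  Free-∏1- : ∀ xs → All (λ x → exponent i (proj₁ x) ≡ 0ℚ) xs → Free (∏1- xs)
  Free-∏1- []       []       = lookup-1ᴹ (lam i) ∷ []
  Free-∏1- (x ∷ xs) (p ∷ ps) = Free-* {1- proj₁ x} (lookup-1ᴹ (lam i) ∷ p ∷ []) (Free-∏1- xs ps)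

  Below : ℕ → ℚ → Set
  Below N q = ∃ λ k → k ℕ.< N × q ≡ + k / 1

  -- The exponents 1, ..., N. They occur in the nonconstant part of a polynomial if N counts the
  -- coefficients after the constant one.
  PositiveBelow : ℕ → ℚ → Set
  PositiveBelow N q = ∃ λ k → k ℕ.< N × q ≡ + suc k / 1

  eval : List FracRat → FracRat
  eval = List.foldr (λ c F → c +ᶠ lam^ i 1ℚ ⊙ F) 0ᶠ

  eval-den : ∀ cs → All (LamFree i) cs → All (λ x → exponent i (proj₁ x) ≡ 0ℚ) (den (eval cs))
  eval-den []       []             = []
  eval-den (c ∷ cs) ((_ , f) ∷ fs) = Allₚ.++⁺ f (eval-den cs fs)

  exponent-lam^ : ∀ q → exponent i (lam^ i q) ≡ q
  exponent-lam^ q = Vecₚ.lookup∘updateAt (lam i) 1ᴹ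

  higher-terms : ∀ N {L} → Exponents (Below N) L → ∀ xs → All (λ x → exponent i (proj₁ x) ≡ 0ℚ) xs →
                 Exponents (PositiveBelow N) (mono (lam^ i 1ℚ) *ᴸ L *ᴸ ∏1- xs)
  higher-terms N ks xs fs = Exponents-* (PositiveBelow N) (_≡ 0ℚ) (PositiveBelow N)
    (λ { p q (k , lt , eq) q≡0 → k , lt , trans (cong₂ ℚ._+_ eq q≡0) (ℚₚ.+-identityʳ (+ suc k / 1)) })
    (Exponents-* (_≡ 1ℚ) (Below N) (PositiveBelow N)
      (λ { p q p≡1 (k , lt , eq) → k , lt , trans (cong₂ ℚ._+_ p≡1 eq) (sym (/1-+ (+ 1) (+ k))) })
      {mono (lam^ i 1ℚ)} (exponent-lam^ 1ℚ ∷ []) ks)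
    (Free-∏1- xs fs)

  eval-num : ∀ cs → All (LamFree i) cs → Exponents (Below (length cs)) (num (eval cs))
  eval-num []       []              = []
  eval-num (c ∷ cs) ((f , f′) ∷ fs) = Allₚ.++⁺
    (All.map (λ eq → 0 , s≤s z≤n , eq) (Free-* f (Free-∏1- (den (eval cs)) (eval-den cs fs))))
    (All.map (λ { (k , lt , eq) → suc k , s≤s lt , eq }) (higher-terms (length cs) (eval-num cs fs) (den c) f′))

  module _ (τ : PartialHom) where
    open PartialHom τ

    T-id : ∀ L → All (λ (_ , x) → to x ≡ just x) L → T L ≡ L
    T-id []            []         = refl
    T-id ((c , x) ∷ L) (eq ∷ eqs) rewrite eq = cong ((c , x) ∷_) (T-id L eqs)

    T-nothing : ∀ L → All (λ (_ , x) → to x ≡ nothing) L → T L ≡ []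
    T-nothing []            []         = refl
    T-nothing ((c , x) ∷ L) (eq ∷ eqs) rewrite eq = T-nothing L eqs

  at0 : List FracRat → FracRat
  at0 cs = Maybe.fromMaybe 0ᶠ (List.head cs)

  private
    multiple : ∀ k a z → 0 ℕ.< k → k ℕ.< a → (+ k / 1) ≢ (z / 1) ℚ.* (+ a / 1)
    multiple k a z 0<k k<a eq = case ∣ z ∣ refl
      where
      sizes : k ≡ ∣ z ∣ ℕ.* a
      sizes = trans (cong ∣_∣ (/1-injective {+ k} {z ℤ.* + a} (trans eq (sym (/1-* z (+ a)))))) (ℤₚ.abs-* z (+ a))
      case : ∀ q → ∣ z ∣ ≡ q → ⊥
      case zero    eq′ = ℕₚ.<-irrefl refl (subst (0 ℕ.<_) (trans sizes (cong (ℕ._* a) eq′)) 0<k)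
      case (suc q) eq′ = ℕₚ.<-irrefl refl (ℕₚ.<-≤-trans k<a
        (subst (a ℕ.≤_) (sym (trans sizes (cong (ℕ._* a) eq′))) (ℕₚ.m≤m+n a (q ℕ.* a))))

  module _ (v : Mono) (v≢0 : exponent i v ≢ 0ℚ) where

    private
      τ : PartialHom
      τ = ρ i v v≢0
    open PartialHom τ

    Good-free : ∀ xs → All (λ x → exponent i (proj₁ x) ≡ 0ℚ) xs → Good τ (∏1- xs)
    Good-free []       []       = Good-1 τ
    Good-free (x ∷ xs) (p ∷ ps) = Good-* τ (Good-1- τ x x (ρ-free i v v≢0 (proj₁ x) p)) (Good-free xs ps)

    T-free : ∀ {L} → Free L → T L ≡ L
    T-free {L} f = T-id τ L (All.map (λ {(_ , x)} p → ρ-free i v v≢0 x p) f)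

    -- Only the constant coefficient of a polynomial of degree < a survives.
    eval-value : ∀ {a} → exponent i v ≡ + a / 1 → ∀ cs → All (LamFree i) cs → length cs ℕ.≤ a →
                 frac (at0 cs) K.* ι (T (∏den (eval cs))) ≃ ι (T (num (eval cs)))
    eval-value v≡a []       []               le = begin
      frac 0ᶠ K.* ι (T 1ᴸ)   ≈⟨ K.*-congʳ frac-0 ⟩
      K.0# K.* ι (T 1ᴸ)      ≈⟨ K.zeroˡ (ι (T 1ᴸ)) ⟩
      K.0#                   ∎
    eval-value {a} v≡a (c ∷ cs) ((f , f′) ∷ fs) le = begin
      frac c K.* ι (T (∏den (eval (c ∷ cs))))           ≡⟨ cong (λ L → frac c K.* ι L) (T-free (Free-∏1- _ (Allₚ.++⁺ f′ (eval-den cs fs)))) ⟩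
      frac c K.* ι (∏den (eval (c ∷ cs)))               ≈⟨ K.*-congˡ {frac c} (K.trans (ι-cong (∏1-‿++ (den c) (den (eval cs)))) (ι-* (∏den c) E)) ⟩
      frac c K.* (ι (∏den c) K.* ι E)                   ≈⟨ K.*-assoc (frac c) (ι (∏den c)) (ι E) ⟨
      frac c K.* ι (∏den c) K.* ι E                     ≈⟨ K.*-congʳ (frac-rep c) ⟩
      ι (num c) K.* ι E                                 ≈⟨ ι-* (num c) E ⟨
      ι (num c *ᴸ E)                                    ≈⟨ ι-cong (R.+-identityʳ (num c *ᴸ E)) ⟨
      ι (num c *ᴸ E ++ [])                              ≡⟨ cong ι (cong₂ _++_ (T-free constant) (T-nothing τ _ higher)) ⟨
      ι (T (num c *ᴸ E) ++ T (mono (lam^ i 1ℚ) *ᴸ num (eval cs) *ᴸ ∏den c))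
                                                        ≡⟨ cong ι (T-++ (num c *ᴸ E) (mono (lam^ i 1ℚ) *ᴸ num (eval cs) *ᴸ ∏den c)) ⟨
      ι (T (num (eval (c ∷ cs))))                       ∎
      where
      E : Laurent
      E = ∏den (eval cs)
      constant : Free (num c *ᴸ E)
      constant = Free-* f (Free-∏1- (den (eval cs)) (eval-den cs fs))
      non-multiple : ∀ x k → k ℕ.< length cs → exponent i x ≡ + suc k / 1 → to x ≡ nothing
      -- The constant coefficient occupies one of the at most a places, so the exponent 1 + k is
      -- strictly between 0 and a. A kept monomial would have an integer multiple of a there.
      non-multiple x k lt eq = ρ-no i v v≢0 x λ int →
        multiple (suc k) a (↥ ratio i v v≢0 x) (s≤s z≤n) (ℕₚ.≤-trans (s≤s lt) le)
          (trans (sym eq) (trans (sym (ratio-* i v v≢0 x)) (cong₂ ℚ._*_ (integer-≡ (ratio i v v≢0 x) int) v≡a)))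
      higher : All (λ (_ , x) → to x ≡ nothing) (mono (lam^ i 1ℚ) *ᴸ num (eval cs) *ᴸ ∏den c)
      higher = All.map (λ { {(_ , x)} (k , lt , eq) → non-multiple x k lt eq })
        (higher-terms (length cs) (eval-num cs fs) (den c) f′)

  private
    abs-nonneg : ∀ q → IsInteger q → 0ℚ ℚ.≤ q → q ≡ + ∣ ↥ q ∣ / 1
    abs-nonneg q@(ℚ.mkℚ (+ k) d _)      int le = integer-≡ q int
    abs-nonneg q@(ℚ.mkℚ ℤ.-[1+ k ] d _) int le = contradiction (ℚₚ.<-≤-trans (ℚₚ.negative⁻¹ q) le) (ℚₚ.<-irrefl refl)

    abs-neg : ∀ q → IsInteger q → ¬ (0ℚ ℚ.≤ q) → ℚ.- q ≡ + ∣ ↥ q ∣ / 1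
    abs-neg q@(ℚ.mkℚ (+ k) d _)      int nle = contradiction (ℚₚ.nonNegative⁻¹ q) nle
    abs-neg q@(ℚ.mkℚ ℤ.-[1+ k ] d _) int nle = trans (cong (λ p → ℚ.- p) (integer-≡ q int)) (sym (/1-neg ℤ.-[1+ k ]))

  nonneg-cases : ∀ x → proj₁ (nonneg i x) ≡ proj₁ x ⊎ proj₁ (nonneg i x) ≡ proj₁ x ⁻¹
  nonneg-cases x with 0ℚ ℚ.≤? exponent i (proj₁ x)
  ... | yes _ = inj₁ refl
  ... | no  _ = inj₂ refl

  nonneg-degree : ∀ x → IsInteger (exponent i (proj₁ x)) → exponent i (proj₁ (nonneg i x)) ≡ + degree i x / 1
  nonneg-degree x int with 0ℚ ℚ.≤? exponent i (proj₁ x)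
  ... | yes le = abs-nonneg (exponent i (proj₁ x)) int le
  ... | no nle = trans (lookup-⁻¹ (proj₁ x) (lam i)) (abs-neg (exponent i (proj₁ x)) int nle)

  nonneg-≡0 : ∀ x t → lookup (proj₁ x) t ≡ 0ℚ → lookup (proj₁ (nonneg i x)) t ≡ 0ℚ
  nonneg-≡0 x t eq with nonneg-cases x
  ... | inj₁ p = trans (cong (λ z → lookup z t) p) eq
  ... | inj₂ p = trans (cong (λ z → lookup z t) p) (trans (lookup-⁻¹ (proj₁ x) t) (cong (λ q → ℚ.- q) eq))

  nonneg-≢0 : ∀ x t → lookup (proj₁ x) t ≢ 0ℚ → lookup (proj₁ (nonneg i x)) t ≢ 0ℚ
  nonneg-≢0 x t ne eq with nonneg-cases x
  ... | inj₁ p = ne (trans (cong (λ z → lookup z t) (sym p)) eq)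
  ... | inj₂ p = neg-≢0 _ ne (trans (sym (lookup-⁻¹ (proj₁ x) t)) (trans (cong (λ z → lookup z t) (sym p)) eq))

  -- This takes the place of pairwise coprimality. The private variable y_ℓ survives inversion,
  -- powers and rescaling of λᵢ, and it certifies that a monomial obtained by eliminating λᵢ between
  -- two factors is not 1.
  Separated : (Fin n → Maybe Mono≢1) → Set
  Separated f = ∀ ℓ x → f ℓ ≡ just x → lookup (proj₁ x) (y ℓ) ≢ 0ℚ ×
    (∀ ℓ′ x′ → f ℓ′ ≡ just x′ → ℓ′ ≢ ℓ → lookup (proj₁ x′) (y ℓ) ≡ 0ℚ)

  -- A power of v is all that elimination multiplies by, so the exponent of a variable that is
  -- absent from v does not change.
  eliminate-≢0 : ∀ v v≢0 x t → lookup v t ≡ 0ℚ → lookup x t ≢ 0ℚ → lookup (eliminate i v v≢0 x) t ≢ 0ℚ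
  eliminate-≢0 v v≢0 x t v≡0 x≢0 eq = x≢0 (trans (sym (ℚₚ.+-identityʳ (lookup x t)))
    (trans (cong (lookup x t ℚ.+_) (sym vanishes)) (trans (sym (lookup-· x _ t)) eq)))
    where
    vanishes : lookup (v ^ℚ (ℚ.- ratio i v v≢0 x)) t ≡ 0ℚ
    vanishes = trans (lookup-^ v (ℚ.- ratio i v v≢0 x) t)
      (trans (cong ((ℚ.- ratio i v v≢0 x) ℚ.*_) v≡0) (ℚₚ.*-zeroʳ (ℚ.- ratio i v v≢0 x)))

  ratio-^ : ∀ v v≢0 x q → ratio i v v≢0 (x ^ℚ q) ≡ q ℚ.* ratio i v v≢0 x
  ratio-^ v v≢0 x q = trans (cong (ℚ._* recip (exponent i v) v≢0) (lookup-^ x q (lam i)))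
    (ℚₚ.*-assoc q (exponent i x) (recip (exponent i v) v≢0))

  module _ (v : Mono) (v≢0 : exponent i v ≢ 0ℚ) where

    private
      τ : PartialHom
      τ = ρ i v v≢0

    Good-power : ∀ x t → lookup v t ≡ 0ℚ → lookup (proj₁ x) t ≢ 0ℚ → ∀ q .{{_ : ℕ.NonZero q}} →
                 IsInteger ((+ q / 1) ℚ.* ratio i v v≢0 (proj₁ x)) → Good τ (1- (proj₁ x ^[ q ]))
    Good-power x t v≡0 x≢0 q int = Good-1- τ (x ^≢1[ q ]) (eliminate i v v≢0 (proj₁ x ^[ q ]) , t , apart)
      (ρ-yes i v v≢0 (proj₁ x ^[ q ]) (subst IsInteger (sym (ratio-^ v v≢0 (proj₁ x) (+ q / 1))) int))
      where
      apart : lookup (eliminate i v v≢0 (proj₁ x ^[ q ])) t ≢ 0ℚ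
      apart = eliminate-≢0 v v≢0 (proj₁ x ^[ q ]) t v≡0
        (*-≢0 (+ q / 1) (lookup (proj₁ x) t) (ℕ⇒ℚ-≢0 q) x≢0 ∘ trans (sym (lookup-^ (proj₁ x) (+ q / 1) t)))

    frac-/-power : ∀ E x q → frac (E /1- x) K.* ι ((1- (proj₁ x ^[ q ])) *ᴸ ∏den E) ≃ ι (geom (proj₁ x) q *ᴸ num E)
    frac-/-power E x q = begin
      frac (E /1- x) K.* ι ((1- (proj₁ x ^[ q ])) *ᴸ ∏den E)
        ≈⟨ K.*-congˡ {frac (E /1- x)} (K.trans (ι-* (1- (proj₁ x ^[ q ])) (∏den E))
             (K.*-congʳ {ι (∏den E)} (K.trans (ι-cong (≐-sym (1-*geom (proj₁ x) q))) (ι-* (1- proj₁ x) (geom (proj₁ x) q))))) ⟩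
      frac (E /1- x) K.* (ι (1- proj₁ x) K.* ι (geom (proj₁ x) q) K.* ι (∏den E))
        ≈⟨ solveᴷ 4 (λ k a b c → k ⊛ ((a ⊛ b) ⊛ c) ⊜ b ⊛ ((k ⊛ a) ⊛ c)) K.refl
             (frac (E /1- x)) (ι (1- proj₁ x)) (ι (geom (proj₁ x) q)) (ι (∏den E)) ⟩
      ι (geom (proj₁ x) q) K.* (frac (E /1- x) K.* ι (1- proj₁ x) K.* ι (∏den E))
        ≈⟨ K.*-congˡ {ι (geom (proj₁ x) q)} (K.trans (K.*-congʳ {ι (∏den E)} (frac-/ E x)) (frac-rep E)) ⟩
      ι (geom (proj₁ x) q) K.* ι (num E)
        ≈⟨ ι-* (geom (proj₁ x) q) (num E) ⟨
      ι (geom (proj₁ x) q *ᴸ num E) ∎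

    -- A geometric sum in the numerator replaces 1 - x by 1 - x^q, with q the denominator of the
    -- ratio of exponents of λᵢ, so that x^q is kept. The variable t, absent from v, shows that its
    -- image is not 1. Hence this factor contributes no pole along v.
    Residue-simple : ∀ E → All (λ z → exponent i (proj₁ z) ≡ 0ℚ) (den E) → ∀ x t →
                     lookup v t ≡ 0ℚ → lookup (proj₁ x) t ≢ 0ℚ → Residue τ v (frac (E /1- x)) K.0#
    Residue-simple E E-free x t v≡0 x≢0 = Residue-0 τ v (ρ-v i v v≢0)
      (Good-* τ (Good-power x t v≡0 x≢0 q cleared) (Good-free v v≢0 (den E) E-free)) (frac-/-power E x q)
      where
      q : ℕ
      q = ↧ₙ ratio i v v≢0 (proj₁ x)
      cleared : IsInteger ((+ q / 1) ℚ.* ratio i v v≢0 (proj₁ x))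
      cleared = subst IsInteger (sym (↧-clears (ratio i v v≢0 (proj₁ x)))) (IsInteger-/1 (↥ ratio i v v≢0 (proj₁ x)))

  module _ (F : Labelled) (separated : Separated (factor F)) (integral : LamIntegral i F)
           (j : Fin n) (w : Mono≢1) (Fj : factor F j ≡ just w) (w≢0 : exponent i (proj₁ w) ≢ 0ℚ)
           where

    private
      v : Mono
      v = proj₁ (nonneg i w)

    direction-≢0 : exponent i v ≢ 0ℚ
    direction-≢0 = nonneg-≢0 w (lam i) w≢0

    private
      τ : PartialHom
      τ = ρ i v direction-≢0
    open PartialHom τ

    module _ (A : Fin n → Poly i) (deg-A : ∀ ℓ x → factor F ℓ ≡ just x → (deg_<_ i (A ℓ) (degree i x))) where

      private
        summand : Fin n → Maybe Mono≢1 → FracRat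
        summand ℓ = maybe′ (λ x → ⟦_⟧ i (A ℓ) /1- nonneg i x) 0ᶠ

        other : ∀ ℓ m → factor F ℓ ≡ m → ℓ ≢ j → Residue τ v (frac (summand ℓ m)) K.0#
        other ℓ nothing  eq ℓ≢j = Residue-0 τ v (ρ-v i v direction-≢0) {N = []} {D = 1ᴸ} (Good-1 τ) (frac-rep 0ᶠ)
        -- The variable y_ℓ occurs in the ℓ-th factor but not in v, which belongs to the label j ≠
        -- ℓ.
        other ℓ (just x) eq ℓ≢j = Residue-simple v direction-≢0 (⟦_⟧ i (A ℓ)) (eval-den (coeffs (A ℓ)) (free (A ℓ)))
          (nonneg i x) (y ℓ) (nonneg-≡0 w (y ℓ) (proj₂ (separated ℓ x eq) j w Fj (ℓ≢j ∘ sym)))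
          (nonneg-≢0 x (y ℓ) (proj₁ (separated ℓ x eq)))

        own : Residue τ v (frac (summand j (just w))) (frac (_at0 i (A j)))
        own = residue {N = num E} {D = ∏den E}
          (Good-free v direction-≢0 (den E) (eval-den (coeffs (A j)) (free (A j))))
          (begin
            frac (E /1- nonneg i w) K.* (ι (1- v) K.* ι (∏den E))  ≈⟨ K.*-assoc (frac (E /1- nonneg i w)) (ι (1- v)) (ι (∏den E)) ⟨
            frac (E /1- nonneg i w) K.* ι (1- v) K.* ι (∏den E)    ≈⟨ K.*-congʳ (frac-/ E (nonneg i w)) ⟩
            frac E K.* ι (∏den E)                                  ≈⟨ frac-rep E ⟩
            ι (num E)                                              ∎)
          (eval-value v direction-≢0 (nonneg-degree w (proj₂ integral j w Fj)) (coeffs (A j)) (free (A j)) (deg-A j w Fj))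
          where
          E : FracRat
          E = ⟦_⟧ i (A j)

        zero+zero : K.0# K.+ K.0# ≃ K.0#
        zero+zero = K.+-identityʳ K.0#

        rest : ∀ ℓs → All (_≢ j) ℓs → Residue τ v (frac (∑ᶠ (List.map (λ ℓ → summand ℓ (factor F ℓ)) ℓs))) K.0#
        rest []       []         = Residue-0 τ v (ρ-v i v direction-≢0) {N = []} {D = 1ᴸ} (Good-1 τ) (frac-rep 0ᶠ)
        rest (ℓ ∷ ℓs) (ne ∷ nes) = Residue-resp τ v
          (K.sym (frac-+ (summand ℓ (factor F ℓ)) (∑ᶠ (List.map (λ ℓ → summand ℓ (factor F ℓ)) ℓs)))) zero+zero
          (Residue-+ τ v (other ℓ (factor F ℓ) refl ne) (rest ℓs nes))

        total : ∀ ℓs → Unique ℓs → j ∈ ℓs →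
                Residue τ v (frac (∑ᶠ (List.map (λ ℓ → summand ℓ (factor F ℓ)) ℓs))) (frac (_at0 i (A j)))
        total (ℓ ∷ ℓs) (fresh ∷ _) (here refl) = Residue-resp τ v
          (K.sym (frac-+ (summand ℓ (factor F ℓ)) (∑ᶠ (List.map (λ ℓ → summand ℓ (factor F ℓ)) ℓs))))
          (K.+-identityʳ (frac (_at0 i (A j))))
          (Residue-+ τ v (subst (λ m → Residue τ v (frac (summand j m)) (frac (_at0 i (A j)))) (sym Fj) own)
            (rest ℓs (All.map (λ ne → ne ∘ sym) fresh)))
        total (ℓ ∷ ℓs) (fresh ∷ unique) (there j∈) = Residue-resp τ v
          (K.sym (frac-+ (summand ℓ (factor F ℓ)) (∑ᶠ (List.map (λ ℓ → summand ℓ (factor F ℓ)) ℓs))))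
          (K.+-identityˡ (frac (_at0 i (A j))))
          (Residue-+ τ v (other ℓ (factor F ℓ) refl (All.lookup fresh j∈)) (total ℓs unique j∈))

      -- The two polynomial parts and the summands with labels other than j have no factor 1 - v to
      -- cancel and contribute 0. The summand of j contributes A_j(0) by the degree bound.
      decomposition-residue : ∀ P p t →
        ⌞ F ⌟ ≈ ⟦_⟧ i P +ᶠ lam^ i (ℚ.- (+ t / 1)) ⊙ ⟦_⟧ i p
          +ᶠ ∑ᶠ (List.map (λ ℓ → maybe′ (λ x → ⟦_⟧ i (A ℓ) /1- nonneg i x) 0ᶠ (factor F ℓ)) (allFin n)) →
        Residue τ v (frac ⌞ F ⌟) (frac (_at0 i (A j)))
      decomposition-residue P p t eq = Residue-resp τ v
        (K.sym (K.trans (≈⇒≃ {⌞ F ⌟} {X +ᶠ Y +ᶠ Z} eq) (K.trans (frac-+ (X +ᶠ Y) Z) (K.+-congʳ (frac-+ X Y)))))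
        (K.trans (K.+-congʳ zero+zero) (K.+-identityˡ _))
        (Residue-+ τ v (Residue-+ τ v
            (Residue-0 τ v (ρ-v i v direction-≢0) (Good-free v direction-≢0 (den X) (eval-den (coeffs P) (free P))) (frac-rep X))
            (Residue-0 τ v (ρ-v i v direction-≢0) (Good-free v direction-≢0 (den Y) (eval-den (coeffs p) (free p))) (frac-rep Y)))
          (total (allFin n) (Uniqueₚ.allFin⁺ n) (∈-allFin j)))
        where
        X Y Z : FracRat
        X = ⟦_⟧ i P
        Y = lam^ i (ℚ.- (+ t / 1)) ⊙ ⟦_⟧ i p
        Z = ∑ᶠ (List.map (λ ℓ → maybe′ (λ x → ⟦_⟧ i (A ℓ) /1- nonneg i x) 0ᶠ (factor F ℓ)) (allFin n))

  -- Existence of decompositions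

  opaque
    inv : Mono≢1 → Fraction
    inv x = _÷_ 1ᴸ (1- proj₁ x) {1-‿regular x}

    inv-* : ∀ x → inv x K.* ι (1- proj₁ x) ≃ K.1#
    inv-* x = ÷-* 1ᴸ (1- proj₁ x)

  inv-unique : ∀ x {k l} → k K.* ι (1- proj₁ x) ≃ l → k ≃ l K.* inv x
  inv-unique x {k} {l} eq = ι-cancelʳ (1-‿regular x) (begin
    k K.* ι (1- proj₁ x)             ≈⟨ eq ⟩
    l                                ≈⟨ K.*-identityʳ l ⟨
    l K.* K.1#                       ≈⟨ K.*-congˡ {l} (inv-* x) ⟨
    l K.* (inv x K.* ι (1- proj₁ x)) ≈⟨ K.*-assoc l (inv x) (ι (1- proj₁ x)) ⟨
    l K.* inv x K.* ι (1- proj₁ x)   ∎)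

  frac-/-inv : ∀ F x → frac (F /1- x) ≃ frac F K.* inv x
  frac-/-inv F x = inv-unique x (frac-/ F x)

  μ : Mono → Fraction
  μ x = ι (mono x)

  μ-· : ∀ x z → μ (x · z) ≃ μ x K.* μ z
  μ-· x z = K.trans (ι-cong (mono-· x z)) (ι-* (mono x) (mono z))

  inv-step : ∀ x → inv x ≃ K.1# K.+ μ (proj₁ x) K.* inv x
  inv-step x = begin
    inv x                                                    ≈⟨ K.*-identityʳ (inv x) ⟨
    inv x K.* K.1#                                           ≈⟨ K.*-congˡ {inv x} (K.trans (K.sym (ι-+ (1- proj₁ x) (mono (proj₁ x)))) (ι-cong (1-+ (proj₁ x)))) ⟨
    inv x K.* (ι (1- proj₁ x) K.+ μ (proj₁ x))               ≈⟨ K.distribˡ (inv x) (ι (1- proj₁ x)) (μ (proj₁ x)) ⟩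
    inv x K.* ι (1- proj₁ x) K.+ inv x K.* μ (proj₁ x)       ≈⟨ K.+-cong (inv-* x) (K.*-comm (inv x) (μ (proj₁ x))) ⟩
    K.1# K.+ μ (proj₁ x) K.* inv x                           ∎

  mono-*1- : ∀ w z → mono w *ᴸ (1- z) ≐ (1- (w · z)) ++ negᴸ (1- w)
  mono-*1- w z = mk≐ λ f → trans (⟪*⟫ (mono w) (1- z) f) (trans (⟪mono⟫ w (λ u → ⟪ 1- z ⟫ (λ v → f (u · v))))
    (trans (⟪1-⟫ z (λ v → f (w · v))) (trans (cong (λ u → f u ℚ.+ ℚ.- f (w · z)) (·-identityʳ w))
      (trans (solve 3 (λ a b c → b :+ (:- c) := (a :+ (:- c)) :+ (:- (a :+ (:- b)))) refl (f 1ᴹ) (f w) (f (w · z)))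
        (sym (trans (⟪++⟫ (1- (w · z)) (negᴸ (1- w)) f)
          (cong₂ ℚ._+_ (⟪1-⟫ (w · z) f) (trans (⟪neg⟫ (1- w) f) (cong (λ q → ℚ.- q) (⟪1-⟫ w f))))))))))

  μ-*1- : ∀ w z → μ w K.* ι (1- z) ≃ ι (1- (w · z)) K.+ K.- ι (1- w)
  μ-*1- w z = K.trans (K.sym (ι-* (mono w) (1- z))) (K.trans (ι-cong (mono-*1- w z))
    (K.trans (ι-+ (1- (w · z)) (negᴸ (1- w))) (K.+-congˡ (ι-neg (1- w)))))

  ι-1-1 : ι (1- 1ᴹ) ≃ K.0#
  ι-1-1 = ι-cong (mk≐ λ f → trans (⟪1-⟫ 1ᴹ f) (ℚₚ.+-inverseʳ (f 1ᴹ)))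

  inv-inverse : ∀ x X → proj₁ X ≡ proj₁ x ⁻¹ → inv x ≃ K.- (μ (proj₁ X) K.* inv X)
  inv-inverse x X eq = K.sym (K.trans (inv-unique x (begin
    K.- (μ (proj₁ X) K.* inv X) K.* ι (1- proj₁ x)    ≈⟨ -‿distribˡ-* (μ (proj₁ X) K.* inv X) (ι (1- proj₁ x)) ⟨
    K.- (μ (proj₁ X) K.* inv X K.* ι (1- proj₁ x))    ≈⟨ K.-‿cong (solveᴷ 3 (λ a b c → (a ⊛ b) ⊛ c ⊜ b ⊛ (a ⊛ c)) K.refl (μ (proj₁ X)) (inv X) (ι (1- proj₁ x))) ⟩
    K.- (inv X K.* (μ (proj₁ X) K.* ι (1- proj₁ x)))  ≈⟨ -‿distribʳ-* (inv X) _ ⟩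
    inv X K.* K.- (μ (proj₁ X) K.* ι (1- proj₁ x))    ≈⟨ K.*-congˡ {inv X} (K.-‿cong product) ⟩
    inv X K.* K.- (K.- ι (1- proj₁ X))                ≈⟨ K.*-congˡ {inv X} (-‿involutive _) ⟩
    inv X K.* ι (1- proj₁ X)                          ≈⟨ inv-* X ⟩
    K.1#                                              ∎)) (K.*-identityˡ (inv x)))
    where
    product : μ (proj₁ X) K.* ι (1- proj₁ x) ≃ K.- ι (1- proj₁ X)
    product = K.trans (μ-*1- (proj₁ X) (proj₁ x)) (K.trans (K.+-congʳ (K.trans
      (K.reflexive (cong (λ z → ι (1- z)) (trans (cong (_· proj₁ x) eq) (·-inverseˡ (proj₁ x))))) ι-1-1))
      (K.+-identityˡ _))

  ι-geom : ∀ x k → ι (geom (proj₁ x) k) ≃ ι (1- (proj₁ x ^[ k ])) K.* inv x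
  ι-geom x k = inv-unique x (K.trans (K.*-comm _ _) (K.trans (K.sym (ι-* (1- proj₁ x) (geom (proj₁ x) k))) (ι-cong (1-*geom (proj₁ x) k))))

  -- With w z = x^b and w = u^a: (1 - x^b) - (1 - u^a) = w (1 - z).
  inv-bezout : ∀ x u z w a b → w ≡ proj₁ u ^[ a ] → w · proj₁ z ≡ proj₁ x ^[ b ] →
               inv x K.* inv u ≃ inv z K.* μ (w ⁻¹) K.* (ι (geom (proj₁ x) b) K.* inv u)
                                 K.+ K.- (inv z K.* μ (w ⁻¹) K.* (ι (geom (proj₁ u) a) K.* inv x))
  inv-bezout x u z w a b eq eq′ = K.sym (begin
    c K.* (ι (geom (proj₁ x) b) K.* inv u) K.+ K.- (c K.* (ι (geom (proj₁ u) a) K.* inv x))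
      ≈⟨ K.+-congˡ (-‿distribʳ-* c _) ⟩
    c K.* (ι (geom (proj₁ x) b) K.* inv u) K.+ c K.* K.- (ι (geom (proj₁ u) a) K.* inv x)
      ≈⟨ K.distribˡ c _ _ ⟨
    c K.* (ι (geom (proj₁ x) b) K.* inv u K.+ K.- (ι (geom (proj₁ u) a) K.* inv x))
      ≈⟨ K.*-congˡ {c} (K.+-cong (K.trans (K.*-congʳ (ι-geom x b)) (K.*-assoc _ (inv x) (inv u)))
           (K.-‿cong (K.trans (K.*-congʳ (ι-geom u a)) (K.trans (K.*-assoc _ (inv u) (inv x)) (K.*-congˡ {ι (1- (proj₁ u ^[ a ]))} (K.*-comm (inv u) (inv x))))))) ⟩
    c K.* (ι (1- (proj₁ x ^[ b ])) K.* (inv x K.* inv u) K.+ K.- (ι (1- (proj₁ u ^[ a ])) K.* (inv x K.* inv u)))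
      ≈⟨ K.*-congˡ {c} (K.+-congˡ (-‿distribˡ-* _ (inv x K.* inv u))) ⟩
    c K.* (ι (1- (proj₁ x ^[ b ])) K.* (inv x K.* inv u) K.+ K.- ι (1- (proj₁ u ^[ a ])) K.* (inv x K.* inv u))
      ≈⟨ K.*-congˡ {c} (K.distribʳ (inv x K.* inv u) _ _) ⟨
    c K.* ((ι (1- (proj₁ x ^[ b ])) K.+ K.- ι (1- (proj₁ u ^[ a ]))) K.* (inv x K.* inv u))
      ≡⟨ cong₂ (λ p q → c K.* ((ι (1- p) K.+ K.- ι (1- q)) K.* (inv x K.* inv u))) (sym eq′) (sym eq) ⟩
    c K.* ((ι (1- (w · proj₁ z)) K.+ K.- ι (1- w)) K.* (inv x K.* inv u))
      ≈⟨ K.*-congˡ {c} (K.*-congʳ (μ-*1- w (proj₁ z))) ⟨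
    inv z K.* μ (w ⁻¹) K.* (μ w K.* ι (1- proj₁ z) K.* (inv x K.* inv u))
      ≈⟨ solveᴷ 5 (λ a b c d e → (a ⊛ b) ⊛ ((c ⊛ d) ⊛ e) ⊜ ((a ⊛ d) ⊛ (b ⊛ c)) ⊛ e) K.refl
           (inv z) (μ (w ⁻¹)) (μ w) (ι (1- proj₁ z)) (inv x K.* inv u) ⟩
    inv z K.* ι (1- proj₁ z) K.* (μ (w ⁻¹) K.* μ w) K.* (inv x K.* inv u)
      ≈⟨ K.*-congʳ (K.*-cong (inv-* z) (K.trans (K.sym (μ-· (w ⁻¹) w)) (K.reflexive (cong μ (·-inverseˡ w))))) ⟩
    K.1# K.* K.1# K.* (inv x K.* inv u)
      ≈⟨ K.trans (K.*-congʳ (K.*-identityˡ K.1#)) (K.*-identityˡ (inv x K.* inv u)) ⟩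
    inv x K.* inv u ∎)
    where
    c : Fraction
    c = inv z K.* μ (w ⁻¹)

  constant : ℚ → FracRat
  constant q = ((q , 1ᴹ) ∷ []) /∏ []

  ι-∷ : ∀ q x L → ι ((q , x) ∷ L) ≃ frac (constant q) K.* μ x K.+ ι L
  ι-∷ q x L = K.trans (ι-+ ((q , x) ∷ []) L) (K.+-congʳ (K.trans (ι-cong split)
    (K.trans (ι-* ((q , 1ᴹ) ∷ []) (mono x)) (K.*-congʳ (K.sym (frac-/∏[] ((q , 1ᴹ) ∷ [])))))))
    where
    split : (q , x) ∷ [] ≐ ((q , 1ᴹ) ∷ []) *ᴸ mono x
    split = R.reflexive (cong₂ (λ p z → (p , z) ∷ []) (sym (ℚₚ.*-identityʳ q)) (sym (·-identityˡ x)))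

  frac-neg1 : ∀ k → frac (constant (ℚ.- 1ℚ)) K.* k ≃ K.- k
  frac-neg1 k = K.trans (K.*-congʳ (K.trans (frac-/∏[] _) (ι-neg 1ᴸ))) (-1*x≈-x k)

  frac-1 : ∀ k → frac (constant 1ℚ) K.* k ≃ k
  frac-1 k = K.trans (K.*-congʳ (frac-/∏[] 1ᴸ)) (K.*-identityˡ k)

  LamFree-constant : ∀ q → LamFree i (constant q)
  LamFree-constant q = lookup-1ᴹ (lam i) ∷ [] , []

  LamFree-* : ∀ {F G} → LamFree i F → LamFree i G → LamFree i (F *ᶠ G)
  LamFree-* (f , f′) (g , g′) = Free-* f g , Allₚ.++⁺ f′ g′

  LamFree-⊙ : ∀ {x F} → exponent i x ≡ 0ℚ → LamFree i F → LamFree i (x ⊙ F)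
  LamFree-⊙ {x} eq (f , f′) = Free-* {mono x} (eq ∷ []) f , f′

  LamFree-+ : ∀ {F G} → LamFree i F → LamFree i G → LamFree i (F +ᶠ G)
  LamFree-+ {F} {G} (f , f′) (g , g′) =
    Allₚ.++⁺ (Free-* f (Free-∏1- (den G) g′)) (Free-* g (Free-∏1- (den F) f′)) , Allₚ.++⁺ f′ g′

  -- The span of the partial fractions

  module Spans (f : Fin n → Maybe Mono≢1) where

    opaque
      λ^ : ℤ → Fraction
      λ^ s = μ (lam^ i (s / 1))

      λ^-μ : ∀ s → λ^ s ≃ μ (lam^ i (s / 1))
      λ^-μ s = K.refl

    -- The elements with a partial fraction decomposition in which only the factors
    -- with labels in S occur.
    data Span (S : List (Fin n)) : Fraction → Set where
      along    : ∀ {k k′} → k ≃ k′ → Span S k → Span S k′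
      none    : Span S K.0#
      plus    : ∀ {k k′} → Span S k → Span S k′ → Span S (k K.+ k′)
      laurent : ∀ g → LamFree i g → ∀ s → Span S (frac g K.* λ^ s)
      proper  : ∀ g → LamFree i g → ∀ ℓ x → f ℓ ≡ just x → exponent i (proj₁ x) ≢ 0ℚ → ℓ ∈ S →
                ∀ s → s ℕ.< degree i x → Span S (frac g K.* λ^ (+ s) K.* inv (nonneg i x))

    weaken : ∀ {S S′ k} → (∀ {ℓ} → ℓ ∈ S → ℓ ∈ S′) → Span S k → Span S′ k
    weaken sub (along eq d)                       = along eq (weaken sub d)
    weaken sub none                              = none
    weaken sub (plus d d′)                       = plus (weaken sub d) (weaken sub d′)
    weaken sub (laurent g g-free s)              = laurent g g-free s
    weaken sub (proper g g-free ℓ x eq ne ℓ∈ s lt) = proper g g-free ℓ x eq ne (sub ℓ∈) s lt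

    scale-free : ∀ {S k} h → LamFree i h → Span S k → Span S (frac h K.* k)
    scale-free h h-free (along eq d)  = along (K.*-congˡ {frac h} eq) (scale-free h h-free d)
    scale-free h h-free none         = along (K.sym (K.zeroʳ (frac h))) none
    scale-free h h-free (plus d d′)  = along (K.sym (K.distribˡ (frac h) _ _)) (plus (scale-free h h-free d) (scale-free h h-free d′))
    scale-free h h-free (laurent g g-free s) =
      along (K.trans (K.*-congʳ (frac-* h g)) (K.*-assoc (frac h) (frac g) (λ^ s)))
        (laurent (h *ᶠ g) (LamFree-* {h} {g} h-free g-free) s)
    scale-free h h-free (proper g g-free ℓ x eq ne ℓ∈ s lt) =
      along (K.trans (K.*-congʳ (K.*-congʳ (frac-* h g)))
             (solveᴷ 4 (λ a b c d → ((a ⊛ b) ⊛ c) ⊛ d ⊜ a ⊛ ((b ⊛ c) ⊛ d)) K.refl (frac h) (frac g) (λ^ (+ s)) (inv (nonneg i x))))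
        (proper (h *ᶠ g) (LamFree-* {h} {g} h-free g-free) ℓ x eq ne ℓ∈ s lt)

    negate : ∀ {S k} → Span S k → Span S (K.- k)
    negate {k = k} d = along (frac-neg1 k) (scale-free (constant (ℚ.- 1ℚ)) (LamFree-constant (ℚ.- 1ℚ)) d)

    -- e = e₀ λᵢ^s with e₀ free of λᵢ.
    private
      rest : ℤ → Mono → Mono
      rest s e = e · (lam^ i (s / 1)) ⁻¹

      rest-free : ∀ s e → exponent i e ≡ s / 1 → exponent i (rest s e) ≡ 0ℚ
      rest-free s e eq = trans (exponent-· e _) (trans (cong₂ ℚ._+_ eq (trans (lookup-⁻¹ (lam^ i (s / 1)) (lam i)) (cong (λ q → ℚ.- q) (exponent-lam^ (s / 1)))))
        (ℚₚ.+-inverseʳ (s / 1)))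

      split : ∀ g s e → frac (rest s e ⊙ g) K.* λ^ s ≃ frac g K.* μ e
      split g s e = K.trans (K.*-congʳ (frac-⊙ (rest s e) g))
        (K.trans (solveᴷ 3 (λ a b c → (a ⊛ b) ⊛ c ⊜ b ⊛ (a ⊛ c)) K.refl (μ (rest s e)) (frac g) (λ^ s))
          (K.*-congˡ {frac g} (K.trans (K.*-congˡ {μ (rest s e)} (λ^-μ s)) (K.trans (K.sym (μ-· (rest s e) (lam^ i (s / 1)))) (K.reflexive (cong μ
            (trans (·-assoc e _ _) (trans (cong (e ·_) (·-inverseˡ _)) (·-identityʳ e)))))))))

    laurent-mono : ∀ {S} g → LamFree i g → ∀ e → IsInteger (exponent i e) → Span S (frac g K.* μ e)
    laurent-mono g g-free e int = along (split g (↥ exponent i e) e)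
      (laurent (rest (↥ exponent i e) e ⊙ g)
        (LamFree-⊙ {rest (↥ exponent i e) e} {g} (rest-free (↥ exponent i e) e (integer-≡ (exponent i e) int)) g-free) (↥ exponent i e))

    Integral : Laurent → Set
    Integral = Exponents IsInteger

    module _ {S : List (Fin n)} (ℓ : Fin n) (x : Mono≢1) (eq : f ℓ ≡ just x)
             (x≢0 : exponent i (proj₁ x) ≢ 0ℚ) (x-int : IsInteger (exponent i (proj₁ x))) (ℓ∈ : ℓ ∈ S) where

      private
        X : Mono≢1
        X = nonneg i x

        a : ℕ
        a = degree i x

        X-degree : exponent i (proj₁ X) ≡ + a / 1
        X-degree = nonneg-degree x x-int

        module _ (g : FracRat) (g-free : LamFree i g) where

          Proper : Mono → Set
          Proper e = Span S (frac g K.* μ e K.* inv X)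

          -- X / (1 - X) = 1 / (1 - X) - 1, so a factor X in the numerator costs only a Laurent
          -- monomial. Read backwards, as in `down`, this removes such a factor; together they
          -- change the exponent of λᵢ by any multiple of a.
          up : ∀ e → IsInteger (exponent i e) → Proper e → Proper (e · proj₁ X)
          up e int d = along (begin
              frac g K.* μ e K.* inv X K.+ K.- (frac g K.* μ e)
                ≈⟨ K.+-congʳ (K.*-congˡ {frac g K.* μ e} (inv-step X)) ⟩
              frac g K.* μ e K.* (K.1# K.+ μ (proj₁ X) K.* inv X) K.+ K.- (frac g K.* μ e)
                ≈⟨ K.+-congʳ (K.trans (K.distribˡ (frac g K.* μ e) K.1# _) (K.trans (K.+-congʳ (K.*-identityʳ (frac g K.* μ e))) (K.+-comm _ _))) ⟩
              frac g K.* μ e K.* (μ (proj₁ X) K.* inv X) K.+ frac g K.* μ e K.+ K.- (frac g K.* μ e)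
                ≈⟨ K.trans (K.+-assoc _ _ _) (K.trans (K.+-congˡ (K.-‿inverseʳ (frac g K.* μ e))) (K.+-identityʳ _)) ⟩
              frac g K.* μ e K.* (μ (proj₁ X) K.* inv X)
                ≈⟨ solveᴷ 4 (λ a b c d → (a ⊛ b) ⊛ (c ⊛ d) ⊜ (a ⊛ (b ⊛ c)) ⊛ d) K.refl (frac g) (μ e) (μ (proj₁ X)) (inv X) ⟩
              frac g K.* (μ e K.* μ (proj₁ X)) K.* inv X
                ≈⟨ K.*-congʳ (K.*-congˡ {frac g} (μ-· e (proj₁ X))) ⟨
              frac g K.* μ (e · proj₁ X) K.* inv X ∎)
            (plus d (negate (laurent-mono g g-free e int)))

          down : ∀ e → IsInteger (exponent i e) → Proper (e · proj₁ X) → Proper e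
          down e int d = along (begin
              frac g K.* μ e K.+ frac g K.* μ (e · proj₁ X) K.* inv X
                ≈⟨ K.+-congˡ (K.*-congʳ (K.*-congˡ {frac g} (μ-· e (proj₁ X)))) ⟩
              frac g K.* μ e K.+ frac g K.* (μ e K.* μ (proj₁ X)) K.* inv X
                ≈⟨ solveᴷ 4 (λ a b c d → a ⊛ b ⊹ (a ⊛ (b ⊛ c)) ⊛ d ⊜ (a ⊛ b) ⊛ (conᴷ 1 ⊹ c ⊛ d)) K.refl (frac g) (μ e) (μ (proj₁ X)) (inv X) ⟩
              frac g K.* μ e K.* (K.1# K.+ μ (proj₁ X) K.* inv X)
                ≈⟨ K.*-congˡ {frac g K.* μ e} (inv-step X) ⟨
              frac g K.* μ e K.* inv X ∎)
            (plus (laurent-mono g g-free e int) d)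

          base : ∀ e s → s ℕ.< a → exponent i e ≡ + s / 1 → Proper e
          base e s lt p = along (K.*-congʳ (split g (+ s) e))
            (proper (rest (+ s) e ⊙ g) (LamFree-⊙ {rest (+ s) e} {g} (rest-free (+ s) e p) g-free) ℓ x eq x≢0 ℓ∈ s lt)

          exponent-^ : ∀ e k → IsInteger (exponent i e) → IsInteger (exponent i (e · proj₁ X ^ℚ (k / 1)))
          exponent-^ e k int = subst IsInteger (sym (exponent-· e (proj₁ X ^ℚ (k / 1))))
            (IsInteger-+ (exponent i e) (exponent i (proj₁ X ^ℚ (k / 1))) int
              (subst IsInteger (sym (trans (lookup-^ (proj₁ X) (k / 1) (lam i)) (cong ((k / 1) ℚ.*_) X-degree)))
                (IsInteger-* (k / 1) (+ a / 1) (IsInteger-/1 k) (IsInteger-/1 (+ a)))))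

          next : ∀ e k → (e · proj₁ X ^ℚ (k / 1)) · proj₁ X ≡ e · proj₁ X ^ℚ (ℤ.suc k / 1)
          next e k = trans (·-assoc e _ (proj₁ X)) (cong (e ·_) (trans (cong (proj₁ X ^ℚ (k / 1) ·_) (sym (^-1 (proj₁ X))))
            (trans (sym (^-+ (proj₁ X) (k / 1) 1ℚ)) (cong (proj₁ X ^ℚ_) (trans (sym (/1-+ k (+ 1))) (cong (_/ 1) (ℤₚ.+-comm k (+ 1))))))))

          powers : ∀ e → IsInteger (exponent i e) → Proper e → ∀ k → Proper (e · proj₁ X ^ℚ (k / 1))
          powers e int d (+ zero)     = subst Proper (sym (trans (cong (e ·_) (^-0 (proj₁ X))) (·-identityʳ e))) d
          powers e int d (+ suc k)    = subst Proper (next e (+ k)) (up _ (exponent-^ e (+ k) int) (powers e int d (+ k)))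
          powers e int d ℤ.-[1+ zero ]  = down _ (exponent-^ e ℤ.-[1+ 0 ] int)
            (subst Proper (sym (next e ℤ.-[1+ 0 ])) (powers e int d (+ 0)))
          powers e int d ℤ.-[1+ suc k ] = down _ (exponent-^ e ℤ.-[1+ suc k ] int)
            (subst Proper (sym (next e ℤ.-[1+ suc k ])) (powers e int d ℤ.-[1+ k ]))

      degree-nonzero : ℕ.NonZero (degree i x)
      degree-nonzero = ℕ.≢-nonZero λ a≡0 → nonneg-≢0 x (lam i) x≢0 (trans X-degree (cong (λ k → + k / 1) a≡0))

      -- Division of the exponent of λᵢ by a with remainder: e = e₀ X^κ, where the exponent of e₀ is
      -- one of 0, ..., a - 1. The remaining variables of e₀ are free of λᵢ and belong to the
      -- coefficient.
      proper-mono : ∀ g → LamFree i g → ∀ e → IsInteger (exponent i e) → Span S (frac g K.* μ e K.* inv X)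
      proper-mono g g-free e int = subst (Proper g g-free) restore
        (powers g g-free e₀ e₀-int (base g g-free e₀ ϱ (n%ℕd<d s a) e₀-exponent) κ)
        where
        open import Data.Integer.DivMod using (_%ℕ_; _/ℕ_; a≡a%ℕn+[a/ℕn]*n; n%ℕd<d)
        instance _ = degree-nonzero
        s κ : ℤ
        s = ↥ exponent i e
        κ = s /ℕ a
        ϱ : ℕ
        ϱ = s %ℕ a
        e₀ : Mono
        e₀ = e · proj₁ X ^ℚ ((ℤ.- κ) / 1)
        e₀-int : IsInteger (exponent i e₀)
        e₀-int = exponent-^ g g-free e (ℤ.- κ) int
        restore : e₀ · proj₁ X ^ℚ (κ / 1) ≡ e
        restore = trans (·-assoc e _ _) (trans (cong (e ·_) (trans (sym (^-+ (proj₁ X) ((ℤ.- κ) / 1) (κ / 1)))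
          (trans (cong (proj₁ X ^ℚ_) (trans (sym (/1-+ (ℤ.- κ) κ)) (cong (_/ 1) (ℤₚ.+-inverseˡ κ)))) (^-0 (proj₁ X))))) (·-identityʳ e))
        e₀-exponent : exponent i e₀ ≡ + ϱ / 1
        e₀-exponent = trans (exponent-· e _) (trans (cong₂ ℚ._+_ (integer-≡ (exponent i e) int)
            (trans (lookup-^ (proj₁ X) ((ℤ.- κ) / 1) (lam i)) (cong (((ℤ.- κ) / 1) ℚ.*_) X-degree)))
          (trans (cong ((s / 1) ℚ.+_) (sym (/1-* (ℤ.- κ) (+ a)))) (trans (sym (/1-+ s (ℤ.- κ ℤ.* + a))) (cong (_/ 1) remainder))))
          where
          remainder : s ℤ.+ (ℤ.- κ) ℤ.* + a ≡ + ϱ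
          remainder = trans (cong₂ ℤ._+_ (a≡a%ℕn+[a/ℕn]*n s a) (sym (ℤₚ.neg-distribˡ-* κ (+ a))))
            (trans (ℤₚ.+-assoc (+ ϱ) (κ ℤ.* + a) _) (trans (cong (λ z → + ϱ ℤ.+ z) (ℤₚ.+-inverseʳ (κ ℤ.* + a))) (ℤₚ.+-identityʳ (+ ϱ))))

      proper-laurent : ∀ g → LamFree i g → ∀ L → Integral L → Span S (frac g K.* ι L K.* inv X)
      proper-laurent g g-free []            []           = along (K.sym (K.trans (K.*-congʳ (K.zeroʳ (frac g))) (K.zeroˡ (inv X)))) none
      proper-laurent g g-free ((q , e) ∷ L) (int ∷ ints) =
        along (K.trans (solveᴷ 5 (λ g c m u v → (c ⊛ ((g ⊛ m) ⊛ v)) ⊹ (g ⊛ u) ⊛ v ⊜ (g ⊛ (c ⊛ m ⊹ u)) ⊛ v) K.refl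
                         (frac g) (frac (constant q)) (μ e) (ι L) (inv X))
               (K.*-congʳ (K.*-congˡ {frac g} (K.sym (ι-∷ q e L)))))
          (plus (scale-free (constant q) (LamFree-constant q) (proper-mono g g-free e int)) (proper-laurent g g-free L ints))

    laurent-sum : ∀ {S} L → Integral L → Span S (ι L)
    laurent-sum []            []           = none
    laurent-sum ((q , e) ∷ L) (int ∷ ints) = along (K.sym (ι-∷ q e L))
      (plus (laurent-mono (constant q) (LamFree-constant q) e int) (laurent-sum L ints))

  -- Closure of the span under multiplication by a new factor

  module SpanClosure (f : Fin n → Maybe Mono≢1) (separated : Separated f)
    (integral : ∀ ℓ x → f ℓ ≡ just x → IsInteger (exponent i (proj₁ x))) where

    open Spans f

    exponent-^-integral : ∀ x q → IsInteger q → IsInteger (exponent i x) → IsInteger (exponent i (x ^ℚ q))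
    exponent-^-integral x q q-int int = subst IsInteger (sym (lookup-^ x q (lam i))) (IsInteger-* q (exponent i x) q-int int)

    exponent-⁻¹-integral : ∀ x → IsInteger (exponent i x) → IsInteger (exponent i (x ⁻¹))
    exponent-⁻¹-integral x int = subst IsInteger (sym (lookup-⁻¹ x (lam i))) (IsInteger-neg (exponent i x) int)

    exponent-·-integral : ∀ x z → IsInteger (exponent i x) → IsInteger (exponent i z) → IsInteger (exponent i (x · z))
    exponent-·-integral x z p q = subst IsInteger (sym (exponent-· x z)) (IsInteger-+ (exponent i x) (exponent i z) p q)

    nonneg-integral : ∀ x → IsInteger (exponent i (proj₁ x)) → IsInteger (exponent i (proj₁ (nonneg i x)))
    nonneg-integral x int = subst IsInteger (sym (nonneg-degree x int)) (IsInteger-/1 (+ degree i x))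

    Integral-* : ∀ L M → Integral L → Integral M → Integral (L *ᴸ M)
    Integral-* L M = Exponents-* IsInteger IsInteger IsInteger IsInteger-+ {L} {M}

    Integral-geom : ∀ x k → IsInteger (exponent i x) → Integral (geom x k)
    Integral-geom x k int = Allₚ.map⁺ (All.universal (λ t → exponent-^-integral x (+ t / 1) (IsInteger-/1 (+ t)) int) (upTo k))

    private
      monomial-times : ∀ g Z e w L Y → frac (g /1- Z) K.* ι (mono (e · w) *ᴸ L) K.* inv Y
                       ≃ frac g K.* μ e K.* (inv Z K.* μ w K.* (ι L K.* inv Y))
      monomial-times g Z e w L Y = K.trans
        (K.*-congʳ (K.*-cong (frac-/-inv g Z) (K.trans (ι-* (mono (e · w)) L) (K.*-congʳ (μ-· e w)))))
        (solveᴷ 6 (λ g z e w l v → (g ⊛ z) ⊛ ((e ⊛ w) ⊛ l) ⊛ v ⊜ g ⊛ e ⊛ (z ⊛ w ⊛ (l ⊛ v))) K.refl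
          (frac g) (inv Z) (μ e) (μ w) (ι L) (inv Y))

    module _ {S : List (Fin n)}
             (ℓ : Fin n) (x : Mono≢1) (eq : f ℓ ≡ just x) (x≢0 : exponent i (proj₁ x) ≢ 0ℚ) (ℓ∈ : ℓ ∈ S)
             (ℓ′ : Fin n) (x′ : Mono≢1) (eq′ : f ℓ′ ≡ just x′) (x′≢0 : exponent i (proj₁ x′) ≢ 0ℚ) (ℓ′∈ : ℓ′ ∈ S)
             (ℓ′≢ℓ : ℓ′ ≢ ℓ) where

      private
        X Y : Mono≢1
        X = nonneg i x
        Y = nonneg i x′
        a b : ℕ
        a = degree i x
        b = degree i x′
        X-degree : exponent i (proj₁ X) ≡ + a / 1
        X-degree = nonneg-degree x (integral ℓ x eq)
        Y-degree : exponent i (proj₁ Y) ≡ + b / 1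
        Y-degree = nonneg-degree x′ (integral ℓ′ x′ eq′)

        w : Mono
        w = proj₁ Y ^[ a ]

        w-integral : IsInteger (exponent i (w ⁻¹))
        w-integral = exponent-⁻¹-integral w (exponent-^-integral (proj₁ Y) (+ a / 1) (IsInteger-/1 (+ a)) (nonneg-integral x′ (integral ℓ′ x′ eq′)))

        z : Mono
        z = proj₁ X ^[ b ] · w ⁻¹

        lookup-z : ∀ t → lookup z t ≡ (+ b / 1) ℚ.* lookup (proj₁ X) t ℚ.+ ℚ.- ((+ a / 1) ℚ.* lookup (proj₁ Y) t)
        lookup-z t = trans (lookup-· (proj₁ X ^[ b ]) (w ⁻¹) t) (cong₂ ℚ._+_ (lookup-^ (proj₁ X) (+ b / 1) t)
          (trans (lookup-⁻¹ w t) (cong (λ q → ℚ.- q) (lookup-^ (proj₁ Y) (+ a / 1) t))))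

        z-free : exponent i z ≡ 0ℚ
        z-free = trans (lookup-z (lam i)) (trans (cong₂ (λ p q → (+ b / 1) ℚ.* p ℚ.+ ℚ.- ((+ a / 1) ℚ.* q)) X-degree Y-degree)
          (trans (cong (λ p → p ℚ.+ ℚ.- ((+ a / 1) ℚ.* (+ b / 1))) (ℚₚ.*-comm (+ b / 1) (+ a / 1))) (ℚₚ.+-inverseʳ ((+ a / 1) ℚ.* (+ b / 1)))))

        z-private : lookup z (y ℓ) ≢ 0ℚ
        z-private z≡0 = *-≢0 (+ b / 1) (lookup (proj₁ X) (y ℓ)) (ℕ⇒ℚ-≢0 b {{degree-nonzero ℓ′ x′ eq′ x′≢0 (integral ℓ′ x′ eq′) ℓ′∈}})
          (nonneg-≢0 x (y ℓ) (proj₁ (separated ℓ x eq)))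
          (trans (sym (ℚₚ.+-identityʳ _)) (trans (cong ((+ b / 1) ℚ.* lookup (proj₁ X) (y ℓ) ℚ.+_) (sym Y-part)) (trans (sym (lookup-z (y ℓ))) z≡0)))
          where
          Y-part : ℚ.- ((+ a / 1) ℚ.* lookup (proj₁ Y) (y ℓ)) ≡ 0ℚ
          Y-part = cong (λ q → ℚ.- q) (trans (cong ((+ a / 1) ℚ.*_) (nonneg-≡0 x′ (y ℓ) (proj₂ (separated ℓ x eq) ℓ′ x′ eq′ ℓ′≢ℓ))) (ℚₚ.*-zeroʳ (+ a / 1)))

        Z : Mono≢1
        Z = z , y ℓ , z-private

        w-z : w · z ≡ proj₁ X ^[ b ]
        w-z = trans (cong (w ·_) (·-comm (proj₁ X ^[ b ]) (w ⁻¹))) (trans (sym (·-assoc w (w ⁻¹) _))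
          (trans (cong (_· proj₁ X ^[ b ]) (·-inverseʳ w)) (·-identityˡ _)))

        side : ∀ g → LamFree i g → ∀ e → IsInteger (exponent i e) → ∀ U k → IsInteger (exponent i U) →
               Integral (mono (e · w ⁻¹) *ᴸ geom U k)
        side g g-free e int U k U-int = Integral-* (mono (e · w ⁻¹)) (geom U k)
          (exponent-·-integral e (w ⁻¹) int w-integral ∷ []) (Integral-geom U k U-int)

      -- Divided by (1 - X) (1 - Y), the Bézout identity leaves one factor in each term, with a
      -- geometric sum as numerator. The factor 1 - z that it introduces is free of λᵢ, so its
      -- inverse is absorbed into the coefficient.
      proper-proper : ∀ g → LamFree i g → ∀ e → IsInteger (exponent i e) →
                      Span S (frac g K.* μ e K.* (inv X K.* inv Y))
      proper-proper g g-free e int = along (begin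
          frac (g /1- Z) K.* ι (mono (e · w ⁻¹) *ᴸ geom (proj₁ X) b) K.* inv Y
            K.+ K.- (frac (g /1- Z) K.* ι (mono (e · w ⁻¹) *ᴸ geom (proj₁ Y) a) K.* inv X)
            ≈⟨ K.+-cong (monomial-times g Z e (w ⁻¹) (geom (proj₁ X) b) Y) (K.-‿cong (monomial-times g Z e (w ⁻¹) (geom (proj₁ Y) a) X)) ⟩
          frac g K.* μ e K.* (inv Z K.* μ (w ⁻¹) K.* (ι (geom (proj₁ X) b) K.* inv Y))
            K.+ K.- (frac g K.* μ e K.* (inv Z K.* μ (w ⁻¹) K.* (ι (geom (proj₁ Y) a) K.* inv X)))
            ≈⟨ K.+-congˡ (-‿distribʳ-* (frac g K.* μ e) _) ⟩
          frac g K.* μ e K.* (inv Z K.* μ (w ⁻¹) K.* (ι (geom (proj₁ X) b) K.* inv Y))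
            K.+ frac g K.* μ e K.* (K.- (inv Z K.* μ (w ⁻¹) K.* (ι (geom (proj₁ Y) a) K.* inv X)))
            ≈⟨ K.distribˡ (frac g K.* μ e) _ _ ⟨
          frac g K.* μ e K.* (inv Z K.* μ (w ⁻¹) K.* (ι (geom (proj₁ X) b) K.* inv Y)
            K.+ K.- (inv Z K.* μ (w ⁻¹) K.* (ι (geom (proj₁ Y) a) K.* inv X)))
            ≈⟨ K.*-congˡ {frac g K.* μ e} (inv-bezout X Y Z w a b refl w-z) ⟨
          frac g K.* μ e K.* (inv X K.* inv Y) ∎)
        (plus
          (proper-laurent ℓ′ x′ eq′ x′≢0 (integral ℓ′ x′ eq′) ℓ′∈ (g /1- Z) gZ-free _
            (side g g-free e int (proj₁ X) b (nonneg-integral x (integral ℓ x eq))))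
          (negate (proper-laurent ℓ x eq x≢0 (integral ℓ x eq) ℓ∈ (g /1- Z) gZ-free _
            (side g g-free e int (proj₁ Y) a (nonneg-integral x′ (integral ℓ′ x′ eq′))))))
        where
        gZ-free : LamFree i (g /1- Z)
        gZ-free = proj₁ g-free , z-free ∷ proj₂ g-free

    private
      merge-laurent : ∀ h g s e X → frac (h *ᶠ g) K.* μ (lam^ i (s / 1) · e) K.* inv X ≃ frac h K.* λ^ s K.* (frac g K.* μ e K.* inv X)
      merge-laurent h g s e X = K.trans (K.*-congʳ (K.*-cong (frac-* h g)
          (K.trans (μ-· (lam^ i (s / 1)) e) (K.*-congʳ (K.sym (λ^-μ s))))))
        (solveᴷ 5 (λ h g s e v → (h ⊛ g) ⊛ (s ⊛ e) ⊛ v ⊜ h ⊛ s ⊛ (g ⊛ e ⊛ v)) K.refl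
          (frac h) (frac g) (λ^ s) (μ e) (inv X))

      merge-proper : ∀ h g s e Y X → frac (h *ᶠ g) K.* μ (lam^ i (s / 1) · e) K.* (inv X K.* inv Y)
                     ≃ frac h K.* λ^ s K.* inv Y K.* (frac g K.* μ e K.* inv X)
      merge-proper h g s e Y X = K.trans (K.*-congʳ (K.*-cong (frac-* h g)
          (K.trans (μ-· (lam^ i (s / 1)) e) (K.*-congʳ (K.sym (λ^-μ s))))))
        (solveᴷ 6 (λ h g s e v u → (h ⊛ g) ⊛ (s ⊛ e) ⊛ (v ⊛ u) ⊜ h ⊛ s ⊛ u ⊛ (g ⊛ e ⊛ v)) K.refl
          (frac h) (frac g) (λ^ s) (μ e) (inv X) (inv Y))

      lam^-integral : ∀ s → IsInteger (exponent i (lam^ i (s / 1)))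
      lam^-integral s = subst IsInteger (sym (exponent-lam^ (s / 1))) (IsInteger-/1 s)

    module _ {S : List (Fin n)} (ℓ : Fin n) (x : Mono≢1) (eq : f ℓ ≡ just x) (x≢0 : exponent i (proj₁ x) ≢ 0ℚ)
             (ℓ∉ : ℓ List∈.∉ S) (g : FracRat) (g-free : LamFree i g) (e : Mono) (int : IsInteger (exponent i e)) where

      -- Since ℓ is not in S, the new factor never meets itself: a product with a proper term has
      -- two different factors, which `proper-proper` separates.
      multiply : ∀ {k} → Span S k → Span (ℓ ∷ S) (k K.* (frac g K.* μ e K.* inv (nonneg i x)))
      multiply (along p d)          = along (K.*-congʳ p) (multiply d)
      multiply none                 = along (K.sym (K.zeroˡ _)) none
      multiply (plus d d′)          = along (K.sym (K.distribʳ _ _ _)) (plus (multiply d) (multiply d′))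
      multiply (laurent h h-free s) = along (merge-laurent h g s e (nonneg i x))
        (proper-mono ℓ x eq x≢0 (integral ℓ x eq) (here refl) (h *ᶠ g) (LamFree-* {h} {g} h-free g-free)
          (lam^ i (s / 1) · e) (exponent-·-integral (lam^ i (s / 1)) e (lam^-integral s) int))
      multiply (proper h h-free ℓ′ x′ eq′ x′≢0 ℓ′∈ s lt) = along (merge-proper h g (+ s) e (nonneg i x′) (nonneg i x))
        (proper-proper ℓ x eq x≢0 (here refl) ℓ′ x′ eq′ x′≢0 (there ℓ′∈) (λ { refl → ℓ∉ ℓ′∈ })
          (h *ᶠ g) (LamFree-* {h} {g} h-free g-free)
          (lam^ i (+ s / 1) · e) (exponent-·-integral (lam^ i (+ s / 1)) e (lam^-integral (+ s)) int))

    -- The rewriting 1 - x = -x (1 - x⁻¹), put into the form of a scalar times a monomial times an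
    -- inverse because this is what `multiply` accepts.
    inv-nonneg : ∀ x → IsInteger (exponent i (proj₁ x)) →
                 ∃ λ q → ∃ λ e → IsInteger (exponent i e) × frac (constant q) K.* μ e K.* inv (nonneg i x) ≃ inv x
    inv-nonneg x int with 0ℚ ℚ.≤? exponent i (proj₁ x)
    ... | yes _ = 1ℚ , 1ᴹ , subst IsInteger (sym (lookup-1ᴹ (lam i))) refl ,
      K.trans (K.*-congʳ (frac-1 (μ 1ᴹ))) (K.*-identityˡ (inv x))
    ... | no  _ = ℚ.- 1ℚ , proj₁ x ⁻¹ , exponent-⁻¹-integral (proj₁ x) int ,
      K.trans (K.*-assoc _ _ _) (K.trans (frac-neg1 _) (K.sym (inv-inverse x (x ⁻¹≢1) refl)))

    -- A factor free of λᵢ is a scalar for the decomposition and joins the coefficients; only the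
    -- other factors call for partial fractions.
    divide : ∀ {S k} ℓ x → f ℓ ≡ just x → ℓ List∈.∉ S → Span S k → Span (ℓ ∷ S) (k K.* inv x)
    divide {S} {k} ℓ x eq ℓ∉ d = case (exponent i (proj₁ x) ℚₚ.≟ 0ℚ)
      where
      case : Dec (exponent i (proj₁ x) ≡ 0ℚ) → Span (ℓ ∷ S) (k K.* inv x)
      case (yes x≡0) = along (K.trans (K.*-congʳ (K.trans (frac-/-inv (constant 1ℚ) x) (frac-1 (inv x)))) (K.*-comm (inv x) k))
        (scale-free (constant 1ℚ /1- x) (proj₁ (LamFree-constant 1ℚ) , x≡0 ∷ []) (weaken there d))
      case (no x≢0) = let q , e , e-int , same = inv-nonneg x (integral ℓ x eq) in
        along (K.*-congˡ {k} same) (multiply ℓ x eq x≢0 ℓ∉ (constant q) (LamFree-constant q) e e-int d)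

    span : ∀ N → Integral N → ∀ ℓs → Unique ℓs → Span ℓs (frac (N /∏ List.mapMaybe f ℓs))
    span N N-int []       []               = along (K.sym (frac-/∏[] N)) (laurent-sum N N-int)
    span N N-int (ℓ ∷ ℓs) (fresh ∷ unique) = case (f ℓ) refl
      where
      case : ∀ m → f ℓ ≡ m → Span (ℓ ∷ ℓs) (frac (N /∏ List.mapMaybe f (ℓ ∷ ℓs)))
      case nothing  eq = subst (λ xs → Span (ℓ ∷ ℓs) (frac (N /∏ xs))) (sym unfold) (weaken there (span N N-int ℓs unique))
        where
        unfold : List.mapMaybe f (ℓ ∷ ℓs) ≡ List.mapMaybe f ℓs
        unfold rewrite eq = refl
      case (just x) eq = subst (λ xs → Span (ℓ ∷ ℓs) (frac (N /∏ xs))) (sym unfold)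
        (along (K.sym (frac-/-inv (N /∏ List.mapMaybe f ℓs) x))
          (divide ℓ x eq (λ ℓ∈ → All.lookup fresh ℓ∈ refl) (span N N-int ℓs unique)))
        where
        unfold : List.mapMaybe f (ℓ ∷ ℓs) ≡ x ∷ List.mapMaybe f ℓs
        unfold rewrite eq = refl

  -- From the span to the prescribed shape of a decomposition

  module NormalForm (f : Fin n → Maybe Mono≢1) where

    open Spans f

    lam^-+ : ∀ p q → lam^ i (p ℚ.+ q) ≡ lam^ i p · lam^ i q
    lam^-+ p q = lookup-ext λ t → case t (t Finₚ.≟ lam i)
      where
      other : ∀ q t → t ≢ lam i → lookup (lam^ i q) t ≡ 0ℚ
      other q t ne = trans (Vecₚ.lookup∘updateAt′ t (lam i) ne 1ᴹ) (lookup-1ᴹ t)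
      case : ∀ t → Dec (t ≡ lam i) → lookup (lam^ i (p ℚ.+ q)) t ≡ lookup (lam^ i p · lam^ i q) t
      case t (yes refl) = trans (exponent-lam^ (p ℚ.+ q)) (sym (trans (exponent-· (lam^ i p) (lam^ i q))
        (cong₂ ℚ._+_ (exponent-lam^ p) (exponent-lam^ q))))
      case t (no ne)    = trans (other (p ℚ.+ q) t ne) (sym (trans (lookup-· (lam^ i p) (lam^ i q) t)
        (cong₂ ℚ._+_ (other p t ne) (other q t ne))))

    λ^-+ : ∀ s t → λ^ (s ℤ.+ t) ≃ λ^ s K.* λ^ t
    λ^-+ s t = K.trans (λ^-μ (s ℤ.+ t)) (K.trans (K.reflexive (cong μ (trans (cong (lam^ i) (/1-+ s t)) (lam^-+ (s / 1) (t / 1)))))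
      (K.trans (μ-· _ _) (K.sym (K.*-cong (λ^-μ s) (λ^-μ t)))))

    λ^-0 : λ^ (+ 0) ≃ K.1#
    λ^-0 = K.trans (λ^-μ (+ 0)) (K.reflexive (cong μ (lookup-ext λ t → case t (t Finₚ.≟ lam i))))
      where
      case : ∀ t → Dec (t ≡ lam i) → lookup (lam^ i 0ℚ) t ≡ lookup 1ᴹ t
      case t (yes refl) = trans (exponent-lam^ 0ℚ) (sym (lookup-1ᴹ t))
      case t (no ne)    = Vecₚ.lookup∘updateAt′ t (lam i) ne 1ᴹ

    λ^-inverse : ∀ s → λ^ (ℤ.- s) K.* λ^ s ≃ K.1#
    λ^-inverse s = K.trans (K.sym (λ^-+ (ℤ.- s) s)) (K.trans (K.reflexive (cong λ^ (ℤₚ.+-inverseˡ s))) λ^-0)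

    ⟦_⟧ᴷ : Poly i → Fraction
    ⟦ A ⟧ᴷ = frac (⟦_⟧ i A)

    private
      eval-∷ : ∀ c cs → frac (eval (c ∷ cs)) ≃ frac c K.+ λ^ (+ 1) K.* frac (eval cs)
      eval-∷ c cs = K.trans (frac-+ c (lam^ i 1ℚ ⊙ eval cs)) (K.+-congˡ (K.trans (frac-⊙ (lam^ i 1ℚ) (eval cs)) (K.*-congʳ (K.sym (λ^-μ (+ 1))))))

      add : List FracRat → List FracRat → List FracRat
      add []       ds       = ds
      add (c ∷ cs) []       = c ∷ cs
      add (c ∷ cs) (d ∷ ds) = c +ᶠ d ∷ add cs ds

      add-free : ∀ {cs ds} → All (LamFree i) cs → All (LamFree i) ds → All (LamFree i) (add cs ds)
      add-free []       qs       = qs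
      add-free (p ∷ ps) []       = p ∷ ps
      add-free {c ∷ _} {d ∷ _} (p ∷ ps) (q ∷ qs) = LamFree-+ {c} {d} p q ∷ add-free ps qs

      add-length : ∀ {N} cs ds → length cs ℕ.≤ N → length ds ℕ.≤ N → length (add cs ds) ℕ.≤ N
      add-length []       ds       le       le′       = le′
      add-length (c ∷ cs) []       le       le′       = le
      add-length (c ∷ cs) (d ∷ ds) (s≤s le) (s≤s le′) = s≤s (add-length cs ds le le′)

      add-eval : ∀ cs ds → frac (eval (add cs ds)) ≃ frac (eval cs) K.+ frac (eval ds)
      add-eval []       ds       = K.sym (K.trans (K.+-congʳ frac-0) (K.+-identityˡ _))
      add-eval (c ∷ cs) []       = K.sym (K.trans (K.+-congˡ frac-0) (K.+-identityʳ _))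
      add-eval (c ∷ cs) (d ∷ ds) = begin
        frac (eval (c +ᶠ d ∷ add cs ds))   ≈⟨ eval-∷ (c +ᶠ d) (add cs ds) ⟩
        frac (c +ᶠ d) K.+ λ^ (+ 1) K.* frac (eval (add cs ds))
          ≈⟨ K.+-cong (frac-+ c d) (K.*-congˡ {λ^ (+ 1)} (add-eval cs ds)) ⟩
        frac c K.+ frac d K.+ λ^ (+ 1) K.* (frac (eval cs) K.+ frac (eval ds))
          ≈⟨ solveᴷ 5 (λ c d l p q → c ⊹ d ⊹ l ⊛ (p ⊹ q) ⊜ (c ⊹ l ⊛ p) ⊹ (d ⊹ l ⊛ q)) K.refl
               (frac c) (frac d) (λ^ (+ 1)) (frac (eval cs)) (frac (eval ds)) ⟩
        (frac c K.+ λ^ (+ 1) K.* frac (eval cs)) K.+ (frac d K.+ λ^ (+ 1) K.* frac (eval ds))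
          ≈⟨ K.+-cong (eval-∷ c cs) (eval-∷ d ds) ⟨
        frac (eval (c ∷ cs)) K.+ frac (eval (d ∷ ds)) ∎

      raise : ℕ → List FracRat → List FracRat
      raise zero    cs = cs
      raise (suc k) cs = 0ᶠ ∷ raise k cs

      raise-free : ∀ k {cs} → All (LamFree i) cs → All (LamFree i) (raise k cs)
      raise-free zero    fs = fs
      raise-free (suc k) fs = ([] , []) ∷ raise-free k fs

      raise-length : ∀ k cs → length (raise k cs) ≡ k ℕ.+ length cs
      raise-length zero    cs = refl
      raise-length (suc k) cs = cong suc (raise-length k cs)

      raise-eval : ∀ k cs → frac (eval (raise k cs)) ≃ λ^ (+ k) K.* frac (eval cs)
      raise-eval zero    cs = K.sym (K.trans (K.*-congʳ λ^-0) (K.*-identityˡ _))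
      raise-eval (suc k) cs = begin
        frac (eval (0ᶠ ∷ raise k cs))                          ≈⟨ eval-∷ 0ᶠ (raise k cs) ⟩
        frac 0ᶠ K.+ λ^ (+ 1) K.* frac (eval (raise k cs))      ≈⟨ K.trans (K.+-congʳ frac-0) (K.+-identityˡ _) ⟩
        λ^ (+ 1) K.* frac (eval (raise k cs))                  ≈⟨ K.*-congˡ {λ^ (+ 1)} (raise-eval k cs) ⟩
        λ^ (+ 1) K.* (λ^ (+ k) K.* frac (eval cs))             ≈⟨ K.*-assoc _ _ _ ⟨
        λ^ (+ 1) K.* λ^ (+ k) K.* frac (eval cs)               ≈⟨ K.*-congʳ (λ^-+ (+ 1) (+ k)) ⟨
        λ^ (+ suc k) K.* frac (eval cs)                        ∎

      ∅ : Poly i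
      ∅ = record { coeffs = [] ; free = [] }

      infixl 6 _⊞_
      _⊞_ : Poly i → Poly i → Poly i
      A ⊞ B = record { coeffs = add (coeffs A) (coeffs B) ; free = add-free (free A) (free B) }

      ↑ : ℕ → Poly i → Poly i
      ↑ k A = record { coeffs = raise k (coeffs A) ; free = raise-free k (free A) }

      const-poly : ∀ g → LamFree i g → Poly i
      const-poly g g-free = record { coeffs = g ∷ [] ; free = g-free ∷ [] }

      const-eval : ∀ g g-free → ⟦ const-poly g g-free ⟧ᴷ ≃ frac g
      const-eval g g-free = K.trans (eval-∷ g []) (K.trans (K.+-congˡ (K.trans (K.*-congˡ {λ^ (+ 1)} frac-0) (K.zeroʳ _))) (K.+-identityʳ (frac g)))

      power-eval : ∀ g g-free s → ⟦ ↑ s (const-poly g g-free) ⟧ᴷ ≃ frac g K.* λ^ (+ s)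
      power-eval g g-free s = K.trans (raise-eval s (g ∷ [])) (K.trans (K.*-congˡ {λ^ (+ s)} (const-eval g g-free)) (K.*-comm (λ^ (+ s)) (frac g)))

      power-length : ∀ g g-free s → length (coeffs (↑ s (const-poly g g-free))) ≡ suc s
      power-length g g-free s = trans (raise-length s (g ∷ [])) (ℕₚ.+-comm s 1)

    Σᴷ : (Fin n → Fraction) → List (Fin n) → Fraction
    Σᴷ h = List.foldr (λ ℓ k → h ℓ K.+ k) K.0#

    private
      Σᴷ-+ : ∀ g h {u} → (∀ ℓ → u ℓ ≃ g ℓ K.+ h ℓ) → ∀ ℓs → Σᴷ u ℓs ≃ Σᴷ g ℓs K.+ Σᴷ h ℓs
      Σᴷ-+ g h eq []       = K.sym (K.+-identityʳ K.0#)
      Σᴷ-+ g h {u} eq (ℓ ∷ ℓs) = K.trans (K.+-cong (eq ℓ) (Σᴷ-+ g h eq ℓs))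
        (solveᴷ 4 (λ a b c d → (a ⊹ b) ⊹ (c ⊹ d) ⊜ (a ⊹ c) ⊹ (b ⊹ d)) K.refl (g ℓ) (h ℓ) (Σᴷ g ℓs) (Σᴷ h ℓs))

      Σᴷ-0 : ∀ h ℓs → All (λ ℓ → h ℓ ≃ K.0#) ℓs → Σᴷ h ℓs ≃ K.0#
      Σᴷ-0 h []       []       = K.refl
      Σᴷ-0 h (ℓ ∷ ℓs) (p ∷ ps) = K.trans (K.+-cong p (Σᴷ-0 h ℓs ps)) (K.+-identityʳ K.0#)

      Σᴷ-single : ∀ h ℓ → (∀ ℓ′ → ℓ′ ≢ ℓ → h ℓ′ ≃ K.0#) → ∀ ℓs → Unique ℓs → ℓ ∈ ℓs → Σᴷ h ℓs ≃ h ℓ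
      Σᴷ-single h ℓ zeros (ℓ ∷ ℓs)  (fresh ∷ _) (here refl) =
        K.trans (K.+-congˡ (Σᴷ-0 h ℓs (All.map (λ ne → zeros _ (ne ∘ sym)) fresh))) (K.+-identityʳ (h ℓ))
      Σᴷ-single h ℓ zeros (ℓ′ ∷ ℓs) (fresh ∷ unique) (there ℓ∈) =
        K.trans (K.+-cong (zeros ℓ′ (All.lookup fresh ℓ∈)) (Σᴷ-single h ℓ zeros ℓs unique ℓ∈)) (K.+-identityˡ (h ℓ))

    summand : Fraction → Maybe Mono≢1 → Fraction
    summand k (just x) = k K.* inv (nonneg i x)
    summand k nothing  = K.0#

    -- The shape required by `PartialFractions`, but as an equation in the ring of fractions, where
    -- sums of decompositions can be formed without common denominators of the coefficients.
    record Decomposed (k : Fraction) : Set where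
      field
        P p   : Poly i
        t     : ℕ
        A     : Fin n → Poly i
        deg-p : deg_<_ i p t
        deg-A : ∀ ℓ x → f ℓ ≡ just x → deg_<_ i (A ℓ) (degree i x)
        value : k ≃ ⟦ P ⟧ᴷ K.+ λ^ (ℤ.- (+ t)) K.* ⟦ p ⟧ᴷ K.+ Σᴷ (λ ℓ → summand ⟦ A ℓ ⟧ᴷ (f ℓ)) (allFin n)

    private
      summand-+ : ∀ {k k′ k″} m → k ≃ k′ K.+ k″ → summand k m ≃ summand k′ m K.+ summand k″ m
      summand-+ (just x) eq = K.trans (K.*-congʳ eq) (K.distribʳ (inv (nonneg i x)) _ _)
      summand-+ nothing  eq = K.sym (K.+-identityʳ K.0#)

      summand-0 : ∀ m → summand ⟦ ∅ ⟧ᴷ m ≃ K.0#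
      summand-0 (just x) = K.trans (K.*-congʳ frac-0) (K.zeroˡ _)
      summand-0 nothing  = K.refl

      Σ-∅ : Σᴷ (λ ℓ → summand ⟦ ∅ ⟧ᴷ (f ℓ)) (allFin n) ≃ K.0#
      Σ-∅ = Σᴷ-0 (λ ℓ → summand ⟦ ∅ ⟧ᴷ (f ℓ)) (allFin n) (All.universal (λ ℓ → summand-0 (f ℓ)) (allFin n))

      principal-0 : ∀ s → λ^ s K.* ⟦ ∅ ⟧ᴷ ≃ K.0#
      principal-0 s = K.trans (K.*-congˡ {λ^ s} frac-0) (K.zeroʳ (λ^ s))

      decomposed-plus : ∀ {k k′} → Decomposed k → Decomposed k′ → Decomposed (k K.+ k′)
      decomposed-plus {k} {k′} d d′ = record
        -- The principal parts are put over the common power λᵢ^(t + t′), so each numerator is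
        -- raised by the exponent of the other.
        { P = D.P ⊞ D′.P ; p = ↑ D′.t D.p ⊞ ↑ D.t D′.p ; t = D.t ℕ.+ D′.t ; A = λ ℓ → D.A ℓ ⊞ D′.A ℓ
        ; deg-p = add-length (raise D′.t (coeffs D.p)) (raise D.t (coeffs D′.p))
            (ℕₚ.≤-trans (ℕₚ.≤-reflexive (raise-length D′.t (coeffs D.p)))
              (ℕₚ.≤-trans (ℕₚ.+-monoʳ-≤ D′.t D.deg-p) (ℕₚ.≤-reflexive (ℕₚ.+-comm D′.t D.t))))
            (ℕₚ.≤-trans (ℕₚ.≤-reflexive (raise-length D.t (coeffs D′.p))) (ℕₚ.+-monoʳ-≤ D.t D′.deg-p))
        ; deg-A = λ ℓ x eq → add-length (coeffs (D.A ℓ)) (coeffs (D′.A ℓ)) (D.deg-A ℓ x eq) (D′.deg-A ℓ x eq)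
        ; value = begin
            k K.+ k′ ≈⟨ K.+-cong D.value D′.value ⟩
            (⟦ D.P ⟧ᴷ K.+ λ^ (ℤ.- (+ D.t)) K.* ⟦ D.p ⟧ᴷ K.+ ΣA) K.+ (⟦ D′.P ⟧ᴷ K.+ λ^ (ℤ.- (+ D′.t)) K.* ⟦ D′.p ⟧ᴷ K.+ ΣA′)
              ≈⟨ solveᴷ 6 (λ a b c d e f → ((a ⊹ b) ⊹ c) ⊹ ((d ⊹ e) ⊹ f) ⊜ ((a ⊹ d) ⊹ (b ⊹ e)) ⊹ (c ⊹ f)) K.refl
                   ⟦ D.P ⟧ᴷ (λ^ (ℤ.- (+ D.t)) K.* ⟦ D.p ⟧ᴷ) ΣA ⟦ D′.P ⟧ᴷ (λ^ (ℤ.- (+ D′.t)) K.* ⟦ D′.p ⟧ᴷ) ΣA′ ⟩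
            (⟦ D.P ⟧ᴷ K.+ ⟦ D′.P ⟧ᴷ) K.+ (λ^ (ℤ.- (+ D.t)) K.* ⟦ D.p ⟧ᴷ K.+ λ^ (ℤ.- (+ D′.t)) K.* ⟦ D′.p ⟧ᴷ) K.+ (ΣA K.+ ΣA′)
              ≈⟨ K.+-cong (K.+-cong (add-eval (coeffs D.P) (coeffs D′.P)) principal)
                   (Σᴷ-+ (λ ℓ → summand ⟦ D.A ℓ ⟧ᴷ (f ℓ)) (λ ℓ → summand ⟦ D′.A ℓ ⟧ᴷ (f ℓ))
                     (λ ℓ → summand-+ (f ℓ) (add-eval (coeffs (D.A ℓ)) (coeffs (D′.A ℓ)))) (allFin n)) ⟨
            ⟦ D.P ⊞ D′.P ⟧ᴷ K.+ λ^ (ℤ.- (+ (D.t ℕ.+ D′.t))) K.* ⟦ ↑ D′.t D.p ⊞ ↑ D.t D′.p ⟧ᴷ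
              K.+ Σᴷ (λ ℓ → summand ⟦ D.A ℓ ⊞ D′.A ℓ ⟧ᴷ (f ℓ)) (allFin n) ∎ }
        where
        module D = Decomposed d
        module D′ = Decomposed d′
        ΣA ΣA′ : Fraction
        ΣA  = Σᴷ (λ ℓ → summand ⟦ D.A ℓ ⟧ᴷ (f ℓ)) (allFin n)
        ΣA′ = Σᴷ (λ ℓ → summand ⟦ D′.A ℓ ⟧ᴷ (f ℓ)) (allFin n)
        principal : λ^ (ℤ.- (+ (D.t ℕ.+ D′.t))) K.* ⟦ ↑ D′.t D.p ⊞ ↑ D.t D′.p ⟧ᴷ
                    ≃ λ^ (ℤ.- (+ D.t)) K.* ⟦ D.p ⟧ᴷ K.+ λ^ (ℤ.- (+ D′.t)) K.* ⟦ D′.p ⟧ᴷ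
        principal = begin
          λ^ (ℤ.- (+ (D.t ℕ.+ D′.t))) K.* ⟦ ↑ D′.t D.p ⊞ ↑ D.t D′.p ⟧ᴷ
            ≈⟨ K.*-cong (K.trans (K.reflexive (cong λ^ (ℤₚ.neg-distrib-+ (+ D.t) (+ D′.t)))) (λ^-+ (ℤ.- (+ D.t)) (ℤ.- (+ D′.t))))
                 (K.trans (add-eval (raise D′.t (coeffs D.p)) (raise D.t (coeffs D′.p))) (K.+-cong (raise-eval D′.t (coeffs D.p)) (raise-eval D.t (coeffs D′.p)))) ⟩
          λ^ (ℤ.- (+ D.t)) K.* λ^ (ℤ.- (+ D′.t)) K.* (λ^ (+ D′.t) K.* ⟦ D.p ⟧ᴷ K.+ λ^ (+ D.t) K.* ⟦ D′.p ⟧ᴷ)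
            ≈⟨ solveᴷ 6 (λ u v u′ v′ p q → (u ⊛ v) ⊛ (v′ ⊛ p ⊹ u′ ⊛ q) ⊜ (v ⊛ v′) ⊛ (u ⊛ p) ⊹ (u ⊛ u′) ⊛ (v ⊛ q)) K.refl
                 (λ^ (ℤ.- (+ D.t))) (λ^ (ℤ.- (+ D′.t))) (λ^ (+ D.t)) (λ^ (+ D′.t)) ⟦ D.p ⟧ᴷ ⟦ D′.p ⟧ᴷ ⟩
          λ^ (ℤ.- (+ D′.t)) K.* λ^ (+ D′.t) K.* (λ^ (ℤ.- (+ D.t)) K.* ⟦ D.p ⟧ᴷ) K.+ λ^ (ℤ.- (+ D.t)) K.* λ^ (+ D.t) K.* (λ^ (ℤ.- (+ D′.t)) K.* ⟦ D′.p ⟧ᴷ)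
            ≈⟨ K.+-cong (K.trans (K.*-congʳ (λ^-inverse (+ D′.t))) (K.*-identityˡ _)) (K.trans (K.*-congʳ (λ^-inverse (+ D.t))) (K.*-identityˡ _)) ⟩
          λ^ (ℤ.- (+ D.t)) K.* ⟦ D.p ⟧ᴷ K.+ λ^ (ℤ.- (+ D′.t)) K.* ⟦ D′.p ⟧ᴷ ∎

      decomposed-laurent : ∀ g → LamFree i g → ∀ s → Decomposed (frac g K.* λ^ s)
      decomposed-laurent g g-free (+ s) = record
        { P = ↑ s (const-poly g g-free) ; p = ∅ ; t = 0 ; A = λ _ → ∅ ; deg-p = z≤n ; deg-A = λ _ _ _ → z≤n
        ; value = K.sym (K.trans (K.+-cong (K.+-cong (power-eval g g-free s) (principal-0 (+ 0))) Σ-∅)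
            (K.trans (K.+-identityʳ _) (K.+-identityʳ _))) }
      decomposed-laurent g g-free ℤ.-[1+ k ] = record
        { P = ∅ ; p = const-poly g g-free ; t = suc k ; A = λ _ → ∅ ; deg-p = s≤s z≤n ; deg-A = λ _ _ _ → z≤n
        ; value = K.sym (K.trans (K.+-cong (K.+-cong frac-0 (K.*-congˡ {λ^ ℤ.-[1+ k ]} (const-eval g g-free))) Σ-∅)
            (K.trans (K.+-identityʳ _) (K.trans (K.+-identityˡ _) (K.*-comm _ _)))) }

      decomposed-proper : ∀ g → LamFree i g → ∀ ℓ x → f ℓ ≡ just x → ∀ s → s ℕ.< degree i x →
                          Decomposed (frac g K.* λ^ (+ s) K.* inv (nonneg i x))
      decomposed-proper g g-free ℓ x eq s lt = record
        { P = ∅ ; p = ∅ ; t = 0 ; A = λ ℓ′ → pick (ℓ′ Finₚ.≟ ℓ) ; deg-p = z≤n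
        ; deg-A = λ ℓ′ x′ eq′ → pick-deg ℓ′ x′ eq′ (ℓ′ Finₚ.≟ ℓ)
        ; value = K.sym (K.trans (K.+-cong (K.trans (K.+-cong frac-0 (principal-0 (+ 0))) (K.+-identityʳ K.0#))
            (K.trans (Σᴷ-single _ ℓ (λ ℓ′ ne → off ℓ′ ne (ℓ′ Finₚ.≟ ℓ)) (allFin n) (Uniqueₚ.allFin⁺ n) (∈-allFin ℓ)) (on (ℓ Finₚ.≟ ℓ))))
            (K.+-identityˡ _)) }
        where
        pick : ∀ {ℓ′} → Dec (ℓ′ ≡ ℓ) → Poly i
        pick (yes _) = ↑ s (const-poly g g-free)
        pick (no _)  = ∅
        pick-deg : ∀ ℓ′ x′ → f ℓ′ ≡ just x′ → (d : Dec (ℓ′ ≡ ℓ)) → deg_<_ i (pick d) (degree i x′)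
        pick-deg ℓ′ x′ eq′ (no _)     = z≤n
        pick-deg ℓ′ x′ eq′ (yes refl) with trans (sym eq) eq′
        ... | refl = ℕₚ.≤-trans (ℕₚ.≤-reflexive (power-length g g-free s)) lt
        off : ∀ ℓ′ → ℓ′ ≢ ℓ → (d : Dec (ℓ′ ≡ ℓ)) → summand ⟦ pick d ⟧ᴷ (f ℓ′) ≃ K.0#
        off ℓ′ ne (yes p) = contradiction p ne
        off ℓ′ ne (no _)  = summand-0 (f ℓ′)
        on : (d : Dec (ℓ ≡ ℓ)) → summand ⟦ pick d ⟧ᴷ (f ℓ) ≃ frac g K.* λ^ (+ s) K.* inv (nonneg i x)
        on (yes _)  = K.trans (K.reflexive (cong (summand _) eq)) (K.*-congʳ (power-eval g g-free s))
        on (no ne)  = contradiction refl ne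

    span-decomposed : ∀ {S k} → Span S k → Decomposed k
    span-decomposed (along eq d) = record { Decomposed (span-decomposed d) ; value = K.trans (K.sym eq) (Decomposed.value (span-decomposed d)) }
    span-decomposed none = record
      { P = ∅ ; p = ∅ ; t = 0 ; A = λ _ → ∅ ; deg-p = z≤n ; deg-A = λ _ _ _ → z≤n
      ; value = K.sym (K.trans (K.+-cong (K.+-cong frac-0 (principal-0 (+ 0))) Σ-∅) (K.trans (K.+-identityʳ _) (K.+-identityʳ K.0#))) }
    span-decomposed (plus d d′)                             = decomposed-plus (span-decomposed d) (span-decomposed d′)
    span-decomposed (laurent g g-free s)                    = decomposed-laurent g g-free s
    span-decomposed (proper g g-free ℓ x eq _ _ s lt)       = decomposed-proper g g-free ℓ x eq s lt

    module _ (k : Fraction) (d : Decomposed k) where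
      open Decomposed d

      private
        fractions-sum : ∀ ℓs → frac (∑ᶠ (List.map (λ ℓ → maybe′ (λ x → ⟦_⟧ i (A ℓ) /1- nonneg i x) 0ᶠ (f ℓ)) ℓs))
                        ≃ Σᴷ (λ ℓ → summand ⟦ A ℓ ⟧ᴷ (f ℓ)) ℓs
        fractions-sum []       = frac-0
        fractions-sum (ℓ ∷ ℓs) = K.trans (frac-+ (maybe′ (λ x → ⟦_⟧ i (A ℓ) /1- nonneg i x) 0ᶠ (f ℓ)) _) (K.+-cong (one (f ℓ)) (fractions-sum ℓs))
          where
          one : ∀ m → frac (maybe′ (λ x → ⟦_⟧ i (A ℓ) /1- nonneg i x) 0ᶠ m) ≃ summand ⟦ A ℓ ⟧ᴷ m
          one (just x) = frac-/-inv (⟦_⟧ i (A ℓ)) (nonneg i x)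
          one nothing  = frac-0

      decomposed-frac : k ≃ frac (⟦_⟧ i P +ᶠ lam^ i (ℚ.- (+ t / 1)) ⊙ ⟦_⟧ i p
        +ᶠ ∑ᶠ (List.map (λ ℓ → maybe′ (λ x → ⟦_⟧ i (A ℓ) /1- nonneg i x) 0ᶠ (f ℓ)) (allFin n)))
      decomposed-frac = K.trans value (K.sym (K.trans (frac-+ (X +ᶠ Y) Z) (K.+-cong
        (K.trans (frac-+ X Y) (K.+-congˡ (K.trans (frac-⊙ (lam^ i (ℚ.- (+ t / 1))) (⟦_⟧ i p))
          (K.*-congʳ (K.trans (K.reflexive (cong (λ q → μ (lam^ i q)) (sym (/1-neg (+ t))))) (K.sym (λ^-μ (ℤ.- (+ t)))))))))
        (fractions-sum (allFin n)))))
        where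
        X Y Z : FracRat
        X = ⟦_⟧ i P
        Y = lam^ i (ℚ.- (+ t / 1)) ⊙ ⟦_⟧ i p
        Z = ∑ᶠ (List.map (λ ℓ → maybe′ (λ x → ⟦_⟧ i (A ℓ) /1- nonneg i x) 0ᶠ (f ℓ)) (allFin n))

  -- Replacing λᵢ by λᵢ^m

  y≢lam : ∀ ℓ → y ℓ ≢ lam i
  y≢lam ℓ eq = case (trans (sym (Finₚ.splitAt-↑ˡ n ℓ r)) (trans (cong (splitAt n) eq) (Finₚ.splitAt-↑ʳ n r i)))
    where
    case : inj₁ ℓ ≢ inj₂ i
    case ()

  map-just : ∀ {A B : Set} (g : A → B) (m : Maybe A) {z} → Maybe.map g m ≡ just z → ∃ λ x → m ≡ just x × g x ≡ z
  map-just g (just x) refl = x , refl , refl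

  module _ (m : ℕ) where

    private
      κ : ∀ {t} → Dec (t ≡ lam i) → ℚ
      κ (yes _) = + m / 1
      κ (no _)  = 1ℚ

      κᵗ : Fin (n ℕ.+ r) → ℚ
      κᵗ t = κ (t Finₚ.≟ lam i)

      scale-κ : ∀ e t (d : Dec (t ≡ lam i)) → scale i m e t d ≡ κ d ℚ.* lookup e t
      scale-κ e t (yes _) = refl
      scale-κ e t (no _)  = sym (ℚₚ.*-identityˡ (lookup e t))

    lookup-subst : ∀ e t → lookup (substᴹ i m e) t ≡ κᵗ t ℚ.* lookup e t
    lookup-subst e t = trans (Vecₚ.lookup∘tabulate (λ t → scale i m e t (t Finₚ.≟ lam i)) t) (scale-κ e t (t Finₚ.≟ lam i))

    subst-lam-exponent : ∀ e → exponent i (substᴹ i m e) ≡ (+ m / 1) ℚ.* exponent i e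
    subst-lam-exponent e = trans (lookup-subst e (lam i)) (cong (ℚ._* exponent i e) (at-lam (lam i Finₚ.≟ lam i)))
      where
      at-lam : (d : Dec (lam i ≡ lam i)) → κ d ≡ + m / 1
      at-lam (yes _)  = refl
      at-lam (no ne)  = contradiction refl ne

    subst-other : ∀ e t → t ≢ lam i → lookup (substᴹ i m e) t ≡ lookup e t
    subst-other e t t≢ = trans (lookup-subst e t) (trans (cong (ℚ._* lookup e t) (elsewhere (t Finₚ.≟ lam i))) (ℚₚ.*-identityˡ (lookup e t)))
      where
      elsewhere : (d : Dec (t ≡ lam i)) → κ d ≡ 1ℚ
      elsewhere (yes p) = contradiction p t≢
      elsewhere (no _)  = refl

    subst-1 : substᴹ i m 1ᴹ ≡ 1ᴹ
    subst-1 = lookup-ext λ t → trans (lookup-subst 1ᴹ t)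
      (trans (cong (κᵗ t ℚ.*_) (lookup-1ᴹ t)) (trans (ℚₚ.*-zeroʳ (κᵗ t)) (sym (lookup-1ᴹ t))))

    subst-· : ∀ x z → substᴹ i m (x · z) ≡ substᴹ i m x · substᴹ i m z
    subst-· x z = lookup-ext λ t → trans (lookup-subst (x · z) t)
      (trans (cong (κᵗ t ℚ.*_) (lookup-· x z t)) (trans (ℚₚ.*-distribˡ-+ (κᵗ t) (lookup x t) (lookup z t))
        (sym (trans (lookup-· (substᴹ i m x) (substᴹ i m z) t) (cong₂ ℚ._+_ (lookup-subst x t) (lookup-subst z t))))))

    subst-^ : ∀ x q → substᴹ i m (x ^ℚ q) ≡ substᴹ i m x ^ℚ q
    subst-^ x q = lookup-ext λ t → trans (lookup-subst (x ^ℚ q) t)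
      (trans (cong (κᵗ t ℚ.*_) (lookup-^ x q t)) (trans (solve 3 (λ a b c → a :* (b :* c) := b :* (a :* c)) refl (κᵗ t) q (lookup x t))
        (sym (trans (lookup-^ (substᴹ i m x) q t) (cong (q ℚ.*_) (lookup-subst x t))))))

    subst-⁻¹ : ∀ x → substᴹ i m (x ⁻¹) ≡ substᴹ i m x ⁻¹
    subst-⁻¹ x = lookup-ext λ t → trans (lookup-subst (x ⁻¹) t)
      (trans (cong (κᵗ t ℚ.*_) (lookup-⁻¹ x t)) (trans (solve 2 (λ a b → a :* (:- b) := :- (a :* b)) refl (κᵗ t) (lookup x t))
        (sym (trans (lookup-⁻¹ (substᴹ i m x) t) (cong (λ q → ℚ.- q) (lookup-subst x t))))))

    subst-free : ∀ e → exponent i e ≡ 0ℚ → substᴹ i m e ≡ e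
    subst-free e eq = lookup-ext λ t → case t (t Finₚ.≟ lam i)
      where
      case : ∀ t → Dec (t ≡ lam i) → lookup (substᴹ i m e) t ≡ lookup e t
      case t (yes refl) = trans (subst-lam-exponent e) (trans (cong ((+ m / 1) ℚ.*_) eq) (trans (ℚₚ.*-zeroʳ (+ m / 1)) (sym eq)))
      case t (no ne)    = subst-other e t ne

    separated-subst : .{{_ : ℕ.NonZero m}} → ∀ F → Separated (factor F) → Separated (factor (subst-lam i m F))
    separated-subst F separated ℓ x eq with map-just (subst≢1 i m) (factor F ℓ) eq
    ... | x₀ , eq₀ , refl =
      (λ p → proj₁ (separated ℓ x₀ eq₀) (trans (sym (subst-other (proj₁ x₀) (y ℓ) (y≢lam ℓ))) p)) , others
      where
      others : ∀ ℓ′ x′ → factor (subst-lam i m F) ℓ′ ≡ just x′ → ℓ′ ≢ ℓ → lookup (proj₁ x′) (y ℓ) ≡ 0ℚ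
      others ℓ′ x′ eq′ ne with map-just (subst≢1 i m) (factor F ℓ′) eq′
      ... | x₀′ , eq₀′ , refl = trans (subst-other (proj₁ x₀′) (y ℓ) (y≢lam ℓ)) (proj₂ (separated ℓ x₀ eq₀) ℓ′ x₀′ eq₀′ ne)

  private
    exponents : Labelled → List ℚ
    exponents F = List.map (λ (_ , e) → exponent i e) (Labelled.num F)
               ++ List.map (λ ℓ → maybe′ (λ x → exponent i (proj₁ x)) 0ℚ (factor F ℓ)) (allFin n)

    integral-subst : ∀ F m .{{_ : ℕ.NonZero m}} → All (λ q → IsInteger ((+ m / 1) ℚ.* q)) (exponents F) → LamIntegral i (subst-lam i m F)
    integral-subst F m ints =
      Allₚ.map⁺ (All.map (λ {(_ , e)} int → subst IsInteger (sym (subst-lam-exponent m e)) int)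
        (Allₚ.map⁻ (Allₚ.++⁻ˡ (List.map (λ (_ , e) → exponent i e) (Labelled.num F)) ints))) ,
      factors
      where
      factors : ∀ ℓ x → factor (subst-lam i m F) ℓ ≡ just x → IsInteger (exponent i (proj₁ x))
      factors ℓ x eq with map-just (subst≢1 i m) (factor F ℓ) eq
      ... | x₀ , eq₀ , refl = subst IsInteger (sym (subst-lam-exponent m (proj₁ x₀)))
        (subst (λ u → IsInteger ((+ m / 1) ℚ.* maybe′ (λ x → exponent i (proj₁ x)) 0ℚ u)) eq₀
          (All.lookup (Allₚ.map⁻ (Allₚ.++⁻ʳ (List.map (λ (_ , e) → exponent i e) (Labelled.num F)) ints)) (∈-allFin ℓ)))

  partial-fractions : ∀ F → Separated (factor F) → PartialFractions i F
  partial-fractions F separated = record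
    { m = m ; m-pos = m≢0 ; integral = integral ; P = P ; p = p ; t = t ; A = A ; deg-p = deg-p ; deg-A = deg-A
    ; decomposed = ≃⇒≈ {⌞ F′ ⌟} (NF.decomposed-frac (frac ⌞ F′ ⌟) decomposition) }
    where
    common : ∃ λ m → ℕ.NonZero m × All (λ q → IsInteger ((+ m / 1) ℚ.* q)) (exponents F)
    common = common-denominator (exponents F)
    m : ℕ
    m = proj₁ common
    instance
      m≢0 : ℕ.NonZero m
      m≢0 = proj₁ (proj₂ common)
    F′ : Labelled
    F′ = subst-lam i m F
    integral : LamIntegral i F′
    integral = integral-subst F m (proj₂ (proj₂ common))
    module NF = NormalForm (factor F′)
    module SC = SpanClosure (factor F′) (separated-subst m F separated) (proj₂ integral)
    decomposition : NF.Decomposed (frac ⌞ F′ ⌟)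
    decomposition = NF.span-decomposed (SC.span (Labelled.num F′) (proj₁ integral) (allFin n) (Uniqueₚ.allFin⁺ n))
    open NF.Decomposed decomposition

  -- Partial fractions in 𝒵 F and in F

  module _ (v : Mono) (v≢0 : exponent i v ≢ 0ℚ) where

    exponent-eliminate : ∀ x → exponent i (eliminate i v v≢0 x) ≡ 0ℚ
    exponent-eliminate x = trans (exponent-· x _) (trans (cong (exponent i x ℚ.+_) (trans (lookup-^ v (ℚ.- ratio i v v≢0 x) (lam i))
      (trans (sym (ℚₚ.neg-distribˡ-* (ratio i v v≢0 x) (exponent i v))) (cong (λ q → ℚ.- q) (ratio-* i v v≢0 x)))))
      (ℚₚ.+-inverseʳ (exponent i x)))

    ratio-unique : ∀ x q → q ℚ.* exponent i v ≡ exponent i x → ratio i v v≢0 x ≡ q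
    ratio-unique x q eq = trans (cong (ℚ._* recip (exponent i v) v≢0) (sym eq))
      (trans (ℚₚ.*-assoc q (exponent i v) (recip (exponent i v) v≢0))
        (trans (cong (q ℚ.*_) (ratio-v i v v≢0)) (ℚₚ.*-identityʳ q)))

    module _ (v′ : Mono) (v′≢0 : exponent i v′ ≢ 0ℚ) (m : ℕ) (eq : v′ ≡ substᴹ i m v) where

      ratio-subst : ∀ x → ratio i v′ v′≢0 (substᴹ i m x) ≡ ratio i v v≢0 x
      ratio-subst x = trans (cong (ℚ._* recip (exponent i v′) v′≢0)
          (trans (subst-lam-exponent m x) (trans (cong ((+ m / 1) ℚ.*_) (sym (ratio-* i v v≢0 x)))
            (trans (solve 3 (λ a b c → a :* (b :* c) := b :* (a :* c)) refl (+ m / 1) (ratio i v v≢0 x) (exponent i v))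
              (cong (ratio i v v≢0 x ℚ.*_) (trans (sym (subst-lam-exponent m v)) (cong (exponent i) (sym eq))))))))
        (trans (ℚₚ.*-assoc (ratio i v v≢0 x) (exponent i v′) (recip (exponent i v′) v′≢0))
          (trans (cong (ratio i v v≢0 x ℚ.*_) (ratio-v i v′ v′≢0)) (ℚₚ.*-identityʳ (ratio i v v≢0 x))))

      eliminate-subst : ∀ x → eliminate i v′ v′≢0 (substᴹ i m x) ≡ eliminate i v v≢0 x
      eliminate-subst x = trans (cong (λ q → substᴹ i m x · v′ ^ℚ (ℚ.- q)) (ratio-subst x))
        (trans (cong (λ u → substᴹ i m x · u) (trans (cong (_^ℚ (ℚ.- ratio i v v≢0 x)) eq) (sym (subst-^ m v (ℚ.- ratio i v v≢0 x)))))
          (trans (sym (subst-· m x _)) (subst-free m (eliminate i v v≢0 x) (exponent-eliminate x))))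

      -- The exponents of λᵢ in x and in v are multiplied by the same m, so their ratio stays, and
      -- after elimination there is no λᵢ left on which the substitution could act. Residues of the
      -- rescaled function can therefore be computed in F, whatever m is.
      ρ-subst : ∀ x → PartialHom.to (ρ i v′ v′≢0) (substᴹ i m x) ≡ PartialHom.to (ρ i v v≢0) x
      ρ-subst x = case (isInteger? (ratio i v v≢0 x))
        where
        case : Dec (IsInteger (ratio i v v≢0 x)) → PartialHom.to (ρ i v′ v′≢0) (substᴹ i m x) ≡ PartialHom.to (ρ i v v≢0) x
        case (yes int) = trans (ρ-yes i v′ v′≢0 (substᴹ i m x) (subst IsInteger (sym (ratio-subst x)) int))
          (trans (cong just (eliminate-subst x)) (sym (ρ-yes i v v≢0 x int)))
        case (no ¬int) = trans (ρ-no i v′ v′≢0 (substᴹ i m x) (¬int ∘ subst IsInteger (ratio-subst x)))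
          (sym (ρ-no i v v≢0 x ¬int))

  private
    sign-up : ∀ k q → .{{_ : ℕ.NonZero k}} → 0ℚ ℚ.≤ q → 0ℚ ℚ.≤ (+ k / 1) ℚ.* q
    sign-up k q le = ℚₚ.≤-trans (ℚₚ.≤-reflexive (sym (ℚₚ.*-zeroʳ (+ k / 1)))) (ℚₚ.*-monoˡ-≤-nonNeg (+ k / 1) {{ℚₚ.pos⇒nonNeg (+ k / 1) {{ℚₚ.normalize-pos k 1}}}} le)

    sign-down : ∀ k q → .{{_ : ℕ.NonZero k}} → 0ℚ ℚ.≤ (+ k / 1) ℚ.* q → 0ℚ ℚ.≤ q
    sign-down k q le = ℚₚ.*-cancelˡ-≤-pos (+ k / 1) {{ℚₚ.normalize-pos k 1}}
      (ℚₚ.≤-trans (ℚₚ.≤-reflexive (ℚₚ.*-zeroʳ (+ k / 1))) le)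

  -- Multiplying an exponent by k > 0 keeps its sign, so the choice between x and x⁻¹ is the same
  -- before and after. This serves both λᵢ ↦ λᵢ^m and the passage from x to x^p in 𝒵.
  nonneg-scaled : ∀ k .{{_ : ℕ.NonZero k}} (φ : Mono → Mono) → (∀ z → φ (z ⁻¹) ≡ φ z ⁻¹) → ∀ x x′ →
                  proj₁ x′ ≡ φ (proj₁ x) → exponent i (proj₁ x′) ≡ (+ k / 1) ℚ.* exponent i (proj₁ x) →
                  proj₁ (nonneg i x′) ≡ φ (proj₁ (nonneg i x))
  nonneg-scaled k φ φ-⁻¹ x x′ eq scaled with 0ℚ ℚ.≤? exponent i (proj₁ x) | 0ℚ ℚ.≤? exponent i (proj₁ x′)
  ... | yes _  | yes _  = eq
  ... | no _   | no _   = trans (cong _⁻¹ eq) (sym (φ-⁻¹ (proj₁ x)))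
  ... | yes le | no nle = contradiction (subst (0ℚ ℚ.≤_) (sym scaled) (sign-up k _ le)) nle
  ... | no nle | yes le = contradiction (sign-down k _ (subst (0ℚ ℚ.≤_) scaled le)) nle

  module _ (m : ℕ) where

    σ : PartialHom
    σ = record
      { to = λ x → just (substᴹ i m x) ; to-1 = cong just (subst-1 m)
      ; to-· = λ { {x} z refl → cong just (subst-· m x z) } }

    σ-Dom : ∀ L → PartialHom.Dom σ L
    σ-Dom = All.universal λ (_ , x) → substᴹ i m x , refl

    σ-map : ∀ L → List.map (λ (c , e) → c , substᴹ i m e) L ≐ PartialHom.T σ L
    σ-map L = mk≐ λ f → trans (⟪map⟫ L (substᴹ i m) f) (sym (PartialHom.⟪T⟫ σ L f))

    σ-Images : .{{_ : ℕ.NonZero m}} → ∀ zs → Images σ zs (List.map (subst≢1 i m) zs)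
    σ-Images []       = []
    σ-Images (z ∷ zs) = refl ∷ σ-Images zs

    subst-den : .{{_ : ℕ.NonZero m}} → ∀ F → den ⌞ subst-lam i m F ⌟ ≡ List.map (subst≢1 i m) (den ⌞ F ⌟)
    subst-den F = sym (Listₚ.map-mapMaybe (subst≢1 i m) (factor F) (allFin n))

  module _ (F : Labelled) (separated : Separated (factor F)) (j : Fin n) (w : Mono≢1) (Fj : factor F j ≡ just w)
           (v : Mono) (v-eq : v ≡ proj₁ (nonneg i w)) (v≢0 : exponent i v ≢ 0ℚ) (w≢0 : exponent i (proj₁ w) ≢ 0ℚ)
           {zs us : List Mono≢1} (images : Images (ρ i v v≢0) zs us) {N : Laurent}
           (rep : frac ⌞ F ⌟ K.* (ι (1- v) K.* ι (∏1- zs)) ≃ ι N) where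

    private
      module V = PartialHom (ρ i v v≢0)

      module _ (D : PartialFractions i F) where
        open PartialFractions D renaming (m to s)

        w′ : Mono≢1
        w′ = subst≢1 i s w

        w′≢0 : exponent i (proj₁ w′) ≢ 0ℚ
        w′≢0 = *-≢0 (+ s / 1) (exponent i (proj₁ w)) (ℕ⇒ℚ-≢0 s) w≢0 ∘ trans (sym (subst-lam-exponent s (proj₁ w)))

        F′j : factor F′ j ≡ just w′
        F′j = cong (Maybe.map (subst≢1 i s)) Fj

        v′ : Mono
        v′ = proj₁ (nonneg i w′)

        v′≢0 : exponent i v′ ≢ 0ℚ
        v′≢0 = direction-≢0 F′ (separated-subst s F separated) integral j w′ F′j w′≢0

        v′-eq : v′ ≡ substᴹ i s v
        v′-eq = trans (nonneg-scaled s (substᴹ i s) (subst-⁻¹ s) w w′ refl (subst-lam-exponent s (proj₁ w))) (cong (substᴹ i s) (sym v-eq))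

        module V′ = PartialHom (ρ i v′ v′≢0)
        module σ′ = PartialHom (σ s)

        zs′ : List Mono≢1
        zs′ = List.map (subst≢1 i s) zs

        images′ : ∀ {zs us} → Images (ρ i v v≢0) zs us → Images (ρ i v′ v′≢0) (List.map (subst≢1 i s) zs) us
        images′ []             = []
        images′ (_∷_ {x = z} eq eqs) = trans (ρ-subst v v≢0 v′ v′≢0 s v′-eq (proj₁ z)) eq ∷ images′ eqs

        rep′ : frac ⌞ F′ ⌟ K.* (ι (1- v′) K.* ι (∏1- zs′)) ≃ ι (σ′.T N)
        rep′ = begin
          frac ⌞ F′ ⌟ K.* (ι (1- v′) K.* ι (∏1- zs′))
            ≈⟨ K.*-congˡ {frac ⌞ F′ ⌟} (K.trans (K.sym (ι-* (1- v′) (∏1- zs′))) (ι-cong (≐-sym image))) ⟩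
          frac ⌞ F′ ⌟ K.* ι (σ′.T ((1- v) *ᴸ ∏1- zs))
            ≈⟨ image-value (σ s) ⌞ F ⌟ ⌞ F′ ⌟ (σ-map s (num ⌞ F ⌟))
                 (≐-trans (R.reflexive (cong ∏1- (subst-den s F))) (≐-sym (Images-T (σ s) (σ-Images s (den ⌞ F ⌟)))))
                 (σ-Dom s (∏den ⌞ F ⌟)) (σ-Dom s ((1- v) *ᴸ ∏1- zs))
                 (K.trans (K.*-congˡ {frac ⌞ F ⌟} (ι-* (1- v) (∏1- zs))) rep) ⟩
          ι (σ′.T N) ∎
          where
          image : σ′.T ((1- v) *ᴸ ∏1- zs) ≐ (1- v′) *ᴸ ∏1- zs′
          image = ≐-trans (σ′.T-* (∏1- zs) (σ-Dom s (1- v)))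
            (R.*-cong {σ′.T (1- v)} {1- v′} (R.reflexive (trans (σ′.T-1- refl) (cong 1-_ (sym v′-eq)))) (Images-T (σ s) (σ-Images s zs)))

        T-σ : V′.T (σ′.T N) ≐ V.T N
        T-σ = mk≐ λ f → trans (V′.⟪T⟫ (σ′.T N) f) (trans (σ′.⟪T⟫ N (V′.extend f))
          (trans (⟪⟫-cong N λ x → cong (maybe′ f 0ℚ) (ρ-subst v v≢0 v′ v′≢0 s v′-eq x)) (sym (V.⟪T⟫ N f))))

        residue′ : Residue (ρ i v′ v′≢0) v′ (frac ⌞ F′ ⌟) (frac (_at0 i (A j)))
        residue′ = decomposition-residue F′ (separated-subst s F separated) integral j w′ F′j w′≢0 A deg-A P p t decomposed

        value′ : frac (_at0 i (A j)) K.* ι (V′.T (∏1- zs′)) ≃ ι (V′.T (σ′.T N))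
        value′ = Residue-value (ρ i v′ v′≢0) v′ residue′ (Images-Good (ρ i v′ v′≢0) (images′ images)) rep′

        at0-value : frac (_at0 i (A j)) K.* ι (∏1- us) ≃ ι (V.T N)
        at0-value = K.trans (K.*-congˡ {frac (_at0 i (A j))} (ι-cong (≐-sym (Images-T (ρ i v′ v′≢0) (images′ images)))))
          (K.trans value′ (ι-cong T-σ))

    -- Neither `N` nor `us` depends on the decomposition behind G. Because the factors of `us` can
    -- be cancelled, all values of `CT` at F agree up to `_≈_`.
    CT-value : ∀ {G} → CT i j F G → frac G K.* ι (∏1- us) ≃ ι (V.T N)
    CT-value {G} (_ , D , eq) = K.trans (K.*-congʳ (≈⇒≃ {G} {_at0 i (PartialFractions.A D j)} eq)) (at0-value D)

  -- The residues along v and v^p, before and after 𝒵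

  private
    module ZS = Data.Integer.Solver.+-*-Solver

    residue-unique : ∀ p .{{_ : ℕ.NonZero p}} t t₀ z → t ℕ.< p → t₀ ℕ.< p → + t ≡ + t₀ ℤ.+ z ℤ.* + p → t ≡ t₀
    residue-unique p t t₀ (+ zero) lt lt₀ eq = ℤₚ.+-injective (trans eq (trans (cong (λ u → + t₀ ℤ.+ u) (ℤₚ.*-zeroˡ (+ p))) (ℤₚ.+-identityʳ (+ t₀))))
    residue-unique p t t₀ (+ suc k) lt lt₀ eq = contradiction lt (ℕₚ.≤⇒≯ (subst (p ℕ.≤_) (sym t-eq)
        (ℕₚ.≤-trans (ℕₚ.m≤m+n p (k ℕ.* p)) (ℕₚ.m≤n+m (suc k ℕ.* p) t₀))))
      where
      t-eq : t ≡ t₀ ℕ.+ suc k ℕ.* p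
      t-eq = ℤₚ.+-injective (trans eq (trans (cong (λ u → + t₀ ℤ.+ u) (sym (ℤₚ.pos-* (suc k) p))) (sym (ℤₚ.pos-+ t₀ (suc k ℕ.* p)))))
    residue-unique p t t₀ ℤ.-[1+ k ] lt lt₀ eq = contradiction lt₀ (ℕₚ.≤⇒≯ (subst (p ℕ.≤_) (sym t₀-eq)
        (ℕₚ.≤-trans (ℕₚ.m≤m+n p (k ℕ.* p)) (ℕₚ.m≤n+m (suc k ℕ.* p) t))))
      where
      t₀-eq : t₀ ≡ t ℕ.+ suc k ℕ.* p
      t₀-eq = ℤₚ.+-injective (trans (sym (trans (cong (λ u → u ℤ.+ + (suc k ℕ.* p)) eq)
        (trans (ℤₚ.+-assoc (+ t₀) (ℤ.-[1+ k ] ℤ.* + p) (+ (suc k ℕ.* p)))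
          (trans (cong (λ u → + t₀ ℤ.+ u) (trans (cong (λ u → ℤ.-[1+ k ] ℤ.* + p ℤ.+ u) (ℤₚ.pos-* (suc k) p))
            (trans (sym (ℤₚ.*-distribʳ-+ (+ p) ℤ.-[1+ k ] (+ suc k))) (trans (cong (ℤ._* + p) (ℤₚ.+-inverseˡ (+ suc k))) (ℤₚ.*-zeroˡ (+ p))))))
            (ℤₚ.+-identityʳ (+ t₀)))))) (sym (ℤₚ.pos-+ t (suc k ℕ.* p))))

    geom-zero : ∀ v k g → (∀ t → t ℕ.< k → g (v ^[ t ]) ≡ 0ℚ) → ⟪ geom v k ⟫ g ≡ 0ℚ
    geom-zero v zero    g zeros = refl
    geom-zero v (suc k) g zeros = trans (⟪geom⟫ v k g)
      (cong₂ ℚ._+_ (geom-zero v k g λ t lt → zeros t (ℕₚ.m<n⇒m<1+n lt)) (zeros k ℕₚ.≤-refl))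

    geom-single : ∀ v k g t₀ → t₀ ℕ.< k → (∀ t → t ℕ.< k → t ≢ t₀ → g (v ^[ t ]) ≡ 0ℚ) → ⟪ geom v k ⟫ g ≡ g (v ^[ t₀ ])
    geom-single v (suc k) g t₀ lt zeros = case (t₀ ℕ.≟ k)
      where
      case : Dec (t₀ ≡ k) → ⟪ geom v (suc k) ⟫ g ≡ g (v ^[ t₀ ])
      case (yes refl) = trans (⟪geom⟫ v k g) (trans (cong (ℚ._+ g (v ^[ k ]))
        (geom-zero v k g λ t t<k → zeros t (ℕₚ.m<n⇒m<1+n t<k) (ℕₚ.<⇒≢ t<k))) (ℚₚ.+-identityˡ _))
      case (no ne)    = trans (⟪geom⟫ v k g) (trans (cong₂ ℚ._+_
        (geom-single v k g t₀ (ℕₚ.≤∧≢⇒< (ℕₚ.≤-pred lt) ne) λ t t<k → zeros t (ℕₚ.m<n⇒m<1+n t<k))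
        (zeros k ℕₚ.≤-refl (ne ∘ sym))) (ℚₚ.+-identityʳ _))

    ζ-extend-yes : ∀ g x → YIntegral x → PartialHom.extend ζ g x ≡ g x
    ζ-extend-yes g x int = cong (maybe′ g 0ℚ) (ζ-yes x int)

    ζ-extend-no : ∀ g x → ¬ YIntegral x → PartialHom.extend ζ g x ≡ 0ℚ
    ζ-extend-no g x ¬int = cong (maybe′ g 0ℚ) (ζ-no x ¬int)

    ζ-extend-0 : ∀ g x → g x ≡ 0ℚ → PartialHom.extend ζ g x ≡ 0ℚ
    ζ-extend-0 g x g≡0 = case (yIntegral? x)
      where
      case : Dec (YIntegral x) → PartialHom.extend ζ g x ≡ 0ℚ
      case (yes int) = trans (ζ-extend-yes g x int) g≡0
      case (no ¬int) = ζ-extend-no g x ¬int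

  module _ (v : Mono) (v≢0 : exponent i v ≢ 0ℚ) (p : ℕ) {{p≢0 : ℕ.NonZero p}}
           (V : Mono) (V≢0 : exponent i V ≢ 0ℚ) (V-eq : V ≡ v ^[ p ]) where

    private
      V-exponent : exponent i V ≡ (+ p / 1) ℚ.* exponent i v
      V-exponent = trans (cong (exponent i) V-eq) (lookup-^ v (+ p / 1) (lam i))

    ratio-power : ∀ x → ratio i v v≢0 x ≡ (+ p / 1) ℚ.* ratio i V V≢0 x
    ratio-power x = ratio-unique v v≢0 x ((+ p / 1) ℚ.* ratio i V V≢0 x)
      (trans (solve 3 (λ p a b → (p :* a) :* b := a :* (p :* b)) refl (+ p / 1) (ratio i V V≢0 x) (exponent i v))
        (trans (cong (ratio i V V≢0 x ℚ.*_) (sym V-exponent)) (ratio-* i V V≢0 x)))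

    eliminate-power : ∀ x → eliminate i V V≢0 x ≡ eliminate i v v≢0 x
    eliminate-power x = cong (x ·_) (trans (cong (_^ℚ (ℚ.- ratio i V V≢0 x)) V-eq)
      (trans (sym (^-* v (ℚ.- ratio i V V≢0 x) (+ p / 1))) (cong (v ^ℚ_)
        (trans (solve 2 (λ a p → (:- a) :* p := :- (p :* a)) refl (ratio i V V≢0 x) (+ p / 1))
          (cong (λ q → ℚ.- q) (sym (ratio-power x)))))))

    private
      module ρv = PartialHom (ρ i v v≢0)
      module ρV = PartialHom (ρ i V V≢0)
      module ζ′ = PartialHom ζ

      ratio-v^ : ∀ q → ratio i v v≢0 (v ^ℚ q) ≡ q
      ratio-v^ q = trans (ratio-^ v v≢0 v q) (trans (cong (q ℚ.*_) (ratio-v i v v≢0)) (ℚₚ.*-identityʳ q))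

      eliminate-v^ : ∀ x q → eliminate i v v≢0 (x · v ^ℚ q) ≡ eliminate i v v≢0 x
      eliminate-v^ x q = trans (eliminate-· i v v≢0 x (v ^ℚ q)) (trans (cong (eliminate i v v≢0 x ·_)
        (trans (cong (λ s → v ^ℚ q · v ^ℚ (ℚ.- s)) (ratio-v^ q)) (trans (sym (^-+ v q (ℚ.- q)))
          (trans (cong (v ^ℚ_) (ℚₚ.+-inverseʳ q)) (^-0 v))))) (·-identityʳ _))

      ratio-shift : ∀ x t → ratio i v v≢0 (x · v ^[ t ]) ≡ ratio i v v≢0 x ℚ.+ (+ t / 1)
      ratio-shift x t = trans (ratio-· i v v≢0 x (v ^[ t ])) (cong (ratio i v v≢0 x ℚ.+_) (ratio-v^ (+ t / 1)))

      module _ (f : Mono → ℚ) where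

        -- The test function for 𝒵 followed by the residue along V. Passing an operator to the test
        -- function reverses the order, so the residue stands inside.
        lhs : Mono → ℚ
        lhs = ζ′.extend (ρV.extend f)

        -- Every monomial kept along V = v^p is also kept along v, and multiplication by v^t does
        -- not change whether a monomial is kept along v. So all terms on the left are dropped.
        non-integral : ∀ x → ¬ IsInteger (ratio i v v≢0 x) →
                       ⟪ geom v p ⟫ (λ u → lhs (x · u)) ≡ ρv.extend (ζ′.extend f) x
        non-integral x ¬int = trans (geom-zero v p (λ u → lhs (x · u)) λ t _ →
            ζ-extend-0 (ρV.extend f) (x · v ^[ t ]) (cong (maybe′ f 0ℚ) (ρ-no i V V≢0 (x · v ^[ t ]) (¬int ∘ back t))))
          (sym (cong (maybe′ (ζ′.extend f) 0ℚ) (ρ-no i v v≢0 x ¬int)))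
          where
          back : ∀ t → IsInteger (ratio i V V≢0 (x · v ^[ t ])) → IsInteger (ratio i v v≢0 x)
          back t int = IsInteger-+ʳ (+ t / 1) (ratio i v v≢0 x) (IsInteger-/1 (+ t))
            (subst IsInteger (trans (sym (ratio-power (x · v ^[ t ]))) (trans (ratio-shift x t) (ℚₚ.+-comm (ratio i v v≢0 x) (+ t / 1))))
              (IsInteger-* (+ p / 1) (ratio i V V≢0 (x · v ^[ t ])) (IsInteger-/1 (+ p)) int))

        -- If x = x₀ v^s with s an integer, the only t < p for which p divides
        -- s + t is the residue of -s.
        integral : YIntegral V → ∀ x → IsInteger (ratio i v v≢0 x) →
                   ⟪ geom v p ⟫ (λ u → lhs (x · u)) ≡ ρv.extend (ζ′.extend f) x
        integral V-int x int = trans (geom-single v p (λ u → lhs (x · u)) t₀ (n%ℕd<d (ℤ.- s) p) others)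
          (trans (case (yIntegral? u₀)) (sym (cong (maybe′ (ζ′.extend f) 0ℚ) (ρ-yes i v v≢0 x int))))
          where
          open import Data.Integer.DivMod using (_%ℕ_; _/ℕ_; a≡a%ℕn+[a/ℕn]*n; n%ℕd<d)
          s κ : ℤ
          s = ↥ ratio i v v≢0 x
          κ = (ℤ.- s) /ℕ p
          t₀ : ℕ
          t₀ = (ℤ.- s) %ℕ p
          u₀ : Mono
          u₀ = x · v ^[ t₀ ]
          division : ℤ.- s ≡ + t₀ ℤ.+ κ ℤ.* + p
          division = a≡a%ℕn+[a/ℕn]*n (ℤ.- s) p
          ratio-s : ratio i v v≢0 x ≡ s / 1
          ratio-s = integer-≡ (ratio i v v≢0 x) int
          ratio-t : ∀ t → ratio i v v≢0 (x · v ^[ t ]) ≡ (s ℤ.+ + t) / 1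
          ratio-t t = trans (ratio-shift x t) (trans (cong (ℚ._+ (+ t / 1)) ratio-s) (sym (/1-+ s (+ t))))

          others : ∀ t → t ℕ.< p → t ≢ t₀ → lhs (x · v ^[ t ]) ≡ 0ℚ
          others t lt ne = ζ-extend-0 (ρV.extend f) (x · v ^[ t ]) (cong (maybe′ f 0ℚ) (ρ-no i V V≢0 (x · v ^[ t ]) λ int-t →
            ne (residue-unique p t t₀ (↥ ratio i V V≢0 (x · v ^[ t ]) ℤ.+ κ) lt (n%ℕd<d (ℤ.- s) p) (relation t int-t))))
            where
            relation : ∀ t → IsInteger (ratio i V V≢0 (x · v ^[ t ])) → + t ≡ + t₀ ℤ.+ (↥ ratio i V V≢0 (x · v ^[ t ]) ℤ.+ κ) ℤ.* + p
            relation t int-t = trans (sym (trans (cong (λ u → u ℤ.+ (s ℤ.+ + t)) division′) (ZS.solve 2 (λ s t → ZS.:- s ZS.:+ (s ZS.:+ t) ZS.:= t) refl s (+ t))))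
              (trans (cong (λ u → (+ t₀ ℤ.+ κ ℤ.* + p) ℤ.+ u) sum) (ZS.solve 4 (λ a k z p → (a ZS.:+ k ZS.:* p) ZS.:+ p ZS.:* z ZS.:= a ZS.:+ (z ZS.:+ k) ZS.:* p) refl (+ t₀) κ z (+ p)))
              where
              z : ℤ
              z = ↥ ratio i V V≢0 (x · v ^[ t ])
              division′ : + t₀ ℤ.+ κ ℤ.* + p ≡ ℤ.- s
              division′ = sym division
              sum : s ℤ.+ + t ≡ + p ℤ.* z
              sum = /1-injective {s ℤ.+ + t} {+ p ℤ.* z} (trans (sym (ratio-t t)) (trans (ratio-power (x · v ^[ t ]))
                (trans (cong ((+ p / 1) ℚ.*_) (integer-≡ (ratio i V V≢0 (x · v ^[ t ])) int-t)) (sym (/1-* (+ p) z)))))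

          -- By -s = t₀ + κ p, the power v^(-s) by which elimination multiplies is the product of
          -- v^t₀ and V^κ. As V is integral in 𝐲, u₀ is integral in 𝐲 exactly if the eliminated
          -- monomial is; so 𝒵 makes the same decision before and after the residue.
          eliminated : eliminate i v v≢0 x ≡ u₀ · V ^ℚ (κ / 1)
          eliminated = sym (trans (·-assoc x (v ^[ t₀ ]) (V ^ℚ (κ / 1))) (cong (x ·_)
            (trans (cong (v ^[ t₀ ] ·_) (trans (cong (_^ℚ (κ / 1)) V-eq) (sym (^-* v (κ / 1) (+ p / 1)))))
              (trans (sym (^-+ v (+ t₀ / 1) ((κ / 1) ℚ.* (+ p / 1)))) (cong (v ^ℚ_)
                (trans (cong ((+ t₀ / 1) ℚ.+_) (sym (/1-* κ (+ p)))) (trans (sym (/1-+ (+ t₀) (κ ℤ.* + p)))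
                  (trans (cong (_/ 1) (sym division)) (trans (/1-neg s) (cong (λ q → ℚ.- q) (sym ratio-s)))))))))))

          V^κ-int : YIntegral (V ^ℚ (κ / 1))
          V^κ-int = YIntegral-^ V (κ / 1) (IsInteger-/1 κ) V-int

          u₀-ratio : IsInteger (ratio i V V≢0 u₀)
          u₀-ratio = subst IsInteger (sym (ratio-unique V V≢0 u₀ ((ℤ.- κ) / 1) balance)) (IsInteger-/1 (ℤ.- κ))
            where
            s+t₀ : (ℤ.- κ) ℤ.* + p ≡ s ℤ.+ + t₀
            s+t₀ = trans (ZS.solve 3 (λ a k p → (ZS.:- k) ZS.:* p ZS.:= (ZS.:- (a ZS.:+ k ZS.:* p)) ZS.:+ a) refl (+ t₀) κ (+ p))
              (cong (ℤ._+ + t₀) (trans (cong (λ u → ℤ.- u) (sym division)) (ℤₚ.neg-involutive s)))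
            balance : ((ℤ.- κ) / 1) ℚ.* exponent i V ≡ exponent i u₀
            balance = trans (cong (((ℤ.- κ) / 1) ℚ.*_) V-exponent) (trans (sym (ℚₚ.*-assoc ((ℤ.- κ) / 1) (+ p / 1) (exponent i v)))
              (trans (cong (ℚ._* exponent i v) (trans (sym (/1-* (ℤ.- κ) (+ p))) (trans (cong (_/ 1) s+t₀) (sym (ratio-t t₀))))) (ratio-* i v v≢0 u₀)))

          case : Dec (YIntegral u₀) → lhs u₀ ≡ ζ′.extend f (eliminate i v v≢0 x)
          case (yes u₀-int) = trans (ζ-extend-yes (ρV.extend f) u₀ u₀-int)
            (trans (cong (maybe′ f 0ℚ) (ρ-yes i V V≢0 u₀ u₀-ratio))
              (trans (cong f (trans (eliminate-power u₀) (eliminate-v^ x (+ t₀ / 1))))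
                (sym (ζ-extend-yes f (eliminate i v v≢0 x) (subst YIntegral (sym eliminated) (YIntegral-· u₀ _ u₀-int V^κ-int))))))
          case (no ¬u₀-int) = trans (ζ-extend-no (ρV.extend f) u₀ ¬u₀-int)
            (sym (ζ-extend-no f (eliminate i v v≢0 x) λ e-int → ¬u₀-int
              (YIntegral-/ (V ^ℚ (κ / 1)) u₀ V^κ-int (subst YIntegral (trans eliminated (·-comm u₀ (V ^ℚ (κ / 1)))) e-int))))

    commutation : YIntegral V → ∀ N → ρV.T (ζ′.T (N *ᴸ geom v p)) ≐ ζ′.T (ρv.T N)
    commutation V-int N = mk≐ λ f → trans (ρV.⟪T⟫ (ζ′.T (N *ᴸ geom v p)) f) (trans (ζ′.⟪T⟫ (N *ᴸ geom v p) (ρV.extend f))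
      (trans (⟪*⟫ N (geom v p) (lhs f)) (trans (⟪⟫-cong N (λ x → monomial f x (isInteger? (ratio i v v≢0 x))))
        (sym (trans (ζ′.⟪T⟫ (ρv.T N) f) (ρv.⟪T⟫ N (ζ′.extend f)))))))
      where
      monomial : ∀ f x → Dec (IsInteger (ratio i v v≢0 x)) → ⟪ geom v p ⟫ (λ u → lhs f (x · u)) ≡ ρv.extend (ζ′.extend f) x
      monomial f x (yes int) = integral f V-int x int
      monomial f x (no ¬int) = non-integral f x ¬int

  -- Comparison of the two orders of CT and 𝒵

  ^-⁻¹ : ∀ z q → (z ⁻¹) ^ℚ q ≡ (z ^ℚ q) ⁻¹
  ^-⁻¹ z q = lookup-ext λ t → trans (lookup-^ (z ⁻¹) q t) (trans (cong (q ℚ.*_) (lookup-⁻¹ z t))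
    (trans (sym (ℚₚ.neg-distribʳ-* q (lookup z t))) (sym (trans (lookup-⁻¹ (z ^ℚ q) t) (cong (λ a → ℚ.- a) (lookup-^ z q t))))))

  YIntegral-⁻¹ : ∀ x → YIntegral x → YIntegral (x ⁻¹)
  YIntegral-⁻¹ x = All.map λ {j} int → subst IsInteger (sym (lookup-⁻¹ x (y j))) (IsInteger-neg (lookup x (y j)) int)

  YIntegral-nonneg : ∀ x → YIntegral (proj₁ x) → YIntegral (proj₁ (nonneg i x))
  YIntegral-nonneg x int = case (nonneg-cases x)
    where
    case : proj₁ (nonneg i x) ≡ proj₁ x ⊎ proj₁ (nonneg i x) ≡ proj₁ x ⁻¹ → YIntegral (proj₁ (nonneg i x))
    case (inj₁ eq) = subst YIntegral (sym eq) int
    case (inj₂ eq) = subst YIntegral (sym eq) (YIntegral-⁻¹ (proj₁ x) int)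

  inv-direction : ∀ x → ∃ λ L → inv x K.* ι (1- proj₁ (nonneg i x)) ≃ ι L
  inv-direction x with 0ℚ ℚ.≤? exponent i (proj₁ x)
  ... | yes _ = 1ᴸ , inv-* x
  ... | no  _ = negᴸ (mono (proj₁ x ⁻¹)) , (begin
    inv x K.* ι (1- (proj₁ x ⁻¹))                                           ≈⟨ K.*-congʳ (inv-inverse x (x ⁻¹≢1) refl) ⟩
    K.- (μ (proj₁ x ⁻¹) K.* inv (x ⁻¹≢1)) K.* ι (1- (proj₁ x ⁻¹))           ≈⟨ -‿distribˡ-* _ _ ⟨
    K.- (μ (proj₁ x ⁻¹) K.* inv (x ⁻¹≢1) K.* ι (1- (proj₁ x ⁻¹)))           ≈⟨ K.-‿cong (K.trans (K.*-assoc _ _ _) (K.trans (K.*-congˡ {μ (proj₁ x ⁻¹)} (inv-* (x ⁻¹≢1))) (K.*-identityʳ _))) ⟩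
    K.- μ (proj₁ x ⁻¹)                                                      ≈⟨ ι-neg (mono (proj₁ x ⁻¹)) ⟨
    ι (negᴸ (mono (proj₁ x ⁻¹)))                                            ∎)

  CT-exists : ∀ F → Separated (factor F) → ∀ j w → factor F j ≡ just w → exponent i (proj₁ w) ≢ 0ℚ → ∃ (CT i j F)
  CT-exists F separated j w Fj w≢0 = _at0 i (PartialFractions.A D j) , (w , Fj , w≢0) , D , λ _ → refl
    where
    D : PartialFractions i F
    D = partial-fractions F separated

  module _ (c : Clearing) where
    open Clearing c

    lookup-clear : ∀ x t → lookup (proj₁ (clear x)) t ≡ (+ p (proj₁ x) / 1) ℚ.* lookup (proj₁ x) t
    lookup-clear x t = lookup-^ (proj₁ x) (+ p (proj₁ x) / 1) t

    lookup-clear-≢0 : ∀ x t → lookup (proj₁ x) t ≢ 0ℚ → lookup (proj₁ (clear x)) t ≢ 0ℚ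
    lookup-clear-≢0 x t ne = *-≢0 (+ p (proj₁ x) / 1) (lookup (proj₁ x) t) (ℕ⇒ℚ-≢0 (p (proj₁ x)) {{positive (proj₁ x)}}) ne
      ∘ trans (sym (lookup-clear x t))

    lookup-clear-≡0 : ∀ x t → lookup (proj₁ x) t ≡ 0ℚ → lookup (proj₁ (clear x)) t ≡ 0ℚ
    lookup-clear-≡0 x t eq = trans (lookup-clear x t) (trans (cong ((+ p (proj₁ x) / 1) ℚ.*_) eq) (ℚₚ.*-zeroʳ (+ p (proj₁ x) / 1)))

    separated-clear : ∀ f → Separated f → Separated (Maybe.map clear ∘ f)
    separated-clear f separated ℓ x eq =
      let x₀ , eq₀ , same = map-just clear (f ℓ) eq in
      subst (λ u → lookup (proj₁ u) (y ℓ) ≢ 0ℚ) same (lookup-clear-≢0 x₀ (y ℓ) (proj₁ (separated ℓ x₀ eq₀))) ,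
      λ ℓ′ x′ eq′ ne → let x₀′ , eq₀′ , same′ = map-just clear (f ℓ′) eq′ in
        subst (λ u → lookup (proj₁ u) (y ℓ) ≡ 0ℚ) same′
          (lookup-clear-≡0 x₀′ (y ℓ) (proj₂ (separated ℓ x₀ eq₀) ℓ′ x₀′ eq₀′ ne))

    𝒵ˡ-⌞⌟ : ∀ F → ⌞ 𝒵ˡ c F ⌟ ≡ 𝒵 c ⌞ F ⌟
    𝒵ˡ-⌞⌟ F = cong (λ d → Clearing.𝒵num c ⌞ F ⌟ /∏ d) (sym (Listₚ.map-mapMaybe clear (factor F) (allFin n)))

    module _ (F : Labelled) (separated : Separated (factor F)) (j : Fin n) (w : Mono≢1) (Fj : factor F j ≡ just w)
             (w≢0 : exponent i (proj₁ w) ≢ 0ℚ) where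

      private
        q : ℕ
        q = p (proj₁ w)

        instance
          q≢0 : ℕ.NonZero q
          q≢0 = positive (proj₁ w)

        v V : Mono
        v = proj₁ (nonneg i w)
        V = proj₁ (nonneg i (clear w))

        W≢0 : exponent i (proj₁ (clear w)) ≢ 0ℚ
        W≢0 = lookup-clear-≢0 w (lam i) w≢0

        v≢0 : exponent i v ≢ 0ℚ
        v≢0 = nonneg-≢0 w (lam i) w≢0

        V≢0 : exponent i V ≢ 0ℚ
        V≢0 = nonneg-≢0 (clear w) (lam i) W≢0

        V-eq : V ≡ v ^[ q ]
        V-eq = nonneg-scaled q (_^[ q ]) (λ z → ^-⁻¹ z (+ q / 1)) w (clear w) refl (lookup-^ (proj₁ w) (+ q / 1) (lam i))

        V-integral : YIntegral V
        V-integral = YIntegral-nonneg (clear w) (clears c (proj₁ w))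

        -- The factors 1 - z and 1 - u are untouched by 𝒵, and the residue operators in
        -- the directions v and V = v^q map z to u.
        Nice : Mono≢1 → Mono≢1 → Set
        Nice (z , _) (u , _) =
          (PartialHom.to (ρ i v v≢0) z ≡ just u × PartialHom.to (ρ i V V≢0) z ≡ just u) × YIntegral z × YIntegral u

        nice-power : ∀ ℓ x → factor F ℓ ≡ just x → ℓ ≢ j → ∃ λ k → ∃ λ z → proj₁ z ≡ proj₁ x ^[ k ] × ∃ (Nice z)
        nice-power ℓ x eq ℓ≢j = k , z , refl , u ,
          ( ρ-yes i v v≢0 (proj₁ z) (subst IsInteger (sym (ratio-power v v≢0 q V V≢0 V-eq (proj₁ z)))
              (IsInteger-* (+ q / 1) (ratio i V V≢0 (proj₁ z)) (IsInteger-/1 (+ q)) ratio-int))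
          , trans (ρ-yes i V V≢0 (proj₁ z) ratio-int) (cong just same)) ,
          z-int ,
          subst YIntegral same (YIntegral-· (proj₁ z) _ z-int
            (YIntegral-^ V (ℚ.- ratio i V V≢0 (proj₁ z)) (IsInteger-neg (ratio i V V≢0 (proj₁ z)) ratio-int) V-integral))
          where
          -- One exponent k clears the ratio along V together with all exponents of 𝐲 in x. The
          -- ratio along v is q times the one along V, so it is cleared as well; the image u is z
          -- times an integer power of V and thus integral in 𝐲.
          common : ∃ λ m → ℕ.NonZero m × All (λ s → IsInteger ((+ m / 1) ℚ.* s)) (ratio i V V≢0 (proj₁ x) ∷ List.map (λ t → lookup (proj₁ x) (y t)) (allFin n))
          common = common-denominator _
          k : ℕ
          k = proj₁ common
          instance
            k≢0 : ℕ.NonZero k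
            k≢0 = proj₁ (proj₂ common)
          z : Mono≢1
          z = x ^≢1[ k ]
          v≡0 : lookup v (y ℓ) ≡ 0ℚ
          v≡0 = nonneg-≡0 w (y ℓ) (proj₂ (separated ℓ x eq) j w Fj (ℓ≢j ∘ sym))
          z≢0 : lookup (proj₁ z) (y ℓ) ≢ 0ℚ
          z≢0 = *-≢0 (+ k / 1) (lookup (proj₁ x) (y ℓ)) (ℕ⇒ℚ-≢0 k) (proj₁ (separated ℓ x eq)) ∘ trans (sym (lookup-^ (proj₁ x) (+ k / 1) (y ℓ)))
          u : Mono≢1
          u = eliminate i v v≢0 (proj₁ z) , y ℓ , eliminate-≢0 v v≢0 (proj₁ z) (y ℓ) v≡0 z≢0
          ratio-int : IsInteger (ratio i V V≢0 (proj₁ z))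
          ratio-int = subst IsInteger (sym (ratio-^ V V≢0 (proj₁ x) (+ k / 1))) (All.head (proj₂ (proj₂ common)))
          z-int : YIntegral (proj₁ z)
          z-int = All.map (λ {t} int → subst IsInteger (sym (lookup-^ (proj₁ x) (+ k / 1) (y t))) int) (Allₚ.map⁻ (All.tail (proj₂ (proj₂ common))))
          same : eliminate i V V≢0 (proj₁ z) ≡ eliminate i v v≢0 (proj₁ z)
          same = eliminate-power v v≢0 q V V≢0 V-eq (proj₁ z)

        -- The factor d is 1 for a list of labels without j, and 1 - v once j has been included.
        Representation : Fraction → FracRat → Set
        Representation d G = ∃ λ N → ∃ λ zs → ∃ λ us → Pointwise Nice zs us × frac G K.* (d K.* ι (∏1- zs)) ≃ ι N

        over : List (Fin n) → FracRat
        over ℓs = num ⌞ F ⌟ /∏ List.mapMaybe (factor F) ℓs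

        over-nothing : ∀ ℓ ℓs → factor F ℓ ≡ nothing → over (ℓ ∷ ℓs) ≡ over ℓs
        over-nothing ℓ ℓs eq rewrite eq = refl

        over-just : ∀ ℓ ℓs x → factor F ℓ ≡ just x → over (ℓ ∷ ℓs) ≡ (over ℓs /1- x)
        over-just ℓ ℓs x eq rewrite eq = refl

        extend : ∀ d ℓ ℓs → ℓ ≢ j → Representation d (over ℓs) → Representation d (over (ℓ ∷ ℓs))
        extend d ℓ ℓs ℓ≢j (N , zs , us , nice , rep) = case (factor F ℓ) refl
          where
          case : ∀ m → factor F ℓ ≡ m → Representation d (over (ℓ ∷ ℓs))
          case nothing  eq = subst (Representation d) (sym (over-nothing ℓ ℓs eq)) (N , zs , us , nice , rep)
          case (just x) eq = let k , z , z-eq , u , z-nice = nice-power ℓ x eq ℓ≢j in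
            subst (Representation d) (sym (over-just ℓ ℓs x eq)) (geom (proj₁ x) k *ᴸ N , z ∷ zs , u ∷ us , z-nice ∷ nice , (begin
              frac (over ℓs /1- x) K.* (d K.* ι ((1- proj₁ z) *ᴸ ∏1- zs))
                ≈⟨ K.*-cong (frac-/-inv (over ℓs) x) (K.*-congˡ {d} (ι-* (1- proj₁ z) (∏1- zs))) ⟩
              frac (over ℓs) K.* inv x K.* (d K.* (ι (1- proj₁ z) K.* ι (∏1- zs)))
                ≈⟨ solveᴷ 5 (λ a b c d e → (a ⊛ b) ⊛ (c ⊛ (d ⊛ e)) ⊜ (d ⊛ b) ⊛ (a ⊛ (c ⊛ e))) K.refl
                     (frac (over ℓs)) (inv x) d (ι (1- proj₁ z)) (ι (∏1- zs)) ⟩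
              ι (1- proj₁ z) K.* inv x K.* (frac (over ℓs) K.* (d K.* ι (∏1- zs)))
                ≈⟨ K.*-cong (K.trans (K.*-congʳ (K.reflexive (cong (λ e → ι (1- e)) z-eq))) (K.sym (ι-geom x k))) rep ⟩
              ι (geom (proj₁ x) k) K.* ι N
                ≈⟨ ι-* (geom (proj₁ x) k) N ⟨
              ι (geom (proj₁ x) k *ᴸ N) ∎))

        rest : ∀ ℓs → All (_≢ j) ℓs → Representation K.1# (over ℓs)
        rest []       []         = num ⌞ F ⌟ , [] , [] , [] , K.trans (K.*-cong (frac-/∏[] (num ⌞ F ⌟)) (K.*-identityʳ K.1#)) (K.*-identityʳ _)
        rest (ℓ ∷ ℓs) (ne ∷ nes) = extend K.1# ℓ ℓs ne (rest ℓs nes)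

        all : ∀ ℓs → Unique ℓs → j ∈ ℓs → Representation (ι (1- v)) (over ℓs)
        all (ℓ ∷ ℓs) (fresh ∷ unique) (there j∈) = extend (ι (1- v)) ℓ ℓs (All.lookup fresh j∈) (all ℓs unique j∈)
        all (ℓ ∷ ℓs) (fresh ∷ unique) (here refl) =
          let N , zs , us , nice , rep = rest ℓs (All.map (λ ne → ne ∘ sym) fresh)
              -- L is 1 or -w⁻¹, the unit by which 1 - v differs from 1 - w when w has to be
              -- inverted.
              L , direction = inv-direction w
          in subst (Representation (ι (1- v))) (sym (over-just ℓ ℓs w Fj)) (L *ᴸ N , zs , us , nice , (begin
            frac (over ℓs /1- w) K.* (ι (1- v) K.* ι (∏1- zs))
              ≈⟨ K.*-congʳ (frac-/-inv (over ℓs) w) ⟩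
            frac (over ℓs) K.* inv w K.* (ι (1- v) K.* ι (∏1- zs))
              ≈⟨ solveᴷ 4 (λ a b c d → (a ⊛ b) ⊛ (c ⊛ d) ⊜ (b ⊛ c) ⊛ (a ⊛ (conᴷ 1 ⊛ d))) K.refl
                   (frac (over ℓs)) (inv w) (ι (1- v)) (ι (∏1- zs)) ⟩
            inv w K.* ι (1- v) K.* (frac (over ℓs) K.* (K.1# K.* ι (∏1- zs)))
              ≈⟨ K.*-cong direction rep ⟩
            ι L K.* ι N
              ≈⟨ ι-* L N ⟨
            ι (L *ᴸ N) ∎))

        module _ (c′ : Clearing) {N : Laurent} {zs us : List Mono≢1} (nice : Pointwise Nice zs us)
                 (rep : frac ⌞ F ⌟ K.* (ι (1- v) K.* ι (∏1- zs)) ≃ ι N) where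

          us-fixed : Images ζ us us
          us-fixed = fixed nice
            where
            fixed : ∀ {zs us} → Pointwise Nice zs us → Images ζ us us
            fixed []       = []
            fixed (_∷_ {y = u} (_ , _ , u-int) hs) = ζ-yes (proj₁ u) u-int ∷ fixed hs

          zs-fixed : Images ζ zs zs
          zs-fixed = fixed nice
            where
            fixed : ∀ {zs us} → Pointwise Nice zs us → Images ζ zs zs
            fixed []       = []
            fixed (_∷_ {x = z} (_ , z-int , _) hs) = ζ-yes (proj₁ z) z-int ∷ fixed hs

          𝒵-CT-value : ∀ {H} → CT i j F H → frac (𝒵 c′ H) K.* ι (∏1- us) ≃ ι (PartialHom.T ζ (PartialHom.T (ρ i v v≢0) N))
          𝒵-CT-value {H} ct = K.trans (K.*-congˡ {frac (𝒵 c′ H)} (ι-cong (≐-sym (Images-T ζ us-fixed))))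
            (𝒵-value c′ H (Good.dom (Images-Good ζ us-fixed))
              (CT-value F separated j w Fj v refl v≢0 w≢0 (Pointwise.map (proj₁ ∘ proj₁) nice) rep {H} ct))

          𝒵-rep : frac ⌞ 𝒵ˡ c F ⌟ K.* (ι (1- V) K.* ι (∏1- zs)) ≃ ι (PartialHom.T ζ (N *ᴸ geom v q))
          𝒵-rep = begin
            frac ⌞ 𝒵ˡ c F ⌟ K.* (ι (1- V) K.* ι (∏1- zs))
              ≈⟨ K.*-cong (K.reflexive (cong frac (𝒵ˡ-⌞⌟ F))) (K.trans (K.sym (ι-* (1- V) (∏1- zs))) (ι-cong (≐-sym fixed))) ⟩
            frac (𝒵 c ⌞ F ⌟) K.* ι (PartialHom.T ζ ((1- V) *ᴸ ∏1- zs))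
              ≈⟨ 𝒵-value c ⌞ F ⌟ (PartialHom.Dom-* ζ V-dom (Good.dom (Images-Good ζ zs-fixed))) multiplied ⟩
            ι (PartialHom.T ζ (N *ᴸ geom v q)) ∎
            where
            V-dom : PartialHom.Dom ζ (1- V)
            V-dom = PartialHom.Dom-1- ζ (ζ-yes V V-integral)
            fixed : PartialHom.T ζ ((1- V) *ᴸ ∏1- zs) ≐ (1- V) *ᴸ ∏1- zs
            fixed = ≐-trans (PartialHom.T-* ζ (∏1- zs) V-dom)
              (R.*-cong {PartialHom.T ζ (1- V)} {1- V} (R.reflexive (PartialHom.T-1- ζ (ζ-yes V V-integral))) (Images-T ζ zs-fixed))
            multiplied : frac ⌞ F ⌟ K.* ι ((1- V) *ᴸ ∏1- zs) ≃ ι (N *ᴸ geom v q)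
            multiplied = begin
              frac ⌞ F ⌟ K.* ι ((1- V) *ᴸ ∏1- zs)
                ≈⟨ K.*-congˡ {frac ⌞ F ⌟} (ι-* (1- V) (∏1- zs)) ⟩
              frac ⌞ F ⌟ K.* (ι (1- V) K.* ι (∏1- zs))
                ≈⟨ K.*-congˡ {frac ⌞ F ⌟} (K.*-congʳ (K.trans (K.reflexive (cong (λ e → ι (1- e)) V-eq))
                     (K.trans (ι-cong (≐-sym (1-*geom v q))) (ι-* (1- v) (geom v q))))) ⟩
              frac ⌞ F ⌟ K.* (ι (1- v) K.* ι (geom v q) K.* ι (∏1- zs))
                ≈⟨ solveᴷ 4 (λ a b c d → a ⊛ ((b ⊛ c) ⊛ d) ⊜ (a ⊛ (b ⊛ d)) ⊛ c) K.refl
                     (frac ⌞ F ⌟) (ι (1- v)) (ι (geom v q)) (ι (∏1- zs)) ⟩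
              frac ⌞ F ⌟ K.* (ι (1- v) K.* ι (∏1- zs)) K.* ι (geom v q)
                ≈⟨ K.*-congʳ rep ⟩
              ι N K.* ι (geom v q)
                ≈⟨ ι-* N (geom v q) ⟨
              ι (N *ᴸ geom v q) ∎

          CT-𝒵-value : ∀ {G} → CT i j (𝒵ˡ c F) G → frac G K.* ι (∏1- us) ≃ ι (PartialHom.T (ρ i V V≢0) (PartialHom.T ζ (N *ᴸ geom v q)))
          CT-𝒵-value {G} = CT-value (𝒵ˡ c F) (separated-clear (factor F) separated) j (clear w) (cong (Maybe.map clear) Fj)
            V refl V≢0 W≢0 (Pointwise.map (proj₂ ∘ proj₁) nice) 𝒵-rep {G}

          agree : ∀ {G H} → CT i j (𝒵ˡ c F) G → CT i j F H → frac G ≃ frac (𝒵 c′ H)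
          agree {G} {H} ctG ctH = ι-cancelʳ (∏1-‿regular us) (K.trans (CT-𝒵-value {G} ctG)
            (K.trans (ι-cong (commutation v v≢0 q V V≢0 V-eq V-integral N)) (K.sym (𝒵-CT-value {H} ctH))))

      interchange : ∀ c′ G H → CT i j (𝒵ˡ c F) G → CT i j F H → G ≈ 𝒵 c′ H
      interchange c′ G H ctG ctH =
        let N , zs , us , nice , rep = all (allFin n) (Uniqueₚ.allFin⁺ n) (∈-allFin j)
        in ≃⇒≈ {G} {𝒵 c′ H} (agree c′ nice rep {G} {H} ctG ctH)

-- The denominator factors of a bracket

module Brackets (n r : ℕ) where

  open Fractional n r
  open Series n r

  δ-off : ∀ {s t} → s ≢ t → δ s t ≡ 0ℚ
  δ-off {s} {t} s≢t with s Finₚ.≟ t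
  ... | yes eq = contradiction eq s≢t
  ... | no  _  = refl

  column-y : ∀ I O s t → lookup (column I O s) (y t) ≡ O (y t) s
  column-y I O s t = trans (Vecₚ.lookup∘tabulate (Column.entry I O s) (y t))
    (cong (Column.omit I O s (y t)) (Finₚ.splitAt-↑ˡ n t r))

  column-lam : ∀ I O s i → i ∉ I → lookup (column I O s) (lam i) ≡ O (lam i) s
  column-lam I O s i i∉I = trans (Vecₚ.lookup∘tabulate (Column.entry I O s) (lam i))
    (trans (cong (Column.omit I O s (lam i)) (Finₚ.splitAt-↑ʳ n r i)) kept)
    where
    kept : Column.omit I O s (lam i) (inj₂ i) ≡ O (lam i) s
    kept with i ∈? I
    ... | yes i∈I = contradiction i∈I i∉I
    ... | no  _   = refl

  module _ {A : Fin r → Fin n → ℤ} {b : Fin r → ℤ} {k I J O} (π : Pivots A b k I J O) where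

    bracket-factor : ∀ ℓ x → factor (bracket π) ℓ ≡ just x → ℓ ∉ J × proj₁ x ≡ column I O (col ℓ)
    bracket-factor ℓ x eq with ℓ ∈? J
    bracket-factor ℓ x refl | no ℓ∉J = ℓ∉J , refl

    bracket-has-factor : ∀ j → j ∉ J → ∃ λ w → factor (bracket π) j ≡ just w
    bracket-has-factor j j∉J with j ∈? J
    ... | yes j∈J = contradiction j∈J j∉J
    ... | no  _   = _ , refl

    -- By `row-fixed`, the row of y_ℓ with ℓ outside J is still that of the identity matrix. So y_ℓ
    -- has exponent 1 in the ℓ-th factor and does not occur in the others.
    bracket-separated : ∀ i → PartialFraction.Separated n r i (factor (bracket π))
    bracket-separated i ℓ x eq = let ℓ∉J , x-eq = bracket-factor ℓ x eq in
      (λ x≡0 → ℚₚ.1≢0 (trans (sym (column-diagonal π ℓ∉J)) (trans (cong (λ e → lookup e (y ℓ)) (sym x-eq)) x≡0))) ,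
      λ ℓ′ x′ eq′ ℓ′≢ℓ → let ℓ′∉J , x′-eq = bracket-factor ℓ′ x′ eq′ in
        trans (cong (λ e → lookup e (y ℓ)) x′-eq) (trans (column-y I O (col ℓ′) ℓ)
          (trans (row-fixed π ℓ∉J ℓ′) (δ-off (ℓ′≢ℓ ∘ sym))))

-- As `CT` is a relation, the equation consists of the existence of a value on either side and the
-- agreement of any two values. The clearings `c` and `c′` are independent, because 𝒵 is applied to
-- different functions on the two sides and any admissible exponents may be chosen for each.
proposition11 : (n r : ℕ) → let open Fractional n r in
    (A : Fin r → Fin n → ℤ) (b : Fin r → ℤ)
    (k : ℕ) (I : Subset r) (J : Subset n) (O : Matrix) (π : Pivots A b k I J O)
    (i : Fin r) (j : Fin n) → i ∉ I → j ∉ J → O (lam i) (col j) ≢ 0ℚ →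
    (c c′ : Clearing) →
    (∃ λ G → CT i j (𝒵ˡ c (bracket π)) G)
    × (∃ λ H → CT i j (bracket π) H)
    × (∀ G H → CT i j (𝒵ˡ c (bracket π)) G → CT i j (bracket π) H → G ≈ 𝒵 c′ H)
proposition11 n r A b k I J O π i j i∉I j∉J O≢0 c c′ =
  let w , Fj = bracket-has-factor π j j∉J
      w≢0 : exponent i (proj₁ w) ≢ 0ℚ
      w≢0 = λ eq → O≢0 (trans (sym (column-lam I O (col j) i i∉I))
        (trans (cong (λ e → lookup e (lam i)) (sym (proj₂ (bracket-factor π j w Fj)))) eq))
  in CT-exists (𝒵ˡ c (bracket π)) (separated-clear c (factor (bracket π)) (bracket-separated π i)) j
       (Clearing.clear c w) (cong (Maybe.map (Clearing.clear c)) Fj) (lookup-clear-≢0 c w (lam i) w≢0) ,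
     CT-exists (bracket π) (bracket-separated π i) j w Fj w≢0 ,
     interchange c (bracket π) (bracket-separated π i) j w Fj w≢0 c′
  where
  open Fractional n r
  open Brackets n r
  open PartialFraction n r i
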